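{- Let $e\ge 3$ be an odd integer, $q=2^e$, and let $\mathcal{C}^3_\varepsilon:=\mathcal{C}(\mathcal{V}^3_\varepsilon)$ be the code over $\mathbb{F}_{q^2}$ generated by the point set $\mathcal{V}^3_\varepsilon\subset\mathrm{PG}(3,q^2)$ (defined in the context, with $r=3$). Then $\mathcal{C}^3_\varepsilon$ is a linear code of length $|\mathcal{V}^3_\varepsilon|$ and dimension $4$ with minimum distance $d=|\mathcal{V}^3_\varepsilon|-q^3-q^2-1$. Moreover, its $m$-th generalized Hamming weights $d_m$, $m\in\{1,2,3\}$, are $$d_1=|\mathcal{V}^3_\varepsilon|-q^3-q^2-1,\qquad d_2=|\mathcal{V}^3_\varepsilon|-q^2-1,\qquad d_3=|\mathcal{V}^3_\varepsilon|-1.$$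
   Context: Let $e\ge 3$ be odd, $q=2^e$, $r\ge 2$. Points of $\mathrm{PG}(r,q^2)$ (projective space of projective dimension $r$ over $\mathbb{F}_{q^2}$) have homogeneous coordinates $(X_0,\dots,X_r)$; $\Pi_\infty$ is the hyperplane $X_0=0$, and affine coordinates on the complement $\mathrm{AG}(r,q^2)$ are $x_i=X_i/X_0$. For an exponent involving $\sigma$, $\sigma$ stands for $2^{(e+1)/2}$, i.e. $x^{\sigma}=x^{2^{(e+1)/2}}$ and $x^{\sigma+2}=x^{2^{(e+1)/2}+2}$. Fix $\varepsilon\in\mathbb{F}_{q^2}\setminus\mathbb{F}_q$ such that $\varepsilon^2+\varepsilon+\delta=0$ for some $\delta\in\mathbb{F}_q\setminus\{1\}$ with absolute trace $\mathrm{Tr}_{q/2}(\delta)=\sum_{i=0}^{e-1}\delta^{2^i}=1$. Put $$\Gamma_{\varepsilon}(x)=[x+(x^q+x)\varepsilon]^{\sigma+2}+(x^q+x)^{\sigma}+(x^{2q}+x^2)\varepsilon+x^{q+1}+x^2.$$ $\mathcal{V}^r_\varepsilon$ is the projective hypersurface of $\mathrm{PG}(r,q^2)$ with affine equation $x_r^q+x_r=\Gamma_{\varepsilon}(x_1)+\dots+\Gamma_{\varepsilon}(x_{r-1})$, i.e. the zero locus of the homogenization (with respect to $X_0$) of the corresponding polynomial; it is identified with its set of $\mathbb{F}_{q^2}$-rational points. For a set $\Omega$ of $N$ points of $\mathrm{PG}(r,q^2)$, $\mathcal{C}(\Omega)$ is the linear code of length $N$ over $\mathbb{F}_{q^2}$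 spanned by the rows of an $(r+1)\times N$ matrix whose columns are coordinate vectors of the points of $\Omega$ (one representative per point); it is unique up to monomial equivalence. The support of a (sub)code is the union of the supports of its codewords, where $\mathrm{supp}(c)=\{i:c_i\neq 0\}$. The $m$-th generalized Hamming weight (called $m$-th higher minimum weight) of $\mathcal{C}$ is $d_m(\mathcal{C})=\min\{|\mathrm{supp}(\mathcal{D})| : \mathcal{D}\le\mathcal{C},\ \dim\mathcal{D}=m\}$. -}

module Defs where

open import Algebra.Bundles using (CommutativeRing; RawSemiring; Semiring)
open import Algebra.Structures using (IsCommutativeRing)
import Algebra.Definitions.RawSemiring as RawSemiringDefs
open import Data.Bool using (if_then_else_)
open import Data.Fin using (Fin; toℕ; fromℕ; inject₁)
open import Data.Fin.Properties using (inj⇒≟)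
open import Data.Fin.Subset using (Subset; _∈_; ∣_∣)
open import Data.List using (List; []; _∷_; _++_; map; filter; foldr; cartesianProductWith; [_])
open import Data.List.Extrema.Nat using (max)
open import Data.Nat as ℕ using (ℕ; suc; NonZero)
open import Data.Nat.DivMod using (_/_)
import Data.Nat.Properties as ℕ
open import Data.Product using (Σ-syntax; ∃-syntax; _×_; _,_; proj₁; proj₂)
open import Data.Vec as Vec using (Vec; lookup; tabulate; transpose; replicate; zipWith; _[_]≔_)
import Data.Vec.Properties as Vec
open import Function using (_∘_)
open import Function.Bundles using (_↔_; _⇔_; Bijection)
open import Function.Properties.Inverse using (↔-sym; ↔⇒↣)
open import Level using (0ℓ)
open import Relation.Binary using (Setoid; DecidableEquality)
open import Relation.Binary.PropositionalEquality
  using (_≡_; _≢_; refl; sym; trans; cong; setoid)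
open import Relation.Nullary using (does)
open import Relation.Nullary.Decidable using (¬?)
open import Relation.Unary using (Pred; _⊆_)

record FiniteField (n : ℕ) : Set₁ where
  infixl 7 _*_
  infixl 6 _+_
  infix  8 -_
  field
    Carrier           : Set
    _+_ _*_           : Carrier → Carrier → Carrier
    -_                : Carrier → Carrier
    0# 1#             : Carrier
    isCommutativeRing : IsCommutativeRing _≡_ _+_ _*_ -_ 0# 1#
    0≢1               : 0# ≢ 1#
    invertible        : ∀ x → x ≢ 0# → ∃[ y ] x * y ≡ 1#
    enumeration       : Fin n ↔ Carrier

  commutativeRing : CommutativeRing 0ℓ 0ℓ
  commutativeRing = record { isCommutativeRing = isCommutativeRing }

  open CommutativeRing commutativeRing public
    using (semiring; *-assoc; *-comm; *-identityˡ; zeroˡ)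

  infix 4 _≟_
  _≟_ : DecidableEquality Carrier
  _≟_ = inj⇒≟ (↔⇒↣ (↔-sym enumeration))

IsMinimum : Pred ℕ 0ℓ → ℕ → Set
IsMinimum P n = P n × (∀ k → P k → n ℕ.≤ k)

-- The same, for predicates quantifying over (small) predicates.
IsMinimum₁ : (ℕ → Set₁) → ℕ → Set₁
IsMinimum₁ P n = P n × (∀ k → P k → n ℕ.≤ k)

module Over {n : ℕ} (K : FiniteField n) where

  open FiniteField K
  open RawSemiringDefs (Semiring.rawSemiring semiring) using (_^_; sum; product)

  -- For q² = n, the subfield of order q consists of the roots of X^q - X.
  InSubfield : ℕ → Pred Carrier 0ℓ
  InSubfield q x = x ^ q ≡ x

  -- Absolute trace from the field with 2^e elements to the prime field.
  absoluteTrace : ℕ → Carrier → Carrier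
  absoluteTrace e x = sum {e} (λ i → x ^ (2 ℕ.^ toℕ i))

  ----------------------------------------------------------------------
  -- Polynomials in k variables, as formal sums of terms (coefficient,
  -- exponent vector).  An exponent vector may occur several times, so the
  -- actual coefficients are those given by coeff.

  Poly : ℕ → Set
  Poly k = List (Carrier × Vec ℕ k)

  coeff : ∀ {k} → Poly k → Vec ℕ k → Carrier
  coeff p α = foldr (λ (c , β) s → if does (Vec.≡-dec ℕ._≟_ β α) then c + s else s) 0# p

  constant : ∀ {k} → Carrier → Poly k
  constant {k} c = [ (c , replicate k 0) ]

  var : ∀ {k} → Fin k → Poly k
  var {k} i = [ (1# , replicate k 0 [ i ]≔ 1) ]

  poly-rawSemiring : ℕ → RawSemiring 0ℓ 0ℓ
  poly-rawSemiring k = record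
    { Carrier = Poly k
    ; _≈_     = λ p r → ∀ α → coeff p α ≡ coeff r α
    ; _+_     = _++_
    ; _*_     = cartesianProductWith λ (c , α) (d , β) → c * d , zipWith ℕ._+_ α β
    ; 0#      = []
    ; 1#      = constant 1#
    }

  negate : ∀ {k} → Poly k → Poly k
  negate = map λ (c , α) → - c , α

  eval : ∀ {k} → Poly k → Vec Carrier k → Carrier
  eval p x = foldr (λ (c , α) s → c * product (λ i → lookup x i ^ lookup α i) + s) 0# p

  -- Total degree; only terms whose coefficient survives cancellation count.
  -- The zero polynomial gets degree 0.
  degree : ∀ {k} → Poly k → ℕ
  degree p = max 0 (map (Vec.sum ∘ proj₂) (filter (λ (_ , α) → ¬? (coeff p α ≟ 0#)) p))

  -- The new variable X₀ comes first.  Terms of degree above degree p cancel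
  -- in p; the truncated subtraction gives them all X₀-exponent 0, so they
  -- cancel in the homogenization as well.
  homogenize : ∀ {k} → Poly k → Poly (suc k)
  homogenize p = map (λ (c , α) → c , (degree p ℕ.∸ Vec.sum α) Vec.∷ α) p

  ----------------------------------------------------------------------
  -- Projective space and hypersurfaces

  infixr 7 _·_
  _·_ : ∀ {k} → Carrier → Vec Carrier k → Vec Carrier k
  c · x = Vec.map (c *_) x

  0ᵛ : ∀ {k} → Vec Carrier k
  0ᵛ {k} = replicate k 0#

  infix 4 _∼_
  _∼_ : ∀ {k} → Vec Carrier k → Vec Carrier k → Set
  x ∼ y = ∃[ c ] c ≢ 0# × c · x ≡ y

  private
    ·-1 : ∀ {k} (x : Vec Carrier k) → 1# · x ≡ x
    ·-1 x = trans (Vec.map-cong *-identityˡ x) (Vec.map-id x)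

    ·-· : ∀ {k} c d (x : Vec Carrier k) → c · d · x ≡ (c * d) · x
    ·-· c d x = trans (sym (Vec.map-∘ (c *_) (d *_) x))
                      (Vec.map-cong (λ y → sym (*-assoc c d y)) x)

    inverse-nonzero : ∀ {c d} → c * d ≡ 1# → c ≢ 0#
    inverse-nonzero {d = d} cd≡1 refl = 0≢1 (trans (sym (zeroˡ d)) cd≡1)

    ∼-refl : ∀ {k} {x : Vec Carrier k} → x ∼ x
    ∼-refl {x = x} = 1# , (0≢1 ∘ sym) , ·-1 x

    ∼-sym : ∀ {k} {x y : Vec Carrier k} → x ∼ y → y ∼ x
    ∼-sym {x = x} (c , c≢0 , refl) with invertible c c≢0
    ... | d , cd≡1 = d , inverse-nonzero dc≡1 ,
                     trans (·-· d c x) (trans (cong (_· x) dc≡1) (·-1 x))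
      where
      dc≡1 : d * c ≡ 1#
      dc≡1 = trans (*-comm d c) cd≡1

    ∼-trans : ∀ {k} {x y z : Vec Carrier k} → x ∼ y → y ∼ z → x ∼ z
    ∼-trans {x = x} (c , c≢0 , refl) (d , d≢0 , refl) = d * c , dc≢0 , sym (·-· d c x)
      where
      dc≢0 : d * c ≢ 0#
      dc≢0 dc≡0 with invertible d d≢0
      ... | d′ , dd′≡1 = c≢0 (trans (sym (*-identityˡ c))
              (trans (cong (_* c) (trans (sym dd′≡1) (*-comm d d′)))
              (trans (*-assoc d′ d c)
              (trans (cong (d′ *_) dc≡0)
              (trans (*-comm d′ 0#) (zeroˡ d′))))))

  -- A set of points of PG(r, K), given by a property of coordinate vectors;
  -- the zero vector is discarded in points below.
  PointSet : ℕ → Set₁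
  PointSet r = Pred (Vec Carrier (suc r)) 0ℓ

  points : ∀ {r} → PointSet r → Setoid 0ℓ 0ℓ
  points {r} Ω = record
    { Carrier       = Σ[ x ∈ Vec Carrier (suc r) ] x ≢ 0ᵛ × Ω x
    ; _≈_           = λ P Q → proj₁ P ∼ proj₁ Q
    ; isEquivalence = record { refl = ∼-refl ; sym = ∼-sym ; trans = ∼-trans }
    }

  -- A listing of the points of Ω without repetition, so that N = |Ω|; it
  -- chooses one coordinate vector for each point.
  Enumeration : ∀ {r} → ℕ → PointSet r → Set
  Enumeration N Ω = Bijection (setoid (Fin N)) (points Ω)

  -- Meaningful as a set of projective points when H is homogeneous.
  zeroLocus : ∀ {r} → Poly (suc r) → PointSet r
  zeroLocus H x = eval H x ≡ 0#

  module _ (e : ℕ) (ε : Carrier) where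

    private
      q σ : ℕ
      q = 2 ℕ.^ e
      σ = 2 ℕ.^ ((e ℕ.+ 1) / 2)

    Γ : ∀ {k} → Poly k → Poly k
    Γ {k} x = (x ⊕ (x ↑ q ⊕ x) ⊗ constant ε) ↑ (σ ℕ.+ 2)
            ⊕ (x ↑ q ⊕ x) ↑ σ
            ⊕ (x ↑ (2 ℕ.* q) ⊕ x ↑ 2) ⊗ constant ε
            ⊕ x ↑ (q ℕ.+ 1)
            ⊕ x ↑ 2
      where
      open RawSemiring (poly-rawSemiring k) using () renaming (_+_ to infixl 6 _⊕_; _*_ to infixl 7 _⊗_)
      open RawSemiringDefs (poly-rawSemiring k) using () renaming (_^_ to infixr 8 _↑_)

    -- x_r^q + x_r - (Γ(x_1) + … + Γ(x_{r-1})); the last variable is x_r.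
    affineEquation : ∀ r → .{{NonZero r}} → Poly r
    affineEquation (suc s) =
      xᵣ ↑ q ⊕ xᵣ ⊕ negate (∑ {s} λ i → Γ (var (inject₁ i)))
      where
      open RawSemiring (poly-rawSemiring (suc s)) using () renaming (_+_ to infixl 6 _⊕_)
      open RawSemiringDefs (poly-rawSemiring (suc s)) using () renaming (_^_ to infixr 8 _↑_; sum to ∑)
      xᵣ : Poly (suc s)
      xᵣ = var (fromℕ s)

    𝒱 : ∀ r → .{{NonZero r}} → PointSet r
    𝒱 r = zeroLocus (homogenize (affineEquation r))

  ----------------------------------------------------------------------
  -- Linear codes

  infixl 6 _+ᵛ_
  _+ᵛ_ : ∀ {N} → Vec Carrier N → Vec Carrier N → Vec Carrier N
  _+ᵛ_ = zipWith _+_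

  Code : ℕ → Set₁
  Code N = Pred (Vec Carrier N) 0ℓ

  record IsLinear {N} (C : Code N) : Set where
    field
      zero-closed : C 0ᵛ
      +-closed    : ∀ {u v} → C u → C v → C (u +ᵛ v)
      ·-closed    : ∀ a {v} → C v → C (a · v)

  linearCombination : ∀ {N k} → Vec Carrier k → Vec (Vec Carrier N) k → Vec Carrier N
  linearCombination as vs = Vec.foldr′ _+ᵛ_ 0ᵛ (zipWith _·_ as vs)

  LinearlyIndependent : ∀ {N k} → Vec (Vec Carrier N) k → Set
  LinearlyIndependent vs = ∀ as → linearCombination as vs ≡ 0ᵛ → as ≡ 0ᵛ

  span : ∀ {N k} → Vec (Vec Carrier N) k → Code N
  span vs v = ∃[ as ] linearCombination as vs ≡ v

  HasDimension : ∀ {N} → Code N → ℕ → Set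
  HasDimension {N} C k =
    Σ[ basis ∈ Vec (Vec Carrier N) k ]
      LinearlyIndependent basis × (∀ v → C v ⇔ span basis v)

  -- The code spanned by the rows of the matrix whose columns are the
  -- coordinate vectors of the enumerated points.
  codeOf : ∀ {r N} {Ω : PointSet r} → Enumeration N Ω → Code N
  codeOf enum = span (transpose (tabulate (proj₁ ∘ Bijection.to enum)))

  differingPositions : ∀ {N} → Vec Carrier N → Vec Carrier N → Subset N
  differingPositions = zipWith (λ a b → does (¬? (a ≟ b)))

  hammingDistance : ∀ {N} → Vec Carrier N → Vec Carrier N → ℕ
  hammingDistance u v = ∣ differingPositions u v ∣

  IsMinimumDistance : ∀ {N} → Code N → ℕ → Set
  IsMinimumDistance C =
    IsMinimum λ d → ∃[ u ] ∃[ v ] C u × C v × u ≢ v × hammingDistance u v ≡ d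

  IsSupport : ∀ {N} → Code N → Subset N → Set
  IsSupport D S = ∀ i → i ∈ S ⇔ (∃[ c ] D c × lookup c i ≢ 0#)

  -- w is the m-th generalized Hamming weight of C.
  IsGeneralizedWeight : ∀ {N} → Code N → ℕ → ℕ → Set₁
  IsGeneralizedWeight {N} C m =
    IsMinimum₁ λ w → Σ[ D ∈ Code N ]
      IsLinear D × D ⊆ C × HasDimension D m ×
      (∃[ S ] IsSupport D S × ∣ S ∣ ≡ w)

{-# OPTIONS --safe #-}

-- Write F for the subfield of order q. Since ε^q = ε + 1, every x is a + bε with a, b in F, where
-- b = x^q + x, and Γ_ε(x) = a^(σ+2) + ab + b^σ. A plane x₃ = α + βx₁ + κx₂ meets the affine part of the
-- surface in the zeros of a sum of two such functions plus a linear one. As b ↦ b^σ is additive,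
-- summing the character (-1)^Tr(μ·) over b leaves at most one value of a, so for μ ≠ 0 each of the
-- two character sums is at most q in absolute value, and the plane has at most q³ + q² - q affine
-- points. At infinity the surface is X₁^D = X₂^D with D = q(σ+2); the ratio ω = X₂/X₁ then satisfies
-- ω^q = ω², which leaves at most q + 1 ratios. The remaining planes, those through (0,0,0,1), are counted
-- directly. The bounds q³ + q² + 1, q² + 1, 1 for planes, lines, points are attained on X₁ = X₂.
module Submission where

open import Defs
open import Algebra.Bundles using (CommutativeMonoid; CommutativeRing; RawRing; RawSemiring; Semiring)
import Algebra.Definitions.RawSemiring as RawSemiringDefs
import Algebra.Properties.CommutativeMonoid.Sum
import Algebra.Properties.CommutativeSemigroup
import Algebra.Properties.CommutativeSemiring.Exp
import Algebra.Properties.Ring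
import Algebra.Properties.Semiring.Exp
import Algebra.Properties.Semiring.Mult
import Algebra.Properties.Semiring.Sum
import Algebra.Solver.Ring
open import Algebra.Solver.Ring.AlmostCommutativeRing using (_-Raw-AlmostCommutative⟶_; fromCommutativeRing)
open import Data.Bool as Bool using (Bool; _xor_; _∧_; false; if_then_else_; true)
open import Data.Empty using (⊥; ⊥-elim)
open import Data.Fin as Fin using (Fin; combine; fromℕ; inject₁; punchIn; punchOut; splitAt; suc; toℕ; zero)
open import Data.Fin.Permutation using (↔⇒≡)
import Data.Fin.Properties as Fin
open import Data.Fin.Subset using (Subset; _∈_; _∉_; inside; outside; ∁; ∣_∣)
import Data.Fin.Subset.Properties as Subset
open import Data.Integer as ℤ using (-1ℤ; 1ℤ; ℤ)
open import Data.List using (List; []; _++_; _∷_; foldr; map)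
open import Data.List.Extrema.Nat using (max≤v⁺; xs≤max)
open import Data.List.Membership.Propositional using () renaming (_∈_ to _∈ˡ_)
open import Data.List.Membership.Propositional.Properties using (∈-filter⁺; ∈-map⁺)
open import Data.List.Relation.Unary.All as All using (All; []; _∷_)
import Data.List.Relation.Unary.All.Properties as All
open import Data.List.Relation.Unary.Any using (here; there)
open import Data.Maybe as Maybe using ()
open import Data.Nat as ℕ using (ℕ; zero; suc; z≤n; s≤s; _≤_; _<_; _∸_)
open import Data.Nat.DivMod using (_%_; _/_; m%n<n; m*n/n≡m; m≡m%n+[m/n]*n)
open import Data.Nat.Divisibility using (_∣_; m%n≡0⇒n∣m)
import Data.Nat.Properties as ℕ
open import Data.Product using (_,_; _×_; proj₁; proj₂; Σ-syntax; ∃-syntax)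
open import Data.Product.Function.NonDependent.Propositional using (_×-↔_)
open import Data.Sum as Sum using (_⊎_; inj₁; inj₂)
open import Data.Sum.Function.Propositional using (_⊎-↔_)
import Data.Sum.Properties as Sum
open import Data.Unit using (tt; ⊤)
open import Data.Vec as Vec using (Vec; []; _[_]≔_; _∷_; here; lookup; replicate; tabulate; there; transpose; zipWith)
import Data.Vec.Properties as Vec
open import Function using (Injective; _∘_; id)
open import Function.Bundles using (Bijection; Equivalence; Injection; Inverse; _↔_; _⇔_; mk↔ₛ′; mk⇔)
import Function.Properties.Inverse as Inverse
open import Level using (0ℓ)
open import Relation.Binary using (Setoid)
open import Relation.Binary.Definitions using (tri<; tri>; tri≈)
open import Relation.Binary.PropositionalEquality
open import Relation.Nullary using (¬_; Dec; contradiction; does; no; yes)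
open import Relation.Nullary.Decidable using (dec-true; dec⇒maybe; decidable-stable; recompute; ¬?)
open import Relation.Unary using (Decidable; Pred; _⊆_)
open import Algebra.Properties.Semiring.Sum ℕ.+-*-semiring using () renaming (sum to ∑ℕ)

-- The number `N` of points is never computed. The words of forms L₁, ..., L_m all vanish at
-- position i exactly when the i-th point lies on L₁ = ... = L_m = 0, so d_m is `N` minus the
-- largest number of listed points in a subspace of codimension m. It is enough to bound every
-- section from above and to exhibit one section that meets the bound. There is no slack for planes
-- missing (0,0,0,1): q³ + q² - q affine points and q + 1 ratios at infinity add up to exactly q³ +
-- q² + 1. This is why the nonzero frequencies of the character sum are counted as q - 1 and not as
-- q. The term a^(σ+2) is not additive, but it depends on a alone, so it only puts a sign in front
-- of the sum over b. The exponent itself matters at infinity, where e odd gives σ² = 2q. The trace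
-- condition on δ supplies an element at which the character is -1. A formal obstacle is that
-- polynomials are lists whose terms may cancel. The degree used by `homogenize` is known only after
-- some coefficient of degree D is shown to survive, and this coefficient is read off by evaluating
-- the homogenization at a point.

-- Upper bounds for cardinalities by injections into `Fin`

module Counting where
  -- An injection in place of a cardinality, so the predicate need not be decidable. The label may
  -- depend on the proof of `P x`, but equal labels only have to identify the elements; two proofs
  -- for the same element may receive different labels.
  AtMost : ∀ {A : Set} → ℕ → Pred A 0ℓ → Set
  AtMost m P = Σ[ f ∈ (∀ x → P x → Fin m) ] (∀ {x y} px py → f x px ≡ f y py → x ≡ y)

  private variable
    A B : Set
    m n k : ℕ
    P Q R : Pred A 0ℓ

  atMost-≤ : m ≤ n → AtMost m P → AtMost n P
  atMost-≤ m≤n (f , f-inj) =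
    (λ x px → Fin.inject≤ (f x px) m≤n) ,
    λ px py eq → f-inj px py (Fin.inject≤-injective m≤n m≤n _ _ eq)

  atMost-along : {P : Pred A 0ℓ} {Q : Pred B 0ℓ} (g : ∀ x → P x → B) → (∀ x px → Q (g x px)) →
                 (∀ {x y} px py → g x px ≡ g y py → x ≡ y) → AtMost m Q → AtMost m P
  atMost-along g gQ g-inj (f , f-inj) =
    (λ x px → f (g x px) (gQ x px)) ,
    λ px py eq → g-inj px py (f-inj _ _ eq)

  atMost-⊎ : (∀ x → P x → Q x ⊎ R x) → AtMost m Q → AtMost n R → AtMost (m ℕ.+ n) P
  atMost-⊎ {P = P} {Q = Q} {R = R} {m = m} {n = n} split (f , f-inj) (g , g-inj) = h , λ px py → h-inj (split _ px) (split _ py)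
    where
    side : ∀ x → Q x ⊎ R x → Fin m ⊎ Fin n
    side x = Sum.map (f x) (g x)
    h : ∀ x → P x → Fin (m ℕ.+ n)
    h x px = Fin.join m n (side x (split x px))
    h-inj : ∀ {x y} (sx : Q x ⊎ R x) (sy : Q y ⊎ R y) →
            Fin.join m n (side x sx) ≡ Fin.join m n (side y sy) → x ≡ y
    h-inj {x} {y} sx sy eq with sx | sy | trans (sym (Fin.splitAt-join m n (side x sx))) (trans (cong (splitAt m) eq) (Fin.splitAt-join m n (side y sy)))
    ... | inj₁ qx | inj₁ qy | same = f-inj qx qy (Sum.inj₁-injective same)
    ... | inj₂ rx | inj₂ ry | same = g-inj rx ry (Sum.inj₂-injective same)
    ... | inj₁ _ | inj₂ _ | ()
    ... | inj₂ _ | inj₁ _ | ()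

  atMost-× : {P : Pred A 0ℓ} {Q : Pred B 0ℓ} → AtMost m P → AtMost n Q →
             AtMost {A × B} (m ℕ.* n) (λ (x , y) → P x × Q y)
  atMost-× (f , f-inj) (g , g-inj) =
    (λ (x , y) (px , qy) → combine (f x px) (g y qy)) ,
    λ (px , qy) (px′ , qy′) eq → let (eq₁ , eq₂) = Fin.combine-injective _ _ _ _ eq in
      cong₂ _,_ (f-inj px px′ eq₁) (g-inj qy qy′ eq₂)

  atMost-↔ : Fin n ↔ A → AtMost {A} n (λ _ → ⊤)
  atMost-↔ A↔ = (λ x _ → Inverse.from A↔ x) ,
    λ {x} {y} _ _ eq → trans (sym (Inverse.strictlyInverseˡ A↔ x)) (trans (cong (Inverse.to A↔) eq) (Inverse.strictlyInverseˡ A↔ y))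

  atMost-0 : (∀ x → ¬ P x) → AtMost 0 P
  atMost-0 ¬P = (λ x px → ⊥-elim (¬P x px)) , λ {x} px → ⊥-elim (¬P x px)

  atMost-1 : (∀ {x y} → P x → P y → x ≡ y) → AtMost 1 P
  atMost-1 unique = (λ _ _ → zero) , λ px py _ → unique px py

  -- The bound is an indicator value, so iterated sums of it through `atMost-Σ` give a count that
  -- can be compared with a character sum.
  atMost-dec : ∀ {P : Set} (P? : Dec P) → AtMost {⊤} (if does P? then 1 else 0) (λ _ → P)
  atMost-dec (yes p) = atMost-1 λ _ _ → refl
  atMost-dec (no ¬p) = (λ _ p → ⊥-elim (¬p p)) , λ p _ _ → ⊥-elim (¬p p)

  atMost-Σ : ∀ {k} {P : Fin k → Pred A 0ℓ} {m : Fin k → ℕ} → (∀ i → AtMost (m i) (P i)) →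
             AtMost {Fin k × A} (∑ℕ m) (λ (i , x) → P i x)
  atMost-Σ {k = zero} bound = (λ ()) , λ { {()} }
  atMost-Σ {A} {k = suc k} {P} {m} bound =
    atMost-⊎ {P = λ (i , x) → P i x} {Q = First} {R = Later} split
      (atMost-along {P = First} {Q = P zero} (λ x _ → proj₂ x) first
        (λ { {zero , _} {zero , _} _ _ refl → refl }) (bound zero))
      (atMost-along {P = Later} {Q = λ (i , x) → P (suc i) x} below (λ { (suc i , x) px → px })
        (λ { {suc _ , _} {suc _ , _} _ _ refl → refl }) (atMost-Σ {P = P ∘ suc} (bound ∘ suc)))
    where
    First Later : Pred (Fin (suc k) × A) 0ℓ
    First (i , x) = i ≡ zero × P i x
    Later (zero , _)  = ⊥
    Later (suc i , x) = P (suc i) x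
    first : ∀ x → First x → P zero (proj₂ x)
    first (_ , x) (refl , px) = px
    below : ∀ x → Later x → Fin k × A
    below (suc i , x) _ = i , x
    split : ∀ x → P (proj₁ x) (proj₂ x) → First x ⊎ Later x
    split (zero , x) px  = inj₁ (refl , px)
    split (suc i , x) px = inj₂ px

  nth : (p : Subset n) → Fin ∣ p ∣ → Fin n
  nth (inside ∷ p)  zero    = zero
  nth (inside ∷ p)  (suc i) = suc (nth p i)
  nth (outside ∷ p) i       = suc (nth p i)

  nth-∈ : (p : Subset n) (i : Fin ∣ p ∣) → nth p i ∈ p
  nth-∈ (inside ∷ p)  zero    = here
  nth-∈ (inside ∷ p)  (suc i) = there (nth-∈ p i)
  nth-∈ (outside ∷ p) i       = there (nth-∈ p i)

  nth-injective : (p : Subset n) → Injective _≡_ _≡_ (nth p)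
  nth-injective (inside ∷ p)  {zero}  {zero}  _  = refl
  nth-injective (inside ∷ p)  {suc i} {suc j} eq = cong suc (nth-injective p (Fin.suc-injective eq))
  nth-injective (outside ∷ p) eq                 = nth-injective p (Fin.suc-injective eq)

  nth-surjective : ∀ (p : Subset n) {i} → i ∈ p → ∃[ j ] nth p j ≡ i
  nth-surjective (inside ∷ p)  here = zero , refl
  nth-surjective (inside ∷ p)  (there i∈p) with nth-surjective p i∈p
  ... | j , refl = suc j , refl
  nth-surjective (outside ∷ p) (there i∈p) with nth-surjective p i∈p
  ... | j , refl = j , refl

  ∣p∣≤ : (p : Subset n) → AtMost m (_∈ p) → ∣ p ∣ ≤ m
  ∣p∣≤ p (f , f-inj) = Fin.injective⇒≤ {f = λ i → f (nth p i) (nth-∈ p i)} λ eq → nth-injective p (f-inj _ _ eq)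

  -- Meant for a support `p`: the positions outside it are the points of a linear section, and these
  -- are what can be bounded from above.
  atMost⇒∣p∣≥ : (p : Subset n) → AtMost m (_∉ p) → n ∸ m ≤ ∣ p ∣
  atMost⇒∣p∣≥ {n} {m} p (f , f-inj) = begin
    n ∸ m               ≤⟨ ℕ.∸-monoʳ-≤ n (∣p∣≤ (∁ p) ((λ i i∈ → f i (Subset.x∈∁p⇒x∉p i∈)) , λ _ _ → f-inj _ _)) ⟩
    n ∸ ∣ ∁ p ∣         ≡⟨ cong (n ∸_) (Subset.∣∁p∣≡n∸∣p∣ p) ⟩
    n ∸ (n ∸ ∣ p ∣)     ≡⟨ ℕ.m∸[m∸n]≡n (Subset.∣p∣≤n p) ⟩
    ∣ p ∣               ∎
    where open ℕ.≤-Reasoning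

  -- The listing `nth p` and `g` have disjoint images, so together they inject a set of size ∣p∣ + m
  -- into `Fin n`.
  outside⇒∣p∣≤ : (p : Subset n) (g : Fin m → Fin n) → Injective _≡_ _≡_ g → (∀ i → g i ∉ p) → ∣ p ∣ ≤ n ∸ m
  outside⇒∣p∣≤ {n} {m} p g g-inj g∉p = ℕ.m+n≤o⇒m≤o∸n ∣ p ∣ (Fin.injective⇒≤ {f = h ∘ splitAt ∣ p ∣} λ {i} {j} eq →
    trans (sym (Fin.join-splitAt ∣ p ∣ m i))
      (trans (cong (Fin.join ∣ p ∣ m) (h-inj (splitAt ∣ p ∣ i) (splitAt ∣ p ∣ j) eq))
             (Fin.join-splitAt ∣ p ∣ m j)))
    where
    h : Fin ∣ p ∣ ⊎ Fin m → Fin n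
    h = Sum.[ nth p , g ]
    h-inj : ∀ x y → h x ≡ h y → x ≡ y
    h-inj (inj₁ i) (inj₁ j) eq = cong inj₁ (nth-injective p eq)
    h-inj (inj₁ i) (inj₂ j) eq = contradiction (subst (_∈ p) eq (nth-∈ p i)) (g∉p j)
    h-inj (inj₂ i) (inj₁ j) eq = contradiction (subst (_∈ p) (sym eq) (nth-∈ p j)) (g∉p i)
    h-inj (inj₂ i) (inj₂ j) eq = cong inj₂ (g-inj eq)

  does-true⇒ : ∀ {P : Set} (P? : Dec P) → does P? ≡ true → P
  does-true⇒ (yes p) _ = p

  subsetOf : {P : Fin n → Set} → (∀ i → Dec (P i)) → Subset n
  subsetOf P? = tabulate (does ∘ P?)

  ∈-subsetOf⁻ : ∀ {P : Fin n → Set} (P? : ∀ i → Dec (P i)) {i} → i ∈ subsetOf P? → P i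
  ∈-subsetOf⁻ P? {i} i∈ = does-true⇒ (P? i) (trans (sym (Vec.lookup∘tabulate (does ∘ P?) i)) (Vec.[]=⇒lookup i∈))

  ∈-subsetOf⁺ : ∀ {P : Fin n → Set} (P? : ∀ i → Dec (P i)) {i} → P i → i ∈ subsetOf P?
  ∈-subsetOf⁺ P? {i} pi = Vec.lookup⇒[]= i _ (trans (Vec.lookup∘tabulate (does ∘ P?) i) (dec-true (P? i) pi))

open Counting

-- Sums of a sign character over a finite field

module SignSums where
  open import Data.Integer using (+_; 0ℤ) renaming (∣_∣ to ∥_∥)
  import Data.Integer.Properties as ℤ
  open import Algebra.Properties.Semiring.Sum (CommutativeRing.semiring ℤ.+-*-commutativeRing)
    using (sum-cong-≗; ∑-comm; sum-permute; sum-remove; *-distribˡ-sum; *-distribʳ-sum; sum-replicate-zero) renaming (sum to ∑)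

  +-∑ : ∀ {k} (f : Fin k → ℕ) → + ∑ℕ f ≡ ∑ (λ i → + f i)
  +-∑ {zero}  f = refl
  +-∑ {suc k} f = trans (ℤ.pos-+ (f zero) _) (cong (λ s → + f zero ℤ.+ s) (+-∑ (f ∘ suc)))

  ∑-const : ∀ k c → ∑ {k} (λ _ → c) ≡ + k ℤ.* c
  ∑-const zero    c = sym (ℤ.*-zeroˡ c)
  ∑-const (suc k) c = trans (cong (λ s → c ℤ.+ s) (∑-const k c)) (sym (ℤ.suc-* (+ k) c))

  ∑-≤ : ∀ {k} (f : Fin k → ℤ) c → (∀ i → f i ℤ.≤ c) → ∑ f ℤ.≤ + k ℤ.* c
  ∑-≤ {zero}  f c f≤c = ℤ.≤-reflexive (sym (ℤ.*-zeroˡ c))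
  ∑-≤ {suc k} f c f≤c =
    ℤ.≤-trans (ℤ.+-mono-≤ (f≤c zero) (∑-≤ (f ∘ suc) c (f≤c ∘ suc))) (ℤ.≤-reflexive (sym (ℤ.suc-* (+ k) c)))

  -- The summand `+ c` on the left stands in for the exceptional index, so the right side has k · c
  -- instead of (k - 1) · c and no subtraction occurs.
  ∑-≤-except : ∀ {k} (f : Fin k → ℤ) i c d → (∀ j → j ≢ i → f j ℤ.≤ + c) → f i ≡ + d →
               ∑ f ℤ.+ + c ℤ.≤ + (d ℕ.+ k ℕ.* c)
  ∑-≤-except {suc k} f i c d f≤c fi≡d = begin
    ∑ f ℤ.+ + c                                    ≡⟨ cong (ℤ._+ + c) (sum-remove {i = i} f) ⟩
    f i ℤ.+ ∑ (f ∘ punchIn i) ℤ.+ + c              ≤⟨ ℤ.+-monoˡ-≤ (+ c) (ℤ.+-monoʳ-≤ (f i) (∑-≤ (f ∘ punchIn i) (+ c) (λ j → f≤c _ (Fin.punchInᵢ≢i i j)))) ⟩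
    f i ℤ.+ + k ℤ.* + c ℤ.+ + c                    ≡⟨ cong₂ (λ s t → s ℤ.+ t ℤ.+ + c) fi≡d (sym (ℤ.pos-* k c)) ⟩
    + (d ℕ.+ k ℕ.* c ℕ.+ c)                        ≡⟨ cong +_ (trans (ℕ.+-assoc d (k ℕ.* c) c) (cong (d ℕ.+_) (ℕ.+-comm (k ℕ.* c) c))) ⟩
    + (d ℕ.+ suc k ℕ.* c)                          ∎
    where open ℤ.≤-Reasoning

  ∑-zero : ∀ {k} (f : Fin k → ℤ) → (∀ i → f i ≡ 0ℤ) → ∑ f ≡ 0ℤ
  ∑-zero {k} f f≡0 = trans (sum-cong-≗ f≡0) (sum-replicate-zero k)

  -- With at most one nonzero term, the sum is 0 or that term.
  ∥∑∥≤-lone : ∀ {k} (f : Fin k → ℤ) c → (∀ i → ∥ f i ∥ ≤ c) →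
             (∀ {i j} → f i ≢ 0ℤ → f j ≢ 0ℤ → i ≡ j) → ∥ ∑ f ∥ ≤ c
  ∥∑∥≤-lone {zero}  f c f≤c lone = z≤n
  ∥∑∥≤-lone {suc k} f c f≤c lone with f zero ℤ.≟ 0ℤ
  ... | yes f0≡0 = subst (λ s → ∥ s ∥ ≤ c) (sym (trans (cong (ℤ._+ ∑ (f ∘ suc)) f0≡0) (ℤ.+-identityˡ (∑ (f ∘ suc)))))
                     (∥∑∥≤-lone (f ∘ suc) c (f≤c ∘ suc) λ fi fj → Fin.suc-injective (lone fi fj))
  ... | no f0≢0 = subst (λ s → ∥ s ∥ ≤ c) (sym (trans (cong (λ s → f zero ℤ.+ s) (∑-zero (f ∘ suc) rest≡0)) (ℤ.+-identityʳ (f zero)))) (f≤c zero)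
    where
    rest≡0 : ∀ i → f (suc i) ≡ 0ℤ
    rest≡0 i with f (suc i) ℤ.≟ 0ℤ
    ... | yes eq = eq
    ... | no neq = contradiction (lone f0≢0 neq) λ ()

  -- Additive characters in characteristic 2 only take the values 1 and -1, so integers suffice and
  -- their order is available for the estimates.
  record SignCharacter {q} (F : FiniteField q) : Set where
    open FiniteField F
    field
      χ            : Carrier → ℤ
      χ-homo       : ∀ x y → χ (x + y) ≡ χ x ℤ.* χ y
      χ-sign       : ∀ x → χ x ≡ 1ℤ ⊎ χ x ≡ -1ℤ
      χ-nontrivial : ∃[ z ] χ z ≡ -1ℤ

  module CharacterSums {q : ℕ} (F : FiniteField q) (character : SignCharacter F) where
    open FiniteField F
    open CommutativeRing commutativeRing using (+-assoc; +-comm; +-identityˡ; +-identityʳ; -‿inverseˡ; -‿inverseʳ; distribˡ; distribʳ; zeroʳ)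
    open SignCharacter character
    open ≡-Reasoning

    private
      to = Inverse.to enumeration
      from = Inverse.from enumeration

      to-from : ∀ x → to (from x) ≡ x
      to-from = Inverse.strictlyInverseˡ enumeration

      from-injective : ∀ {x y} → from x ≡ from y → x ≡ y
      from-injective {x} {y} eq = trans (sym (to-from x)) (trans (cong to eq) (to-from y))

      to-injective : ∀ {i j} → to i ≡ to j → i ≡ j
      to-injective = Injection.injective (Inverse.↔⇒↣ enumeration)

    -- Abstract, so that unification does not look inside the sums.
    abstract
      ∑F : (Carrier → ℤ) → ℤ
      ∑F f = ∑ (f ∘ to)

      ∑ℕF : (Carrier → ℕ) → ℕ
      ∑ℕF f = ∑ℕ (f ∘ to)

      ∑F-cong : ∀ {f g : Carrier → ℤ} → (∀ x → f x ≡ g x) → ∑F f ≡ ∑F g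
      ∑F-cong eq = sum-cong-≗ (eq ∘ to)

      ∑F-comm : ∀ (f : Carrier → Carrier → ℤ) → ∑F (λ x → ∑F (f x)) ≡ ∑F (λ y → ∑F λ x → f x y)
      ∑F-comm f = ∑-comm λ i j → f (to i) (to j)

      ∑F-const : ∀ c → ∑F (λ _ → c) ≡ + q ℤ.* c
      ∑F-const = ∑-const q

      *-∑F : ∀ c (f : Carrier → ℤ) → c ℤ.* ∑F f ≡ ∑F λ x → c ℤ.* f x
      *-∑F c f = *-distribˡ-sum c (f ∘ to)

      ∑F-* : ∀ (f : Carrier → ℤ) c → ∑F f ℤ.* c ≡ ∑F λ x → f x ℤ.* c
      ∑F-* f c = *-distribʳ-sum c (f ∘ to)

      ∑F-shift : ∀ f z → ∑F f ≡ ∑F (λ x → f (x + z))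
      ∑F-shift f z = trans (sum-permute (f ∘ to) shifted)
        (sum-cong-≗ λ i → cong f (to-from (to i + z)))
        where
        shift : Carrier ↔ Carrier
        shift = mk↔ₛ′ (_+ z) (_+ - z)
          (λ x → trans (+-assoc x (- z) z) (trans (cong (λ t → x + t) (-‿inverseˡ z)) (+-identityʳ x)))
          (λ x → trans (+-assoc x z (- z)) (trans (cong (λ t → x + t) (-‿inverseʳ z)) (+-identityʳ x)))
        shifted : Fin q ↔ Fin q
        shifted = Inverse.↔-trans enumeration (Inverse.↔-trans shift (Inverse.↔-sym enumeration))

      ∥∑F∥≤-lone : ∀ f c → (∀ x → ∥ f x ∥ ≤ c) → (∀ {x y} → f x ≢ 0ℤ → f y ≢ 0ℤ → x ≡ y) → ∥ ∑F f ∥ ≤ c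
      ∥∑F∥≤-lone f c f≤c lone = ∥∑∥≤-lone (f ∘ to) c (f≤c ∘ to) λ fi fj → to-injective (lone fi fj)

      ∑F-≤-except : ∀ f x c d → (∀ {y} → y ≢ x → f y ℤ.≤ + c) → f x ≡ + d → ∑F f ℤ.+ + c ℤ.≤ + (d ℕ.+ q ℕ.* c)
      ∑F-≤-except f x c d f≤c fx≡d =
        ∑-≤-except (f ∘ to) (from x) c d (λ j j≢ → f≤c λ eq → j≢ (to-injective (trans eq (sym (to-from x)))))
          (trans (cong f (to-from x)) fx≡d)

      +-∑F : ∀ f → + ∑ℕF f ≡ ∑F (λ x → + f x)
      +-∑F f = +-∑ (f ∘ to)

      atMost-ΣF : ∀ {A} {P : Carrier → Pred A 0ℓ} {m : Carrier → ℕ} → (∀ x → AtMost (m x) (P x)) →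
                  AtMost {Carrier × A} (∑ℕF m) (λ (x , a) → P x a)
      atMost-ΣF {A} {P} bound = atMost-along
        {Q = λ (i , a) → P (to i) a}
        (λ (x , a) _ → from x , a)
        (λ (x , a) → subst (λ y → P y a) (sym (to-from x)))
        (λ _ _ eq → cong₂ _,_ (from-injective (cong proj₁ eq)) (cong proj₂ eq))
        (atMost-Σ (bound ∘ to))

    Additive : (Carrier → Carrier) → Set
    Additive φ = ∀ x y → φ (x + y) ≡ φ x + φ y

    -- Translating the summation variable by b multiplies the sum by χ(φ b). If this sign were -1,
    -- the sum would equal its own negative.
    ∑χ≢0⇒trivial : ∀ {φ} → Additive φ → ∑F (χ ∘ φ) ≢ 0ℤ → ∀ b → χ (φ b) ≡ 1ℤ
    ∑χ≢0⇒trivial {φ} φ-+ ∑≢0 b with χ-sign (φ b)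
    ... | inj₁ χ≡1  = χ≡1
    ... | inj₂ χ≡-1 = contradiction (self-negative ∑≡-∑) ∑≢0
      where
      ∑≡-∑ : ∑F (χ ∘ φ) ≡ ∑F (χ ∘ φ) ℤ.* -1ℤ
      ∑≡-∑ = begin
        ∑F (χ ∘ φ)                       ≡⟨ ∑F-shift (χ ∘ φ) b ⟩
        ∑F (λ x → χ (φ (x + b)))         ≡⟨ ∑F-cong (λ x → trans (cong χ (φ-+ x b)) (χ-homo _ _)) ⟩
        ∑F (λ x → χ (φ x) ℤ.* χ (φ b))   ≡⟨ ∑F-* (χ ∘ φ) (χ (φ b)) ⟨
        ∑F (χ ∘ φ) ℤ.* χ (φ b)           ≡⟨ cong (∑F (χ ∘ φ) ℤ.*_) χ≡-1 ⟩
        ∑F (χ ∘ φ) ℤ.* -1ℤ               ∎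
      self-negative : ∀ {s} → s ≡ s ℤ.* -1ℤ → s ≡ 0ℤ
      self-negative {+ zero}  _ = refl
      self-negative {+ suc n} ()
      self-negative {ℤ.-[1+ n ]} ()

    χ[0]≡1 : χ 0# ≡ 1ℤ
    χ[0]≡1 with χ-sign 0#
    ... | inj₁ eq = eq
    ... | inj₂ eq with trans (sym eq) (trans (cong χ (sym (+-identityˡ 0#))) (trans (χ-homo 0# 0#) (cong₂ ℤ._*_ eq eq)))
    ... | ()

    -- If z ≠ 0, every element is a multiple z · b, including one where χ is -1.
    nondegenerate : ∀ {z} → (∀ b → χ (z * b) ≡ 1ℤ) → z ≡ 0#
    nondegenerate {z} trivial with z ≟ 0#
    ... | yes z≡0 = z≡0
    ... | no  z≢0 with invertible z z≢0 | χ-nontrivial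
    ... | y , zy≡1 | w , χw≡-1 with trans (sym χw≡-1) (trans (cong χ w≡) (trivial (y * w)))
      where
      w≡ : w ≡ z * (y * w)
      w≡ = trans (sym (*-identityˡ w)) (trans (cong (_* w) (sym zy≡1)) (*-assoc z y w))
    ... | ()

    -- Summing over μ detects z = 0: for z ≠ 0 a nonzero sum would make μ ↦ χ(μz) trivial. The
    -- decision is an argument, so the right side matches the indicator that is being counted,
    -- whichever way it is decided.
    orthogonality : ∀ z (z≟0 : Dec (z ≡ 0#)) → ∑F (λ μ → χ (μ * z)) ≡ + q ℤ.* + (if does z≟0 then 1 else 0)
    orthogonality z (yes refl) = trans (∑F-cong λ μ → trans (cong χ (zeroʳ μ)) χ[0]≡1) (∑F-const 1ℤ)
    orthogonality z (no z≢0) with ∑F (λ μ → χ (μ * z)) ℤ.≟ 0ℤ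
    ... | yes ∑≡0 = trans ∑≡0 (sym (ℤ.*-zeroʳ (+ q)))
    ... | no ∑≢0  = contradiction (nondegenerate trivial) z≢0
      where
      trivial : ∀ b → χ (z * b) ≡ 1ℤ
      trivial b = trans (cong χ (*-comm z b)) (∑χ≢0⇒trivial (λ x y → distribʳ z x y) ∑≢0 b)

    ∥χ∥≡1 : ∀ x → ∥ χ x ∥ ≡ 1
    ∥χ∥≡1 x = Sum.[ cong ∥_∥ , cong ∥_∥ ] (χ-sign x)

    module Sheet (h φ : Carrier → Carrier) (φ-+ : ∀ x y → φ (x + y) ≡ φ x + φ y) where

      -- This is γ at a + bε plus a linear form in (a , b): `h` takes everything that depends on a
      -- alone, and for fixed a the remainder is additive in b.
      sheet : Carrier → Carrier → Carrier
      sheet a b = h a + (a * b + φ b)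

      W : Carrier → ℤ
      W μ = ∑F λ a → ∑F λ b → χ (μ * sheet a b)

      W[0] : W 0# ≡ + q ℤ.* + q
      W[0] = begin
        W 0#                         ≡⟨ ∑F-cong (λ a → ∑F-cong λ b → trans (cong χ (zeroˡ _)) χ[0]≡1) ⟩
        ∑F (λ a → ∑F (λ b → 1ℤ))     ≡⟨ ∑F-cong (λ a → trans (∑F-const 1ℤ) (ℤ.*-identityʳ (+ q))) ⟩
        ∑F (λ a → + q)               ≡⟨ ∑F-const (+ q) ⟩
        + q ℤ.* + q                  ∎

      private
        inner : Carrier → Carrier → ℤ
        inner μ a = ∑F λ b → χ (μ * (a * b + φ b))

        exchange : ∀ x y u v → (x + y) + (u + v) ≡ (x + u) + (y + v)
        exchange x y u v = trans (+-assoc x y _) (trans (cong (λ t → x + t) (trans (sym (+-assoc y u v))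
          (trans (cong (_+ v) (+-comm y u)) (+-assoc u y v)))) (sym (+-assoc x u _)))

        form-+ : ∀ μ a → Additive (λ b → μ * (a * b + φ b))
        form-+ μ a x y = trans (cong (μ *_) (trans (cong₂ _+_ (distribˡ a x y) (φ-+ x y)) (exchange _ _ _ _))) (distribˡ μ _ _)

        inner-value : ∀ μ a → inner μ a ≢ 0ℤ → inner μ a ≡ + q
        inner-value μ a ≢0 = trans (∑F-cong (∑χ≢0⇒trivial (form-+ μ a) ≢0)) (trans (∑F-const 1ℤ) (ℤ.*-identityʳ (+ q)))

        inner-bound : ∀ μ a → ∥ inner μ a ∥ ≤ q
        inner-bound μ a with inner μ a ℤ.≟ 0ℤ
        ... | yes ≡0 = subst (λ s → ∥ s ∥ ≤ q) (sym ≡0) z≤n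
        ... | no  ≢0 = subst (λ s → ∥ s ∥ ≤ q) (sym (inner-value μ a ≢0)) ℕ.≤-refl

        -- Nonzero sums at a and a′ make both b ↦ χ(μ(ab + φ b)) and b ↦ χ(μ(a′b + φ b)) trivial. In
        -- the quotient φ cancels, so b ↦ χ(μ(a - a′)b) is trivial, and nondegeneracy gives a = a′.
        inner-lone : ∀ {μ} → μ ≢ 0# → ∀ {a a′} → inner μ a ≢ 0ℤ → inner μ a′ ≢ 0ℤ → a ≡ a′
        inner-lone {μ} μ≢0 {a} {a′} ≢0 ≢0′ = difference-zero (cancel (nondegenerate difference-trivial))
          where
          difference-zero : a + - a′ ≡ 0# → a ≡ a′
          difference-zero eq = begin
            a                ≡⟨ +-identityʳ a ⟨
            a + 0#           ≡⟨ cong (λ t → a + t) (-‿inverseˡ a′) ⟨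
            a + (- a′ + a′)  ≡⟨ +-assoc a (- a′) a′ ⟨
            (a + - a′) + a′  ≡⟨ cong (_+ a′) eq ⟩
            0# + a′          ≡⟨ +-identityˡ a′ ⟩
            a′               ∎
          cancel : ∀ {x} → μ * x ≡ 0# → x ≡ 0#
          cancel {x} μx≡0 with invertible μ μ≢0
          ... | ν , μν≡1 = begin
            x             ≡⟨ *-identityˡ x ⟨
            1# * x        ≡⟨ cong (_* x) (trans (sym μν≡1) (*-comm μ ν)) ⟩
            (ν * μ) * x   ≡⟨ *-assoc ν μ x ⟩
            ν * (μ * x)   ≡⟨ cong (ν *_) μx≡0 ⟩
            ν * 0#        ≡⟨ zeroʳ ν ⟩
            0#            ∎
          trivial : ∀ b → χ (μ * (a * b + φ b)) ≡ 1ℤ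
          trivial = ∑χ≢0⇒trivial (form-+ μ a) ≢0
          trivial′ : ∀ b → χ (μ * (a′ * b + φ b)) ≡ 1ℤ
          trivial′ = ∑χ≢0⇒trivial (form-+ μ a′) ≢0′
          split : ∀ b → μ * (a + - a′) * b + μ * (a′ * b + φ b) ≡ μ * (a * b + φ b)
          split b = begin
            μ * (a + - a′) * b + μ * (a′ * b + φ b)      ≡⟨ cong (_+ μ * (a′ * b + φ b)) (*-assoc μ _ b) ⟩
            μ * ((a + - a′) * b) + μ * (a′ * b + φ b)    ≡⟨ distribˡ μ _ _ ⟨
            μ * ((a + - a′) * b + (a′ * b + φ b))        ≡⟨ cong (μ *_) (+-assoc _ _ _) ⟨
            μ * (((a + - a′) * b + a′ * b) + φ b)        ≡⟨ cong (λ t → μ * (t + φ b)) (distribʳ b _ _) ⟨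
            μ * (((a + - a′) + a′) * b + φ b)            ≡⟨ cong (λ t → μ * (t * b + φ b)) (+-assoc a (- a′) a′) ⟩
            μ * ((a + (- a′ + a′)) * b + φ b)            ≡⟨ cong (λ t → μ * ((a + t) * b + φ b)) (-‿inverseˡ a′) ⟩
            μ * ((a + 0#) * b + φ b)                     ≡⟨ cong (λ t → μ * (t * b + φ b)) (+-identityʳ a) ⟩
            μ * (a * b + φ b)                            ∎
          difference-trivial : ∀ b → χ (μ * (a + - a′) * b) ≡ 1ℤ
          difference-trivial b = begin
            χ (μ * (a + - a′) * b)                                ≡⟨ ℤ.*-identityʳ _ ⟨
            χ (μ * (a + - a′) * b) ℤ.* 1ℤ                         ≡⟨ cong (χ (μ * (a + - a′) * b) ℤ.*_) (trivial′ b) ⟨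
            χ (μ * (a + - a′) * b) ℤ.* χ (μ * (a′ * b + φ b))     ≡⟨ χ-homo _ _ ⟨
            χ (μ * (a + - a′) * b + μ * (a′ * b + φ b))           ≡⟨ cong χ (split b) ⟩
            χ (μ * (a * b + φ b))                                 ≡⟨ trivial b ⟩
            1ℤ                                                    ∎

        row : ∀ μ a → ∑F (λ b → χ (μ * sheet a b)) ≡ χ (μ * h a) ℤ.* inner μ a
        row μ a = trans (∑F-cong λ b → trans (cong χ (distribˡ μ (h a) _)) (χ-homo _ _)) (sym (*-∑F (χ (μ * h a)) (λ b → χ (μ * (a * b + φ b)))))

      -- Each row is the inner sum times the sign χ(μ · h a). At most one inner sum is nonzero, and
      -- it has absolute value at most q.
      ∥W∥≤q : ∀ {μ} → μ ≢ 0# → ∥ W μ ∥ ≤ q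
      ∥W∥≤q {μ} μ≢0 = ∥∑F∥≤-lone (λ a → ∑F λ b → χ (μ * sheet a b)) q bound
        (λ ≢0 ≢0′ → inner-lone μ≢0 (inner≢0 ≢0) (inner≢0 ≢0′))
        where
        bound : ∀ a → ∥ ∑F (λ b → χ (μ * sheet a b)) ∥ ≤ q
        bound a = subst (_≤ q) (sym (begin
          ∥ ∑F (λ b → χ (μ * sheet a b)) ∥    ≡⟨ cong ∥_∥ (row μ a) ⟩
          ∥ χ (μ * h a) ℤ.* inner μ a ∥       ≡⟨ ℤ.abs-* (χ (μ * h a)) (inner μ a) ⟩
          ∥ χ (μ * h a) ∥ ℕ.* ∥ inner μ a ∥   ≡⟨ cong (ℕ._* ∥ inner μ a ∥) (∥χ∥≡1 (μ * h a)) ⟩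
          1 ℕ.* ∥ inner μ a ∥                 ≡⟨ ℕ.*-identityˡ _ ⟩
          ∥ inner μ a ∥                       ∎)) (inner-bound μ a)
        inner≢0 : ∀ {a} → ∑F (λ b → χ (μ * sheet a b)) ≢ 0ℤ → inner μ a ≢ 0ℤ
        inner≢0 {a} row≢0 eq = row≢0 (trans (row μ a) (trans (cong (χ (μ * h a) ℤ.*_) eq) (ℤ.*-zeroʳ (χ (μ * h a)))))

    module TwoSheets (h φ h′ φ′ : Carrier → Carrier)
                     (φ-+ : ∀ x y → φ (x + y) ≡ φ x + φ y) (φ′-+ : ∀ x y → φ′ (x + y) ≡ φ′ x + φ′ y) where
      open Sheet h φ φ-+
      open Sheet h′ φ′ φ′-+ using () renaming (sheet to sheet′; W to W′; W[0] to W′[0]; ∥W∥≤q to ∥W′∥≤q)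

      Balanced : Pred (Carrier × Carrier × Carrier × Carrier) 0ℓ
      Balanced (a , b , c , d) = sheet a b + sheet′ c d ≡ 0#

      private
        indicator : Carrier → ℕ
        indicator z = if does (z ≟ 0#) then 1 else 0

        M : ℕ
        M = ∑ℕF λ a → ∑ℕF λ b → ∑ℕF λ c → ∑ℕF λ d → indicator (sheet a b + sheet′ c d)

        M-counts : AtMost M Balanced
        M-counts = atMost-along
          (λ (a , b , c , d) _ → a , b , c , d , tt) (λ _ balanced → balanced) (λ { _ _ refl → refl })
          (atMost-ΣF λ a → atMost-ΣF λ b → atMost-ΣF λ c → atMost-ΣF λ d → atMost-dec (sheet a b + sheet′ c d ≟ 0#))

        ∑⁴ : (Carrier → Carrier → Carrier → Carrier → ℤ) → ℤ
        ∑⁴ f = ∑F λ a → ∑F λ b → ∑F λ c → ∑F λ d → f a b c d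

        ∑⁴-cong : ∀ {f g : Carrier → Carrier → Carrier → Carrier → ℤ} → (∀ a b c d → f a b c d ≡ g a b c d) → ∑⁴ f ≡ ∑⁴ g
        ∑⁴-cong eq = ∑F-cong λ a → ∑F-cong λ b → ∑F-cong λ c → ∑F-cong λ d → eq a b c d

        *-∑⁴ : ∀ x (f : Carrier → Carrier → Carrier → Carrier → ℤ) → x ℤ.* ∑⁴ f ≡ ∑⁴ λ a b c d → x ℤ.* f a b c d
        *-∑⁴ x f =
          trans (*-∑F x λ a → ∑F λ b → ∑F λ c → ∑F (f a b c)) (∑F-cong λ a →
          trans (*-∑F x λ b → ∑F λ c → ∑F (f a b c)) (∑F-cong λ b →
          trans (*-∑F x λ c → ∑F (f a b c)) (∑F-cong λ c → *-∑F x (f a b c))))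

        ∑⁴-∑F : ∀ (f : Carrier → Carrier → Carrier → Carrier → Carrier → ℤ) → ∑⁴ (λ a b c d → ∑F (f a b c d)) ≡ ∑F λ x → ∑⁴ λ a b c d → f a b c d x
        ∑⁴-∑F f =
          trans (∑F-cong λ a →
            trans (∑F-cong λ b →
              trans (∑F-cong λ c → ∑F-comm λ d x → f a b c d x)
                    (∑F-comm λ c x → ∑F λ d → f a b c d x))
                  (∑F-comm λ b x → ∑F λ c → ∑F λ d → f a b c d x))
                (∑F-comm λ a x → ∑F λ b → ∑F λ c → ∑F λ d → f a b c d x)

        +M≡ : + M ≡ ∑⁴ λ a b c d → + indicator (sheet a b + sheet′ c d)
        +M≡ =
          trans (+-∑F λ a → ∑ℕF λ b → ∑ℕF λ c → ∑ℕF λ d → i a b c d) (∑F-cong λ a →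
          trans (+-∑F λ b → ∑ℕF λ c → ∑ℕF λ d → i a b c d) (∑F-cong λ b →
          trans (+-∑F λ c → ∑ℕF λ d → i a b c d) (∑F-cong λ c → +-∑F λ d → i a b c d)))
          where
          i : Carrier → Carrier → Carrier → Carrier → ℕ
          i a b c d = indicator (sheet a b + sheet′ c d)

        separate : ∀ μ → ∑⁴ (λ a b c d → χ (μ * sheet a b) ℤ.* χ (μ * sheet′ c d)) ≡ W μ ℤ.* W′ μ
        separate μ = begin
          ∑⁴ (λ a b c d → f a b ℤ.* g c d)
            ≡⟨ (∑F-cong λ a → ∑F-cong λ b → ∑F-cong λ c → *-∑F (f a b) (g c)) ⟨
          (∑F λ a → ∑F λ b → ∑F λ c → f a b ℤ.* ∑F (g c))
            ≡⟨ (∑F-cong λ a → ∑F-cong λ b → *-∑F (f a b) λ c → ∑F (g c)) ⟨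
          (∑F λ a → ∑F λ b → f a b ℤ.* W′ μ)
            ≡⟨ (∑F-cong λ a → ∑F-* (f a) (W′ μ)) ⟨
          (∑F λ a → ∑F (f a) ℤ.* W′ μ)
            ≡⟨ ∑F-* (λ a → ∑F (f a)) (W′ μ) ⟨
          W μ ℤ.* W′ μ ∎
          where
          f g : Carrier → Carrier → ℤ
          f a b = χ (μ * sheet a b)
          g c d = χ (μ * sheet′ c d)

        -- Orthogonality writes q times each indicator as a sum over μ. With μ outermost, the sum
        -- over (a , b , c , d) splits into a factor for each sheet.
        q*M≡ : + q ℤ.* + M ≡ ∑F λ μ → W μ ℤ.* W′ μ
        q*M≡ = begin
          + q ℤ.* + M
            ≡⟨ cong (λ s → + q ℤ.* s) +M≡ ⟩
          + q ℤ.* ∑⁴ (λ a b c d → + indicator (sheet a b + sheet′ c d))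
            ≡⟨ *-∑⁴ (+ q) (λ a b c d → + indicator (sheet a b + sheet′ c d)) ⟩
          ∑⁴ (λ a b c d → + q ℤ.* + indicator (sheet a b + sheet′ c d))
            ≡⟨ ∑⁴-cong (λ a b c d → orthogonality _ (sheet a b + sheet′ c d ≟ 0#)) ⟨
          ∑⁴ (λ a b c d → ∑F λ μ → χ (μ * (sheet a b + sheet′ c d)))
            ≡⟨ ∑⁴-cong (λ a b c d → ∑F-cong λ μ → trans (cong χ (distribˡ μ (sheet a b) (sheet′ c d))) (χ-homo _ _)) ⟩
          ∑⁴ (λ a b c d → ∑F λ μ → χ (μ * sheet a b) ℤ.* χ (μ * sheet′ c d))
            ≡⟨ ∑⁴-∑F (λ a b c d μ → χ (μ * sheet a b) ℤ.* χ (μ * sheet′ c d)) ⟩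
          (∑F λ μ → ∑⁴ λ a b c d → χ (μ * sheet a b) ℤ.* χ (μ * sheet′ c d))
            ≡⟨ ∑F-cong separate ⟩
          (∑F λ μ → W μ ℤ.* W′ μ) ∎

      -- The frequency μ = 0 contributes q² · q², and each of the other q - 1 frequencies at most q
      -- · q, so qM ≤ q⁴ + (q - 1)q². The term -q² is moved to the left to stay within ℕ.
      balanced-count : ∃[ m ] q ℕ.* m ℕ.+ q ℕ.* q ≤ q ℕ.* q ℕ.* (q ℕ.* q) ℕ.+ q ℕ.* (q ℕ.* q) × AtMost m Balanced
      balanced-count = M , bound , M-counts
        where
        term : Carrier → ℤ
        term μ = W μ ℤ.* W′ μ
        term≤ : ∀ {μ} → μ ≢ 0# → term μ ℤ.≤ + (q ℕ.* q)
        term≤ {μ} μ≢0 = ℤ.≤-trans (i≤∥i∥ (term μ)) (ℤ.+≤+ (subst (_≤ q ℕ.* q) (sym (ℤ.abs-* (W μ) (W′ μ))) (ℕ.*-mono-≤ (∥W∥≤q μ≢0) (∥W′∥≤q μ≢0))))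
          where
          i≤∥i∥ : ∀ i → i ℤ.≤ + ∥ i ∥
          i≤∥i∥ (+ n)        = ℤ.≤-refl
          i≤∥i∥ (ℤ.-[1+ n ]) = ℤ.-≤+
        term[0] : term 0# ≡ + (q ℕ.* q ℕ.* (q ℕ.* q))
        term[0] = trans (cong₂ ℤ._*_ (trans W[0] (sym (ℤ.pos-* q q))) (trans W′[0] (sym (ℤ.pos-* q q)))) (sym (ℤ.pos-* (q ℕ.* q) (q ℕ.* q)))
        bound : q ℕ.* M ℕ.+ q ℕ.* q ≤ q ℕ.* q ℕ.* (q ℕ.* q) ℕ.+ q ℕ.* (q ℕ.* q)
        bound = ℤ.drop‿+≤+ (ℤ.≤-trans
          (ℤ.≤-reflexive (cong (λ t → t ℤ.+ + (q ℕ.* q)) (trans (ℤ.pos-* q M) q*M≡)))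
          (∑F-≤-except term 0# (q ℕ.* q) _ term≤ term[0]))

open SignSums

-- Finite field arithmetic and characteristic two

module FieldTheory {n : ℕ} (K : FiniteField n) where
  open FiniteField K
  open CommutativeRing commutativeRing public
    using (+-assoc; +-comm; +-identityˡ; +-identityʳ; *-identityʳ; -‿inverseˡ; -‿inverseʳ; distribˡ; distribʳ; zeroʳ; ring; +-commutativeMonoid; *-commutativeMonoid; commutativeSemiring)
  open RawSemiringDefs (Semiring.rawSemiring semiring) public using (_^_)
  open Algebra.Properties.Semiring.Exp semiring public using (^-homo-*; ^-assocʳ)
  open Algebra.Properties.CommutativeSemiring.Exp commutativeSemiring public using (^-distrib-*)
  open ≡-Reasoning

  private
    module ∑ = Algebra.Properties.CommutativeMonoid.Sum +-commutativeMonoid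
    module ∏ = Algebra.Properties.CommutativeMonoid.Sum *-commutativeMonoid
    module × = Algebra.Properties.Semiring.Mult semiring
    to = Inverse.to enumeration
    from = Inverse.from enumeration

    to-from : ∀ x → to (from x) ≡ x
    to-from = Inverse.strictlyInverseˡ enumeration

    reindex : Carrier ↔ Carrier → Fin n ↔ Fin n
    reindex π = Inverse.↔-trans enumeration (Inverse.↔-trans π (Inverse.↔-sym enumeration))

  infix 9 _⁻¹
  -- Made total by the default 0⁻¹ = 0, so that quotients can be written without carrying a proof
  -- that the denominator is nonzero.
  _⁻¹ : Carrier → Carrier
  x ⁻¹ with x ≟ 0#
  ... | yes _  = 0#
  ... | no x≢0 = proj₁ (invertible x x≢0)

  x*x⁻¹≡1 : ∀ {x} → x ≢ 0# → x * x ⁻¹ ≡ 1#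
  x*x⁻¹≡1 {x} x≢0 with x ≟ 0#
  ... | yes x≡0  = contradiction x≡0 x≢0
  ... | no x≢0′ = proj₂ (invertible x x≢0′)

  x⁻¹*x≡1 : ∀ {x} → x ≢ 0# → x ⁻¹ * x ≡ 1#
  x⁻¹*x≡1 x≢0 = trans (*-comm _ _) (x*x⁻¹≡1 x≢0)

  1≢0 : 1# ≢ 0#
  1≢0 = 0≢1 ∘ sym

  *-cancelˡ : ∀ {x y z} → x ≢ 0# → x * y ≡ x * z → y ≡ z
  *-cancelˡ {x} {y} {z} x≢0 eq = begin
    y                 ≡⟨ *-identityˡ y ⟨
    1# * y            ≡⟨ cong (_* y) (x⁻¹*x≡1 x≢0) ⟨
    x ⁻¹ * x * y      ≡⟨ *-assoc _ _ _ ⟩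
    x ⁻¹ * (x * y)    ≡⟨ cong (x ⁻¹ *_) eq ⟩
    x ⁻¹ * (x * z)    ≡⟨ *-assoc _ _ _ ⟨
    x ⁻¹ * x * z      ≡⟨ cong (_* z) (x⁻¹*x≡1 x≢0) ⟩
    1# * z            ≡⟨ *-identityˡ z ⟩
    z                 ∎

  no-zero-divisors : ∀ {x y} → x ≢ 0# → x * y ≡ 0# → y ≡ 0#
  no-zero-divisors x≢0 eq = *-cancelˡ x≢0 (trans eq (sym (zeroʳ _)))

  *-≢0 : ∀ {x y} → x ≢ 0# → y ≢ 0# → x * y ≢ 0#
  *-≢0 x≢0 y≢0 eq = y≢0 (no-zero-divisors x≢0 eq)

  ⁻¹-≢0 : ∀ {x} → x ≢ 0# → x ⁻¹ ≢ 0#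
  ⁻¹-≢0 {x} x≢0 eq = 1≢0 (trans (sym (x*x⁻¹≡1 x≢0)) (trans (cong (x *_) eq) (zeroʳ x)))

  ^-≢0 : ∀ {x} k → x ≢ 0# → x ^ k ≢ 0#
  ^-≢0 zero    x≢0 = 1≢0
  ^-≢0 (suc k) x≢0 = *-≢0 x≢0 (^-≢0 k x≢0)

  x^k≡0⇒x≡0 : ∀ {x} k → x ^ k ≡ 0# → x ≡ 0#
  x^k≡0⇒x≡0 {x} k eq with x ≟ 0#
  ... | yes x≡0 = x≡0
  ... | no x≢0  = contradiction eq (^-≢0 k x≢0)

  1^k≡1 : ∀ k → 1# ^ k ≡ 1#
  1^k≡1 zero    = refl
  1^k≡1 (suc k) = trans (*-identityˡ _) (1^k≡1 k)

  private
    ∏-≢0 : ∀ {k} (f : Fin k → Carrier) → (∀ i → f i ≢ 0#) → ∏.sum f ≢ 0#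
    ∏-≢0 {zero}  f f≢0 = 1≢0
    ∏-≢0 {suc k} f f≢0 = *-≢0 (f≢0 zero) (∏-≢0 (f ∘ suc) (f≢0 ∘ suc))

    -- The extra factor x replaces the one factor equal to 1, which makes the exponent the full
    -- number k of indices.
    ∏-const-except : ∀ {k} (f : Fin k → Carrier) i x → f i ≡ 1# → (∀ j → j ≢ i → f j ≡ x) → x * ∏.sum f ≡ x ^ k
    ∏-const-except {suc k} f i x fi≡1 f≡x = cong (x *_) (begin
      ∏.sum f                              ≡⟨ ∏.sum-remove {i = i} f ⟩
      f i * ∏.sum (f ∘ punchIn i)          ≡⟨ cong₂ _*_ fi≡1 (∏.sum-cong-≗ λ j → f≡x _ (Fin.punchInᵢ≢i i j)) ⟩
      1# * ∏.sum {k} (λ _ → x)             ≡⟨ *-identityˡ _ ⟩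
      ∏.sum {k} (λ _ → x)                  ≡⟨ ∏.sum-replicate k ⟩
      x ^ k                                ∎)

  -- Multiplication by x permutes the nonzero elements, hence fixes their product.
  fermat : ∀ {x} → x ≢ 0# → x ^ n ≡ x
  fermat {x} x≢0 = begin
    x ^ n                    ≡⟨ ∏-const-except (factor ∘ to) (from 0#) x factor[0] factor[≢0] ⟨
    x * ∏.sum (factor ∘ to)  ≡⟨ cong (x *_) ∏factor≡1 ⟩
    x * 1#                   ≡⟨ *-identityʳ x ⟩
    x                        ∎
    where
    1-if_else_ : ∀ {P : Set} → Dec P → Carrier → Carrier
    1-if yes _ else z = 1#
    1-if no _  else z = z

    nonzero factor : Carrier → Carrier
    nonzero y = 1-if (y ≟ 0#) else y
    factor y  = 1-if (y ≟ 0#) else x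

    nonzero-≢0 : ∀ y → nonzero y ≢ 0#
    nonzero-≢0 y with y ≟ 0#
    ... | yes _  = 1≢0
    ... | no y≢0 = y≢0

    nonzero-* : ∀ y → nonzero (x * y) ≡ nonzero y * factor y
    nonzero-* y with y ≟ 0# | x * y ≟ 0#
    ... | yes _    | yes _    = sym (*-identityˡ 1#)
    ... | yes refl | no xy≢0  = contradiction (zeroʳ x) xy≢0
    ... | no y≢0   | yes xy≡0 = contradiction (no-zero-divisors x≢0 xy≡0) y≢0
    ... | no _     | no _     = *-comm x y

    scale : Carrier ↔ Carrier
    scale = mk↔ₛ′ (x *_) (x ⁻¹ *_)
      (λ y → trans (sym (*-assoc _ _ _)) (trans (cong (_* y) (x*x⁻¹≡1 x≢0)) (*-identityˡ y)))
      (λ y → trans (sym (*-assoc _ _ _)) (trans (cong (_* y) (x⁻¹*x≡1 x≢0)) (*-identityˡ y)))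

    ∏factor≡1 : ∏.sum (factor ∘ to) ≡ 1#
    ∏factor≡1 = *-cancelˡ (∏-≢0 (nonzero ∘ to) (nonzero-≢0 ∘ to)) (begin
      ∏.sum (nonzero ∘ to) * ∏.sum (factor ∘ to)     ≡⟨ ∏.∑-distrib-+ (nonzero ∘ to) (factor ∘ to) ⟨
      ∏.sum (λ i → nonzero (to i) * factor (to i))   ≡⟨ ∏.sum-cong-≗ (λ i → trans (cong nonzero (to-from (x * to i))) (nonzero-* (to i))) ⟨
      ∏.sum (λ i → nonzero (to (from (x * to i))))   ≡⟨ ∏.sum-permute (nonzero ∘ to) (reindex scale) ⟨
      ∏.sum (nonzero ∘ to)                           ≡⟨ *-identityʳ _ ⟨
      ∏.sum (nonzero ∘ to) * 1#                      ∎)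

    factor[0] : factor (to (from 0#)) ≡ 1#
    factor[0] with to (from 0#) ≟ 0#
    ... | yes _ = refl
    ... | no ≢0 = contradiction (to-from 0#) ≢0

    factor[≢0] : ∀ i → i ≢ from 0# → factor (to i) ≡ x
    factor[≢0] i i≢ with to i ≟ 0#
    ... | yes ≡0 = contradiction (trans (sym (Inverse.strictlyInverseʳ enumeration i)) (cong from ≡0)) i≢
    ... | no _   = refl

  -- Translation by 1 permutes the field, so the sum of its elements equals itself plus n · 1.
  n×1≡0 : n ×.× 1# ≡ 0#
  n×1≡0 = begin
    n ×.× 1#                                   ≡⟨ +-identityˡ _ ⟨
    0# + n ×.× 1#                              ≡⟨ cong (_+ n ×.× 1#) (-‿inverseˡ total) ⟨
    - total + total + n ×.× 1#                 ≡⟨ +-assoc _ _ _ ⟩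
    - total + (total + n ×.× 1#)               ≡⟨ cong (λ t → - total + (total + t)) (∑.sum-replicate n) ⟨
    - total + (total + ∑.sum {n} (λ _ → 1#))   ≡⟨ cong (- total +_) (∑.∑-distrib-+ to (λ _ → 1#)) ⟨
    - total + ∑.sum (λ i → to i + 1#)          ≡⟨ cong (- total +_) (∑.sum-cong-≗ λ i → to-from (to i + 1#)) ⟨
    - total + ∑.sum (to ∘ from ∘ (_+ 1#) ∘ to) ≡⟨ cong (- total +_) (∑.sum-permute to (reindex translate)) ⟨
    - total + total                            ≡⟨ -‿inverseˡ total ⟩
    0#                                         ∎
    where
    total = ∑.sum to
    translate : Carrier ↔ Carrier
    translate = mk↔ₛ′ (_+ 1#) (_+ - 1#)
      (λ x → trans (+-assoc x _ _) (trans (cong (x +_) (-‿inverseˡ 1#)) (+-identityʳ x)))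
      (λ x → trans (+-assoc x _ _) (trans (cong (x +_) (-‿inverseʳ 1#)) (+-identityʳ x)))

  -- The multiple n · 1 is the k-th power of 2 · 1. If 2 were nonzero, so would be this power,
  -- against `n×1≡0`.
  1+1≡0 : ∀ k → n ≡ 2 ℕ.^ k → 1# + 1# ≡ 0#
  1+1≡0 k n≡2^k with 1# + 1# ≟ 0#
  ... | yes eq = eq
  ... | no neq = contradiction (trans (cong (×._× 1#) (sym n≡2^k)) n×1≡0) (2^k×1≢0 k)
    where
    2^k×1≢0 : ∀ k → (2 ℕ.^ k) ×.× 1# ≢ 0#
    2^k×1≢0 zero    eq = 1≢0 (trans (sym (+-identityʳ 1#)) eq)
    2^k×1≢0 (suc k) eq = *-≢0 (λ 2≡0 → neq (trans (cong (1# +_) (sym (+-identityʳ 1#))) 2≡0)) (2^k×1≢0 k)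
      (trans (sym (×.×1-homo-* 2 (2 ℕ.^ k))) eq)

  module CharacteristicTwo (two≡0 : FiniteField._+_ K (FiniteField.1# K) (FiniteField.1# K) ≡ FiniteField.0# K) where

    x+x≡0 : ∀ x → x + x ≡ 0#
    x+x≡0 x = begin
      x + x                ≡⟨ cong₂ _+_ (*-identityˡ x) (*-identityˡ x) ⟨
      1# * x + 1# * x      ≡⟨ distribʳ x 1# 1# ⟨
      (1# + 1#) * x        ≡⟨ cong (_* x) two≡0 ⟩
      0# * x               ≡⟨ zeroˡ x ⟩
      0#                   ∎

    x+y≡0⇒x≡y : ∀ {x y} → x + y ≡ 0# → x ≡ y
    x+y≡0⇒x≡y {x} {y} eq = begin
      x              ≡⟨ +-identityʳ x ⟨
      x + 0#         ≡⟨ cong (x +_) (x+x≡0 y) ⟨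
      x + (y + y)    ≡⟨ +-assoc x y y ⟨
      (x + y) + y    ≡⟨ cong (_+ y) eq ⟩
      0# + y         ≡⟨ +-identityˡ y ⟩
      y              ∎

    -x≡x : ∀ x → - x ≡ x
    -x≡x x = x+y≡0⇒x≡y (-‿inverseˡ x)

    private
      bit : Bool → Carrier
      bit b = if b then 1# else 0#

      𝔽₂ : RawRing _ _
      𝔽₂ = record { Carrier = Bool ; _≈_ = _≡_ ; _+_ = _xor_ ; _*_ = _∧_ ; -_ = id ; 0# = false ; 1# = true }

      bit-homo : 𝔽₂ -Raw-AlmostCommutative⟶ fromCommutativeRing commutativeRing
      bit-homo = record
        { ⟦_⟧    = bit
        ; +-homo = λ { false b → sym (+-identityˡ (bit b)) ; true false → sym (+-identityʳ 1#) ; true true → sym two≡0 }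
        ; *-homo = λ { false b → sym (zeroˡ (bit b)) ; true b → sym (*-identityˡ (bit b)) }
        ; -‿homo = λ b → sym (-x≡x (bit b))
        ; 0-homo = refl
        ; 1-homo = refl
        }

    -- Coefficients in 𝔽₂ let the solver use 2 = 0.
    open Algebra.Solver.Ring 𝔽₂ (fromCommutativeRing commutativeRing) bit-homo
      (λ b c → Maybe.map (cong bit) (dec⇒maybe (b Bool.≟ c))) public
      using (solve; con; _:=_; _:+_; _:*_)

    frobenius-+ : ∀ k x y → (x + y) ^ (2 ℕ.^ k) ≡ x ^ (2 ℕ.^ k) + y ^ (2 ℕ.^ k)
    frobenius-+ zero    x y = trans (*-identityʳ _) (sym (cong₂ _+_ (*-identityʳ x) (*-identityʳ y)))
    frobenius-+ (suc k) x y = begin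
      (x + y) ^ (2 ℕ.* 2 ℕ.^ k)                  ≡⟨ ^-assocʳ (x + y) 2 (2 ℕ.^ k) ⟨
      ((x + y) ^ 2) ^ (2 ℕ.^ k)                  ≡⟨ cong (_^ (2 ℕ.^ k)) square ⟩
      (x ^ 2 + y ^ 2) ^ (2 ℕ.^ k)                ≡⟨ frobenius-+ k (x ^ 2) (y ^ 2) ⟩
      (x ^ 2) ^ (2 ℕ.^ k) + (y ^ 2) ^ (2 ℕ.^ k)  ≡⟨ cong₂ _+_ (^-assocʳ x 2 (2 ℕ.^ k)) (^-assocʳ y 2 (2 ℕ.^ k)) ⟩
      x ^ (2 ℕ.^ suc k) + y ^ (2 ℕ.^ suc k)      ∎
      where
      square : (x + y) ^ 2 ≡ x ^ 2 + y ^ 2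
      square = solve 2 (λ x y → (x :+ y) :* ((x :+ y) :* con true) := x :* (x :* con true) :+ y :* (y :* con true)) refl x y

    frobenius-injective : ∀ k {x y} → x ^ (2 ℕ.^ k) ≡ y ^ (2 ℕ.^ k) → x ≡ y
    frobenius-injective k {x} {y} eq = x+y≡0⇒x≡y (x^k≡0⇒x≡0 (2 ℕ.^ k)
      (trans (frobenius-+ k x y) (trans (cong (_+ y ^ (2 ℕ.^ k)) eq) (x+x≡0 _))))

-- The quadratic extension, its subfield and the trace character

square-injective : ∀ {m n} → m ℕ.* m ≡ n ℕ.* n → m ≡ n
square-injective {m} {n} eq with ℕ.<-cmp m n
... | tri< m<n _ _ = contradiction eq (ℕ.<⇒≢ (ℕ.*-mono-< m<n m<n))
... | tri≈ _ m≡n _ = m≡n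
... | tri> _ _ n<m = contradiction (sym eq) (ℕ.<⇒≢ (ℕ.*-mono-< n<m n<m))

record QuadraticGenerator (e : ℕ) (K : FiniteField ((2 ℕ.^ e) ℕ.^ 2)) : Set where
  open FiniteField K
  open Over K
  field
    ε δ       : Carrier
    ε∉F       : ¬ InSubfield (2 ℕ.^ e) ε
    δ∈F       : InSubfield (2 ℕ.^ e) δ
    tr[δ]≡1   : absoluteTrace e δ ≡ 1#
    ε²+ε+δ≡0  : ε * ε + ε + δ ≡ 0#

module QuadraticExtension {e : ℕ} {K : FiniteField ((2 ℕ.^ e) ℕ.^ 2)} (generator : QuadraticGenerator e K) where
  open QuadraticGenerator generator public
  open FiniteField K public
  open FieldTheory K public
  open Over K using (absoluteTrace)
  open ≡-Reasoning

  q : ℕ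
  q = 2 ℕ.^ e

  q² : (2 ℕ.^ e) ℕ.^ 2 ≡ q ℕ.* q
  q² = cong (q ℕ.*_) (ℕ.*-identityʳ q)

  open CharacteristicTwo (1+1≡0 (e ℕ.* 2) (ℕ.^-*-assoc 2 e 2)) public

  0^2^k≡0 : ∀ k → 0# ^ (2 ℕ.^ k) ≡ 0#
  0^2^k≡0 k = trans (cong (_^ (2 ℕ.^ k)) (sym (x+x≡0 0#))) (trans (frobenius-+ k 0# 0#) (x+x≡0 _))

  bar : Carrier → Carrier
  bar x = x ^ q

  bar-+ : ∀ x y → bar (x + y) ≡ bar x + bar y
  bar-+ = frobenius-+ e

  bar-* : ∀ x y → bar (x * y) ≡ bar x * bar y
  bar-* x y = ^-distrib-* x y q

  bar-^ : ∀ x k → bar (x ^ k) ≡ bar x ^ k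
  bar-^ x k = trans (^-assocʳ x k q) (trans (cong (x ^_) (ℕ.*-comm k q)) (sym (^-assocʳ x q k)))

  bar-0 : bar 0# ≡ 0#
  bar-0 = 0^2^k≡0 e

  bar-1 : bar 1# ≡ 1#
  bar-1 = 1^k≡1 q

  bar-involutive : ∀ x → bar (bar x) ≡ x
  bar-involutive x with x ≟ 0#
  ... | yes refl = trans (cong bar bar-0) bar-0
  ... | no x≢0 = trans (^-assocʳ x q q) (trans (cong (x ^_) (sym q²)) (fermat x≢0))

  -- Both ε and its conjugate are roots of X² + X + δ. Adding the two equations gives (bar ε +
  -- ε)(bar ε + ε + 1) = 0, and the first factor is nonzero because ε is outside the subfield.
  bar[ε] : bar ε ≡ ε + 1#
  bar[ε] = x+y≡0⇒x≡y (no-zero-divisors {bar ε + ε} (λ eq → ε∉F (x+y≡0⇒x≡y eq)) (begin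
    (bar ε + ε) * (bar ε + (ε + 1#))                         ≡⟨ solve 3 (λ x y d → (x :+ y) :* (x :+ (y :+ con true)) := (x :* x :+ x :+ d) :+ (y :* y :+ y :+ d)) refl (bar ε) ε δ ⟩
    (bar ε * bar ε + bar ε + δ) + (ε * ε + ε + δ)            ≡⟨ cong₂ _+_ conjugate ε²+ε+δ≡0 ⟩
    0# + 0#                                                  ≡⟨ x+x≡0 0# ⟩
    0#                                                       ∎))
    where
    conjugate : bar ε * bar ε + bar ε + δ ≡ 0#
    conjugate = begin
      bar ε * bar ε + bar ε + δ          ≡⟨ cong₂ (λ s t → s + bar ε + t) (bar-* ε ε) δ∈F ⟨
      bar (ε * ε) + bar ε + bar δ        ≡⟨ cong (_+ bar δ) (bar-+ _ _) ⟨
      bar (ε * ε + ε) + bar δ            ≡⟨ bar-+ _ _ ⟨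
      bar (ε * ε + ε + δ)                ≡⟨ cong bar ε²+ε+δ≡0 ⟩
      bar 0#                             ≡⟨ bar-0 ⟩
      0#                                 ∎

  InF : Carrier → Set
  InF x = bar x ≡ x

  +-InF : ∀ {x y} → InF x → InF y → InF (x + y)
  +-InF x∈ y∈ = trans (bar-+ _ _) (cong₂ _+_ x∈ y∈)

  *-InF : ∀ {x y} → InF x → InF y → InF (x * y)
  *-InF x∈ y∈ = trans (bar-* _ _) (cong₂ _*_ x∈ y∈)

  ^-InF : ∀ {x} k → InF x → InF (x ^ k)
  ^-InF {x} k x∈ = trans (bar-^ x k) (cong (_^ k) x∈)

  -- x = re x + im x * ε with re x and im x in the subfield.
  im re : Carrier → Carrier
  im x = bar x + x
  re x = x + im x * ε

  im-+ : ∀ x y → im (x + y) ≡ im x + im y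
  im-+ x y = trans (cong (_+ (x + y)) (bar-+ x y))
    (solve 4 (λ x̄ ȳ x y → x̄ :+ ȳ :+ (x :+ y) := x̄ :+ x :+ (ȳ :+ y)) refl (bar x) (bar y) x y)

  im-*ˡ : ∀ {a} → InF a → ∀ x → im (a * x) ≡ a * im x
  im-*ˡ {a} a∈ x = trans (cong (_+ a * x) (trans (bar-* a x) (cong (_* bar x) a∈))) (sym (distribˡ a _ _))

  im-InF : ∀ x → InF (im x)
  im-InF x = trans (bar-+ _ _) (trans (cong (_+ bar x) (bar-involutive x)) (+-comm _ _))

  im≡0 : ∀ {a} → InF a → im a ≡ 0#
  im≡0 {a} a∈ = trans (cong (_+ a) a∈) (x+x≡0 a)

  im[ε]≡1 : im ε ≡ 1#
  im[ε]≡1 = trans (cong (_+ ε) bar[ε]) (solve 1 (λ x → x :+ con true :+ x := con true) refl ε)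

  re+imε : ∀ x → re x + im x * ε ≡ x
  re+imε x = solve 2 (λ x y → x :+ y :+ y := x) refl x (im x * ε)

  im-a+bε : ∀ {a b} → InF a → InF b → im (a + b * ε) ≡ b
  im-a+bε {a} {b} a∈ b∈ = begin
    im (a + b * ε)        ≡⟨ im-+ a (b * ε) ⟩
    im a + im (b * ε)     ≡⟨ cong₂ _+_ (im≡0 a∈) (trans (im-*ˡ b∈ ε) (cong (b *_) im[ε]≡1)) ⟩
    0# + b * 1#           ≡⟨ trans (+-identityˡ _) (*-identityʳ b) ⟩
    b                     ∎

  re-a+bε : ∀ {a b} → InF a → InF b → re (a + b * ε) ≡ a
  re-a+bε {a} {b} a∈ b∈ = trans (cong (λ t → a + b * ε + t * ε) (im-a+bε a∈ b∈))
    (solve 2 (λ x y → x :+ y :+ y := x) refl a (b * ε))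

  -- Conjugation adds im x to x, and also to im x · ε since bar ε = ε + 1; the two changes cancel.
  re-InF : ∀ x → InF (re x)
  re-InF x = begin
    bar (x + im x * ε)                     ≡⟨ bar-+ _ _ ⟩
    bar x + bar (im x * ε)                 ≡⟨ cong (bar x +_) (trans (bar-* _ _) (cong₂ _*_ (im-InF x) bar[ε])) ⟩
    bar x + im x * (ε + 1#)                ≡⟨ solve 3 (λ x̄ x w → x̄ :+ (x̄ :+ x) :* (w :+ con true) := x :+ (x̄ :+ x) :* w) refl (bar x) x ε ⟩
    re x                                   ∎

  -- As `fixed` is irrelevant, equality in `F` is equality of values, which `FiniteField` requires
  -- because its laws are stated for `_≡_`. Decidability of the equation lets `recompute` recover
  -- the proof.
  record F : Set where
    constructor _∈F
    field
      {val}  : Carrier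
      .fixed : InF val
  open F using (val) public

  val-InF : (a : F) → InF (val a)
  val-InF (_∈F {x} x∈) = recompute (bar x ≟ x) x∈

  F-≡ : ∀ {a b} → val a ≡ val b → a ≡ b
  F-≡ refl = refl

  private
    inF? : Decidable InF
    inF? x = bar x ≟ x

    members : Subset ((2 ℕ.^ e) ℕ.^ 2)
    members = subsetOf (inF? ∘ Inverse.to enumeration)

    listing : Fin ∣ members ∣ ↔ F
    listing = mk↔ₛ′ there′ (proj₁ ∘ back) (proj₂ ∘ back) (λ i → there′-injective (proj₂ (back (there′ i))))
      where
      there′ : Fin ∣ members ∣ → F
      there′ i = ∈-subsetOf⁻ (inF? ∘ Inverse.to enumeration) (nth-∈ members i) ∈F
      there′-injective : ∀ {i j} → there′ i ≡ there′ j → i ≡ j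
      there′-injective eq = nth-injective members (Injection.injective (Inverse.↔⇒↣ enumeration) (cong val eq))
      back : (a : F) → ∃[ i ] there′ i ≡ a
      back a with nth-surjective members {Inverse.from enumeration (val a)}
                    (∈-subsetOf⁺ (inF? ∘ Inverse.to enumeration) (subst InF (sym (Inverse.strictlyInverseˡ enumeration (val a))) (val-InF a)))
      ... | i , eq = i , F-≡ (trans (cong (Inverse.to enumeration) eq) (Inverse.strictlyInverseˡ enumeration (val a)))

    coordinates : Carrier ↔ (F × F)
    coordinates = mk↔ₛ′ (λ x → re-InF x ∈F , im-InF x ∈F) (λ (a , b) → val a + val b * ε)
      (λ (a , b) → cong₂ _,_ (F-≡ (re-a+bε (val-InF a) (val-InF b))) (F-≡ (im-a+bε (val-InF a) (val-InF b))))
      re+imε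

    -- The coordinates re and im identify K with F × F, so ∣F∣² = q². This avoids counting the roots
    -- of X^q - X.
    ∣F∣≡q : ∣ members ∣ ≡ q
    ∣F∣≡q = square-injective (sym (trans (sym q²) (↔⇒≡ pairs)))
      where
      pairs : Fin ((2 ℕ.^ e) ℕ.^ 2) ↔ Fin (∣ members ∣ ℕ.* ∣ members ∣)
      pairs = Inverse.↔-trans enumeration (Inverse.↔-trans coordinates
        (Inverse.↔-trans (Inverse.↔-sym (listing ×-↔ listing)) (Inverse.↔-sym Fin.*↔×)))

  F-enumeration : Fin q ↔ F
  F-enumeration = subst (λ m → Fin m ↔ F) ∣F∣≡q listing

  subfield : FiniteField q
  subfield = record
    { Carrier = F
    ; _+_ = λ a b → +-InF (val-InF a) (val-InF b) ∈F
    ; _*_ = λ a b → *-InF (val-InF a) (val-InF b) ∈F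
    ; -_ = λ a → trans (cong bar (-x≡x (val a))) (trans (val-InF a) (sym (-x≡x (val a)))) ∈F
    ; 0# = bar-0 ∈F
    ; 1# = bar-1 ∈F
    ; isCommutativeRing = record
      { isRing = record
        { +-isAbelianGroup = record
          { isGroup = record
            { isMonoid = record
              { isSemigroup = record
                { isMagma = record { isEquivalence = isEquivalence ; ∙-cong = cong₂ _ }
                ; assoc = λ a b c → F-≡ (+-assoc (val a) (val b) (val c)) }
              ; identity = (λ a → F-≡ (+-identityˡ (val a))) , λ a → F-≡ (+-identityʳ (val a)) }
            ; inverse = (λ a → F-≡ (-‿inverseˡ (val a))) , λ a → F-≡ (-‿inverseʳ (val a))
            ; ⁻¹-cong = λ { refl → refl } }
          ; comm = λ a b → F-≡ (+-comm (val a) (val b)) }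
        ; *-cong = cong₂ _
        ; *-assoc = λ a b c → F-≡ (*-assoc (val a) (val b) (val c))
        ; *-identity = (λ a → F-≡ (*-identityˡ (val a))) , λ a → F-≡ (*-identityʳ (val a))
        ; distrib = (λ a b c → F-≡ (distribˡ (val a) (val b) (val c))) , λ a b c → F-≡ (distribʳ (val a) (val b) (val c)) }
      ; *-comm = λ a b → F-≡ (*-comm (val a) (val b)) }
    ; 0≢1 = λ eq → 0≢1 (cong val eq)
    ; invertible = λ a a≢0 → let val≢0 = λ eq → a≢0 (F-≡ eq) in
        inverse-InF a val≢0 ∈F , F-≡ (x*x⁻¹≡1 val≢0)
    ; enumeration = F-enumeration
    }
    where
    inverse-InF : ∀ a → val a ≢ 0# → InF (val a ⁻¹)
    inverse-InF a a≢0 = *-cancelˡ a≢0 (begin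
      val a * bar (val a ⁻¹)          ≡⟨ cong (_* bar (val a ⁻¹)) (val-InF a) ⟨
      bar (val a) * bar (val a ⁻¹)    ≡⟨ bar-* _ _ ⟨
      bar (val a * val a ⁻¹)          ≡⟨ cong bar (x*x⁻¹≡1 a≢0) ⟩
      bar 1#                          ≡⟨ bar-1 ⟩
      1#                              ≡⟨ x*x⁻¹≡1 a≢0 ⟨
      val a * val a ⁻¹                ∎)

  private
    module ∑ = Algebra.Properties.CommutativeMonoid.Sum +-commutativeMonoid

    trace : ℕ → Carrier → Carrier
    trace k x = ∑.sum {k} (λ i → x ^ (2 ℕ.^ toℕ i))

    trace-+ : ∀ k x y → trace k (x + y) ≡ trace k x + trace k y
    trace-+ k x y = trans (∑.sum-cong-≗ {k} λ i → frobenius-+ (toℕ i) x y) (∑.∑-distrib-+ {k} _ _)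

    ∑-last : ∀ k (f : ℕ → Carrier) → f 0 + ∑.sum {k} (λ i → f (suc (toℕ i))) ≡ ∑.sum {k} (f ∘ toℕ) + f k
    ∑-last zero    f = +-comm _ _
    ∑-last (suc k) f = trans (cong (f 0 +_) (∑-last k (f ∘ suc))) (sym (+-assoc _ _ _))

    ∑-square : ∀ {k} (f : Fin k → Carrier) → ∑.sum f * ∑.sum f ≡ ∑.sum (λ i → f i * f i)
    ∑-square {zero}  f = zeroˡ 0#
    ∑-square {suc k} f = trans
      (solve 2 (λ x y → (x :+ y) :* (x :+ y) := x :* x :+ y :* y) refl (f zero) (∑.sum (f ∘ suc)))
      (cong (f zero * f zero +_) (∑-square (f ∘ suc)))

    -- Squaring shifts every exponent 2^i to 2^(i+1), and x^(2^e) = x closes the cycle. Adding x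
    -- twice restores the missing first power, so that `∑-last` can trade it for the last one.
    trace-idempotent : ∀ {x} → InF x → trace e x * trace e x ≡ trace e x
    trace-idempotent {x} x∈ = begin
      trace e x * trace e x                            ≡⟨ ∑-square {e} _ ⟩
      ∑.sum {e} (λ i → x ^ (2 ℕ.^ toℕ i) * x ^ (2 ℕ.^ toℕ i))  ≡⟨ ∑.sum-cong-≗ {e} (λ i → double (toℕ i)) ⟩
      rest                                             ≡⟨ solve 2 (λ x y → y := x :+ y :+ x) refl x rest ⟩
      x + rest + x                                     ≡⟨ cong (λ t → t + rest + x) (*-identityʳ x) ⟨
      x ^ 1 + rest + x                                 ≡⟨ cong (_+ x) (∑-last e (λ i → x ^ (2 ℕ.^ i))) ⟩
      trace e x + bar x + x                            ≡⟨ cong (λ t → trace e x + t + x) x∈ ⟩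
      trace e x + x + x                                ≡⟨ solve 2 (λ x y → y :+ x :+ x := y) refl x (trace e x) ⟩
      trace e x                                        ∎
      where
      rest : Carrier
      rest = ∑.sum {e} (λ i → x ^ (2 ℕ.^ suc (toℕ i)))
      double : ∀ i → x ^ (2 ℕ.^ i) * x ^ (2 ℕ.^ i) ≡ x ^ (2 ℕ.^ suc i)
      double i = trans (sym (^-homo-* x (2 ℕ.^ i) (2 ℕ.^ i))) (cong (λ j → x ^ (2 ℕ.^ i ℕ.+ j)) (sym (ℕ.+-identityʳ (2 ℕ.^ i))))

    trace-bit : ∀ (a : F) → trace e (val a) ≡ 0# ⊎ trace e (val a) ≡ 1#
    trace-bit a with trace e (val a) ≟ 0#
    ... | yes ≡0 = inj₁ ≡0
    ... | no ≢0  = inj₂ (*-cancelˡ ≢0 (trans (trace-idempotent (val-InF a)) (sym (*-identityʳ _))))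

    sign : ∀ {t : Carrier} → t ≡ 0# ⊎ t ≡ 1# → ℤ
    sign (inj₁ _) = 1ℤ
    sign (inj₂ _) = -1ℤ

    sign-+ : ∀ {s t u} (s-bit : s ≡ 0# ⊎ s ≡ 1#) (t-bit : t ≡ 0# ⊎ t ≡ 1#) (u-bit : u ≡ 0# ⊎ u ≡ 1#) →
             s ≡ t + u → sign s-bit ≡ sign t-bit ℤ.* sign u-bit
    sign-+ (inj₁ refl) (inj₁ refl) (inj₁ refl) eq = refl
    sign-+ (inj₁ refl) (inj₁ refl) (inj₂ refl) eq = contradiction (trans eq (+-identityˡ 1#)) 0≢1
    sign-+ (inj₁ refl) (inj₂ refl) (inj₁ refl) eq = contradiction (trans eq (+-identityʳ 1#)) 0≢1
    sign-+ (inj₁ refl) (inj₂ refl) (inj₂ refl) eq = refl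
    sign-+ (inj₂ refl) (inj₁ refl) (inj₁ refl) eq = contradiction (sym (trans eq (x+x≡0 0#))) 0≢1
    sign-+ (inj₂ refl) (inj₁ refl) (inj₂ refl) eq = refl
    sign-+ (inj₂ refl) (inj₂ refl) (inj₁ refl) eq = refl
    sign-+ (inj₂ refl) (inj₂ refl) (inj₂ refl) eq = contradiction (sym (trans eq (x+x≡0 1#))) 0≢1

  -- This is (-1)^Tr on the subfield. Nontriviality comes from δ, whose trace is 1.
  trace-character : SignCharacter subfield
  trace-character = record
    { χ            = χ
    ; χ-homo       = λ a b → sign-+ (trace-bit _) (trace-bit a) (trace-bit b) (trace-+ e (val a) (val b))
    ; χ-sign       = χ-sign
    ; χ-nontrivial = (δ∈F ∈F) , χ[δ]
    }
    where
    χ : F → ℤ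
    χ a = sign (trace-bit a)
    χ-sign : ∀ a → χ a ≡ 1ℤ ⊎ χ a ≡ -1ℤ
    χ-sign a with trace-bit a
    ... | inj₁ _ = inj₁ refl
    ... | inj₂ _ = inj₂ refl
    χ[δ] : χ (δ∈F ∈F) ≡ -1ℤ
    χ[δ] with trace-bit (δ∈F ∈F)
    ... | inj₁ ≡0 = contradiction (trans (sym ≡0) tr[δ]≡1) 0≢1
    ... | inj₂ _  = refl

-- The function γ, affine plane sections and the ratios at infinity

odd⇒half-sum : ∀ e → ¬ (2 ∣ e) → (e ℕ.+ 1) / 2 ℕ.+ (e ℕ.+ 1) / 2 ≡ suc e
odd⇒half-sum e odd with e % 2 | m%n<n e 2 | m≡m%n+[m/n]*n e 2 | m%n≡0⇒n∣m e 2
... | 0           | _             | _  | even = contradiction (even refl) odd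
... | 1           | _             | eq | _    = trans (cong₂ ℕ._+_ half half) (trans (sym (double (suc k))) (sym suc-e))
  where
  k = e / 2
  double : ∀ m → m ℕ.* 2 ≡ m ℕ.+ m
  double m = trans (ℕ.*-comm m 2) (cong (m ℕ.+_) (ℕ.+-identityʳ m))
  suc-e : suc e ≡ suc k ℕ.* 2
  suc-e = cong suc eq
  half : (e ℕ.+ 1) / 2 ≡ suc k
  half = trans (cong (_/ 2) (trans (ℕ.+-comm e 1) suc-e)) (m*n/n≡m (suc k) 2)
... | suc (suc _) | s≤s (s≤s ()) | _ | _

module Surface {e : ℕ} {K : FiniteField ((2 ℕ.^ e) ℕ.^ 2)} (generator : QuadraticGenerator e K) (odd : ¬ (2 ∣ e)) where
  open QuadraticExtension generator public
  open ≡-Reasoning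

  s σ D : ℕ
  s = (e ℕ.+ 1) / 2
  σ = 2 ℕ.^ s
  D = (σ ℕ.+ 2) ℕ.* q

  γ : Carrier → Carrier
  γ x = (x + (bar x + x) * ε) ^ (σ ℕ.+ 2) + (bar x + x) ^ σ + (x ^ (2 ℕ.* q) + x ^ 2) * ε + x ^ (q ℕ.+ 1) + x ^ 2

  -- The last three summands collapse into (x + (bar x + x)ε)(bar x + x) = (bar x² + x²)ε + bar x ·
  -- x + x², which is re x · im x.
  γ-coordinates : ∀ x → γ x ≡ re x ^ (σ ℕ.+ 2) + im x ^ σ + re x * im x
  γ-coordinates x = begin
    γ x
      ≡⟨ cong₂ (λ t u → u₀ + (t + x ^ 2) * ε + u + x ^ 2) x^2q x^[q+1] ⟩
    u₀ + (bar x * bar x + x ^ 2) * ε + bar x * x + x ^ 2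
      ≡⟨ solve 4 (λ u x̄ x w → u :+ (x̄ :* x̄ :+ x :* (x :* con true)) :* w :+ x̄ :* x :+ x :* (x :* con true) := u :+ (x :+ (x̄ :+ x) :* w) :* (x̄ :+ x)) refl u₀ (bar x) x ε ⟩
    u₀ + re x * im x ∎
    where
    u₀ = re x ^ (σ ℕ.+ 2) + im x ^ σ
    x^2q : x ^ (2 ℕ.* q) ≡ bar x * bar x
    x^2q = trans (^-homo-* x q (q ℕ.+ 0)) (cong (λ k → bar x * x ^ k) (ℕ.+-identityʳ q))
    x^[q+1] : x ^ (q ℕ.+ 1) ≡ bar x * x
    x^[q+1] = trans (^-homo-* x q 1) (cong (bar x *_) (*-identityʳ x))

  γ-InF : ∀ x → InF (γ x)
  γ-InF x = subst InF (sym (γ-coordinates x))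
    (+-InF (+-InF (^-InF (σ ℕ.+ 2) (re-InF x)) (^-InF σ (im-InF x))) (*-InF (re-InF x) (im-InF x)))

  module _ (α β κ : Carrier) where
    private
      -- The part of γ x + im(βx) + im α that depends only on a = re x; `h` is the same in `F`. What
      -- depends only on im x goes into `φ`.
      form : (β α : Carrier) → Carrier → Carrier
      form β α a = a ^ (σ ℕ.+ 2) + a * im β + im α

      h : (β α : Carrier) → F → F
      h β α a = +-InF (+-InF (^-InF (σ ℕ.+ 2) (val-InF a)) (*-InF (val-InF a) (im-InF β))) (im-InF α) ∈F

      φ : Carrier → F → F
      φ β b = +-InF (^-InF σ (val-InF b)) (*-InF (val-InF b) (im-InF (β * ε))) ∈F

      open CharacterSums subfield trace-character

      φ-+ : ∀ β → Additive (φ β)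
      φ-+ β a b = F-≡ (begin
        (val a + val b) ^ σ + (val a + val b) * t
          ≡⟨ cong (_+ (val a + val b) * t) (frobenius-+ s (val a) (val b)) ⟩
        val a ^ σ + val b ^ σ + (val a + val b) * t
          ≡⟨ solve 5 (λ u v x y t → u :+ v :+ (x :+ y) :* t := u :+ x :* t :+ (v :+ y :* t)) refl (val a ^ σ) (val b ^ σ) (val a) (val b) t ⟩
        val a ^ σ + val a * t + (val b ^ σ + val b * t) ∎)
        where t = im (β * ε)

      -- The constant im α of the plane is assigned to the sheet of x, hence the 0 in the sheet of
      -- y.
      open TwoSheets (h β α) (φ β) (h κ 0#) (φ κ) (φ-+ β) (φ-+ κ)

      -- Since im is linear over the subfield, im(βx) is a linear form in re x and im x, with its
      -- values at β and βε as coefficients.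
      im-linear : ∀ β x → im (β * x) ≡ re x * im β + im x * im (β * ε)
      im-linear β x = begin
        im (β * x)                                  ≡⟨ cong (λ t → im (β * t)) (re+imε x) ⟨
        im (β * (re x + im x * ε))                  ≡⟨ cong im (solve 4 (λ β a b w → β :* (a :+ b :* w) := a :* β :+ b :* (β :* w)) refl β (re x) (im x) ε) ⟩
        im (re x * β + im x * (β * ε))              ≡⟨ im-+ _ _ ⟩
        im (re x * β) + im (im x * (β * ε))         ≡⟨ cong₂ _+_ (im-*ˡ (re-InF x) β) (im-*ˡ (im-InF x) (β * ε)) ⟩
        re x * im β + im x * im (β * ε)             ∎

      sheet-value : ∀ β α x → form β α (re x) + (re x * im x + (im x ^ σ + im x * im (β * ε))) ≡ γ x + im (β * x) + im α
      sheet-value β α x = begin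
        form β α a + (a * b + (b ^ σ + b * im (β * ε)))
          ≡⟨ solve 7 (λ u v a b s t r → u :+ a :* s :+ r :+ (a :* b :+ (v :+ b :* t)) := u :+ v :+ a :* b :+ (a :* s :+ b :* t) :+ r) refl (a ^ (σ ℕ.+ 2)) (b ^ σ) a b (im β) (im (β * ε)) (im α) ⟩
        a ^ (σ ℕ.+ 2) + b ^ σ + a * b + (a * im β + b * im (β * ε)) + im α
          ≡⟨ cong₂ (λ s t → s + t + im α) (γ-coordinates x) (im-linear β x) ⟨
        γ x + im (β * x) + im α ∎
        where
        a = re x
        b = im x

      OnPlane : Carrier × Carrier → Set
      OnPlane (x , y) = im (α + β * x + κ * y) ≡ γ x + γ y

      sheets-cancel : ∀ x y → OnPlane (x , y) →
        form β α (re x) + (re x * im x + (im x ^ σ + im x * im (β * ε))) +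
        (form κ 0# (re y) + (re y * im y + (im y ^ σ + im y * im (κ * ε)))) ≡ 0#
      sheets-cancel x y on = begin
        form β α (re x) + (re x * im x + (im x ^ σ + im x * im (β * ε))) +
        (form κ 0# (re y) + (re y * im y + (im y ^ σ + im y * im (κ * ε))))
          ≡⟨ cong₂ _+_ (sheet-value β α x) (sheet-value κ 0# y) ⟩
        γ x + im (β * x) + im α + (γ y + im (κ * y) + im 0#)
          ≡⟨ cong (λ t → γ x + im (β * x) + im α + (γ y + im (κ * y) + t)) (im≡0 bar-0) ⟩
        γ x + im (β * x) + im α + (γ y + im (κ * y) + 0#)
          ≡⟨ solve 5 (λ g u a h v → g :+ u :+ a :+ (h :+ v :+ con false) := a :+ u :+ v :+ (g :+ h)) refl (γ x) (im (β * x)) (im α) (γ y) (im (κ * y)) ⟩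
        im α + im (β * x) + im (κ * y) + (γ x + γ y)
          ≡⟨ cong (_+ (γ x + γ y)) (trans (im-+ (α + β * x) (κ * y)) (cong (_+ im (κ * y)) (im-+ α (β * x)))) ⟨
        im (α + β * x + κ * y) + (γ x + γ y)
          ≡⟨ cong (_+ (γ x + γ y)) on ⟩
        (γ x + γ y) + (γ x + γ y)
          ≡⟨ x+x≡0 (γ x + γ y) ⟩
        0# ∎

    -- The coordinates re and im of x and y embed the solutions into the balanced quadruples. The
    -- common factor q of the inequality is kept here and cancelled in `OffApex`.
    affine-plane-count : ∃[ m ] q ℕ.* m ℕ.+ q ℕ.* q ≤ q ℕ.* q ℕ.* (q ℕ.* q) ℕ.+ q ℕ.* (q ℕ.* q)
      × AtMost m (λ ((x , y) : Carrier × Carrier) → im (α + β * x + κ * y) ≡ γ x + γ y)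
    affine-plane-count = let (m , bound , count) = balanced-count in m , bound , atMost-along {P = OnPlane}
      (λ (x , y) _ → re-InF x ∈F , im-InF x ∈F , re-InF y ∈F , im-InF y ∈F) balanced
      (λ { {x , y} {x′ , y′} _ _ eq → cong₂ _,_
        (coordinates-injective (cong (val ∘ proj₁) eq) (cong (val ∘ proj₁ ∘ proj₂) eq))
        (coordinates-injective (cong (val ∘ proj₁ ∘ proj₂ ∘ proj₂) eq) (cong (val ∘ proj₂ ∘ proj₂ ∘ proj₂) eq)) })
      count
      where
      coordinates-injective : ∀ {x y} → re x ≡ re y → im x ≡ im y → x ≡ y
      coordinates-injective {x} {y} r i = trans (sym (re+imε x)) (trans (cong₂ (λ a b → a + b * ε) r i) (re+imε y))
      balanced : ∀ p (on : OnPlane p) → Balanced (re-InF (proj₁ p) ∈F , im-InF (proj₁ p) ∈F , re-InF (proj₂ p) ∈F , im-InF (proj₂ p) ∈F)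
      balanced (x , y) on = F-≡ (sheets-cancel x y on)

  0^D≡0 : 0# ^ D ≡ 0#
  0^D≡0 = trans (sym (^-assocʳ 0# (σ ℕ.+ 2) q)) (trans (cong (λ m → (0# ^ m) ^ q) (ℕ.+-comm σ 2)) (trans (cong bar (zeroˡ _)) bar-0))

  -- As e is odd, s is exactly (e + 1)/2, so σ² = 2^(e+1).
  σσ≡2q : σ ℕ.* σ ≡ q ℕ.+ q
  σσ≡2q = trans (sym (ℕ.^-distribˡ-+-* 2 s s)) (trans (cong (2 ℕ.^_) (odd⇒half-sum e odd)) (cong (q ℕ.+_) (ℕ.+-identityʳ q)))

  -- Raising ω^σ ω² = 1 to the power σ and using σ² = 2q gives ω^q = ω².
  root-of-unity : ∀ {ω} → ω ^ D ≡ 1# → bar ω ≡ ω * ω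
  root-of-unity {ω} ω^D≡1 = *-cancelˡ t≢0 (trans tω̄≡1 (sym tω²≡1))
    where
    t = ω ^ σ
    ω^[σ+2]≡1 : ω ^ (σ ℕ.+ 2) ≡ 1#
    ω^[σ+2]≡1 = frobenius-injective e (trans (^-assocʳ ω (σ ℕ.+ 2) q) (trans ω^D≡1 (sym bar-1)))
    tω²≡1 : t * (ω * ω) ≡ 1#
    tω²≡1 = trans (cong (λ x → t * (ω * x)) (sym (*-identityʳ ω))) (trans (sym (^-homo-* ω σ 2)) ω^[σ+2]≡1)
    t≢0 : t ≢ 0#
    t≢0 t≡0 = 0≢1 (trans (sym (zeroˡ _)) (trans (cong (_* (ω * ω)) (sym t≡0)) tω²≡1))
    t^σ : t ^ σ ≡ bar ω * bar ω
    t^σ = trans (^-assocʳ ω σ σ) (trans (cong (ω ^_) σσ≡2q) (^-homo-* ω q q))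
    square : (t * bar ω) ^ 2 ≡ 1# ^ 2
    square = begin
      (t * bar ω) ^ 2                   ≡⟨ solve 2 (λ t b → (t :* b) :* ((t :* b) :* con true) := (b :* b) :* (t :* t)) refl t (bar ω) ⟩
      (bar ω * bar ω) * (t * t)         ≡⟨ cong₂ _*_ t^σ (^-distrib-* ω ω σ) ⟨
      t ^ σ * (ω * ω) ^ σ               ≡⟨ ^-distrib-* t (ω * ω) σ ⟨
      (t * (ω * ω)) ^ σ                 ≡⟨ cong (_^ σ) tω²≡1 ⟩
      1# ^ σ                            ≡⟨ 1^k≡1 σ ⟩
      1#                                ≡⟨ 1^k≡1 2 ⟨
      1# ^ 2                            ∎
    tω̄≡1 : t * bar ω ≡ 1#
    tω̄≡1 = frobenius-injective 1 square

  -- From bar ω = ω² and bar (bar ω) = ω one gets ω⁴ = ω, so ω ≠ 1 satisfies ω² + ω = 1, and ω² + ω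
  -- is im ω. Remembering only im ω = 1 allows q values besides 1; that still fits both the plane at
  -- infinity, with (q + 1)q² + 1 points, and the planes missing the apex.
  root-cases : ∀ {ω} → ω ^ D ≡ 1# → ω ≡ 1# ⊎ im ω ≡ 1#
  root-cases {ω} ω^D≡1 with ω ≟ 1#
  ... | yes ω≡1 = inj₁ ω≡1
  ... | no ω≢1  = inj₂ (trans (cong (_+ ω) ω̄≡ω²) (x+y≡0⇒x≡y (no-zero-divisors product≢0 product≡0)))
    where
    ω̄≡ω² : bar ω ≡ ω * ω
    ω̄≡ω² = root-of-unity ω^D≡1
    ω⁴≡ω : (ω * ω) * (ω * ω) ≡ ω
    ω⁴≡ω = trans (cong₂ _*_ (sym ω̄≡ω²) (sym ω̄≡ω²)) (trans (sym (bar-* ω ω)) (trans (cong bar (sym ω̄≡ω²)) (bar-involutive ω)))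
    ω≢0 : ω ≢ 0#
    ω≢0 refl = 0≢1 (trans (sym 0^D≡0) ω^D≡1)
    product≢0 : ω * (ω + 1#) ≢ 0#
    product≢0 = *-≢0 ω≢0 (ω≢1 ∘ x+y≡0⇒x≡y)
    product≡0 : ω * (ω + 1#) * (ω * ω + ω + 1#) ≡ 0#
    product≡0 = trans (solve 1 (λ x → x :* (x :+ con true) :* (x :* x :+ x :+ con true) := x :* x :* (x :* x) :+ x) refl ω)
                      (trans (cong (_+ ω) ω⁴≡ω) (x+x≡0 ω))

  im-fibre-count : ∀ v → AtMost q (λ z → im z ≡ v)
  im-fibre-count v = atMost-along (λ z _ → re-InF z ∈F) _
    (λ {x} {y} ix iy eq → trans (sym (re+imε x)) (trans (cong₂ (λ a b → a + b * ε) (cong val eq) (trans ix (sym iy))) (re+imε y)))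
    (atMost-↔ F-enumeration)

  roots-of-unity-count : AtMost (1 ℕ.+ q) (λ ω → ω ^ D ≡ 1#)
  roots-of-unity-count = atMost-⊎ {Q = _≡ 1#} {R = λ ω → im ω ≡ 1#} (λ _ → root-cases)
    (atMost-1 λ x≡1 y≡1 → trans x≡1 (sym y≡1)) (im-fibre-count 1#)

-- Evaluation, degree and homogenization of formal polynomials

module PolynomialEvaluation {n : ℕ} (K : FiniteField n) where
  open FiniteField K
  open FieldTheory K
  open Over K
  open RawSemiringDefs (Semiring.rawSemiring semiring) using (product)
  open ≡-Reasoning

  private variable
    k d d′ : ℕ
    p r : Poly k

  infixl 6 _⊕_
  infixl 7 _⊗_
  infixr 8 _↑_
  _⊕_ _⊗_ : Poly k → Poly k → Poly k
  _⊕_ {k} = RawSemiring._+_ (poly-rawSemiring k)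
  _⊗_ {k} = RawSemiring._*_ (poly-rawSemiring k)
  _↑_ : Poly k → ℕ → Poly k
  _↑_ {k} = RawSemiringDefs._^_ (poly-rawSemiring k)

  Weight : ℕ → Set
  Weight k = Vec ℕ k → Carrier

  -- Evaluation and the value of a homogenization differ only in the weight given to an exponent
  -- vector, so sums and products are treated once for both.
  weigh : Weight k → Poly k → Carrier
  weigh w = foldr (λ (c , α) s → c * w α + s) 0#

  Exponents : Pred (Vec ℕ k) 0ℓ → Poly k → Set
  Exponents P = All (P ∘ proj₂)

  private
    ≡0ˡ : ∀ {x y} → x ≡ 0# → x * y ≡ 0#
    ≡0ˡ refl = zeroˡ _

    ≡0ʳ : ∀ {x y} → y ≡ 0# → x * y ≡ 0#
    ≡0ʳ refl = zeroʳ _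

  weigh-⊕ : ∀ (w : Weight k) p r → weigh w (p ⊕ r) ≡ weigh w p + weigh w r
  weigh-⊕ w []            r = sym (+-identityˡ _)
  weigh-⊕ w ((c , α) ∷ p) r = trans (cong (c * w α +_) (weigh-⊕ w p r)) (sym (+-assoc _ _ _))

  -- The weight of a homogenization uses truncated subtraction, which is multiplicative only below
  -- the degree bounds; `P` and `Q` carry these bounds.
  weigh-⊗ : ∀ {P Q : Pred (Vec ℕ k) 0ℓ} {w u v : Weight k} →
            (∀ α β → P α → Q β → w (zipWith ℕ._+_ α β) ≡ u α * v β) →
            Exponents P p → Exponents Q r → weigh w (p ⊗ r) ≡ weigh u p * weigh v r
  weigh-⊗ w≡ [] Qr = sym (zeroˡ _)
  weigh-⊗ {p = (c , α) ∷ p} {r = r} {w = w} {u} {v} w≡ (Pα ∷ Pp) Qr = begin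
    weigh w (map (times (c , α)) r ++ (p ⊗ r))                 ≡⟨ weigh-⊕ w (map (times (c , α)) r) (p ⊗ r) ⟩
    weigh w (map (times (c , α)) r) + weigh w (p ⊗ r)          ≡⟨ cong₂ _+_ (term r Qr) (weigh-⊗ w≡ Pp Qr) ⟩
    c * u α * weigh v r + weigh u p * weigh v r                ≡⟨ distribʳ (weigh v r) (c * u α) (weigh u p) ⟨
    (c * u α + weigh u p) * weigh v r                          ∎
    where
    times : Carrier × Vec ℕ _ → Carrier × Vec ℕ _ → Carrier × Vec ℕ _
    times (c , α) (d , β) = c * d , zipWith ℕ._+_ α β
    interchange : ∀ a b x y → a * b * (x * y) ≡ a * x * (b * y)
    interchange a b x y = begin
      a * b * (x * y)      ≡⟨ *-assoc a b (x * y) ⟩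
      a * (b * (x * y))    ≡⟨ cong (a *_) (trans (sym (*-assoc b x y)) (trans (cong (_* y) (*-comm b x)) (*-assoc x b y))) ⟩
      a * (x * (b * y))    ≡⟨ *-assoc a x (b * y) ⟨
      a * x * (b * y)      ∎
    term : ∀ r → Exponents _ r → weigh w (map (times (c , α)) r) ≡ c * u α * weigh v r
    term [] [] = sym (zeroʳ _)
    term ((d , β) ∷ r) (Qβ ∷ Qr) = begin
      c * d * w (zipWith ℕ._+_ α β) + weigh w (map (times (c , α)) r)
        ≡⟨ cong₂ _+_ (trans (cong (c * d *_) (w≡ α β Pα Qβ)) (interchange c d (u α) (v β))) (term r Qr) ⟩
      c * u α * (d * v β) + c * u α * weigh v r
        ≡⟨ distribˡ (c * u α) (d * v β) (weigh v r) ⟨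
      c * u α * (d * v β + weigh v r) ∎

  weigh-cong : ∀ {P : Pred (Vec ℕ k) 0ℓ} {u v : Weight k} → (∀ α → P α → u α ≡ v α) → Exponents P p → weigh u p ≡ weigh v p
  weigh-cong u≡v [] = refl
  weigh-cong {p = (c , _) ∷ _} u≡v (Pα ∷ Pp) = cong₂ (λ a s → c * a + s) (u≡v _ Pα) (weigh-cong u≡v Pp)

  weigh-* : ∀ (w : Weight k) c p → weigh (λ α → c * w α) p ≡ c * weigh w p
  weigh-* w c [] = sym (zeroʳ c)
  weigh-* w c ((d , α) ∷ p) = begin
    d * (c * w α) + weigh (λ α → c * w α) p   ≡⟨ cong₂ _+_ (trans (sym (*-assoc d c _)) (trans (cong (_* w α) (*-comm d c)) (*-assoc c d _))) (weigh-* w c p) ⟩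
    c * (d * w α) + c * weigh w p             ≡⟨ distribˡ c _ _ ⟨
    c * (d * w α + weigh w p)                 ∎

  weigh-const : ∀ (w : Weight k) c → w (replicate k 0) ≡ 1# → weigh w (constant c) ≡ c
  weigh-const w c w0≡1 = trans (+-identityʳ _) (trans (cong (c *_) w0≡1) (*-identityʳ c))

  monomial : Vec Carrier k → Weight k
  monomial x α = product (λ i → lookup x i ^ lookup α i)

  monomial-+ : ∀ (x : Vec Carrier k) α β → monomial x (zipWith ℕ._+_ α β) ≡ monomial x α * monomial x β
  monomial-+ []      []      []      = sym (*-identityˡ 1#)
  monomial-+ (x ∷ xs) (a ∷ α) (b ∷ β) = begin
    x ^ (a ℕ.+ b) * monomial xs (zipWith ℕ._+_ α β)         ≡⟨ cong₂ _*_ (^-homo-* x a b) (monomial-+ xs α β) ⟩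
    x ^ a * x ^ b * (monomial xs α * monomial xs β)         ≡⟨ *-assoc (x ^ a) (x ^ b) _ ⟩
    x ^ a * (x ^ b * (monomial xs α * monomial xs β))       ≡⟨ cong (x ^ a *_) (trans (sym (*-assoc _ _ _)) (trans (cong (_* monomial xs β) (*-comm _ _)) (*-assoc _ _ _))) ⟩
    x ^ a * (monomial xs α * (x ^ b * monomial xs β))       ≡⟨ *-assoc (x ^ a) _ _ ⟨
    x ^ a * monomial xs α * (x ^ b * monomial xs β)         ∎

  monomial-0 : ∀ (x : Vec Carrier k) → monomial x (replicate k 0) ≡ 1#
  monomial-0 []       = refl
  monomial-0 (x ∷ xs) = trans (*-identityˡ _) (monomial-0 xs)

  monomial-var : ∀ (x : Vec Carrier k) i → monomial x (replicate k 0 [ i ]≔ 1) ≡ lookup x i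
  monomial-var (x ∷ xs) zero    = trans (cong₂ _*_ (*-identityʳ x) (monomial-0 xs)) (*-identityʳ x)
  monomial-var (x ∷ xs) (suc i) = trans (*-identityˡ _) (monomial-var xs i)

  monomial-· : ∀ c (x : Vec Carrier k) α → monomial (c · x) α ≡ c ^ Vec.sum α * monomial x α
  monomial-· c []       []      = sym (*-identityˡ 1#)
  monomial-· c (x ∷ xs) (a ∷ α) = begin
    (c * x) ^ a * monomial (c · xs) α                       ≡⟨ cong₂ _*_ (^-distrib-* c x a) (monomial-· c xs α) ⟩
    c ^ a * x ^ a * (c ^ Vec.sum α * monomial xs α)         ≡⟨ *-assoc (c ^ a) _ _ ⟩
    c ^ a * (x ^ a * (c ^ Vec.sum α * monomial xs α))       ≡⟨ cong (c ^ a *_) (trans (sym (*-assoc _ _ _)) (trans (cong (_* monomial xs α) (*-comm _ _)) (*-assoc _ _ _))) ⟩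
    c ^ a * (c ^ Vec.sum α * (x ^ a * monomial xs α))       ≡⟨ *-assoc (c ^ a) _ _ ⟨
    c ^ a * c ^ Vec.sum α * (x ^ a * monomial xs α)         ≡⟨ cong (_* (x ^ a * monomial xs α)) (^-homo-* c a (Vec.sum α)) ⟨
    c ^ (a ℕ.+ Vec.sum α) * (x ^ a * monomial xs α)         ∎

  eval-⊕ : ∀ (p r : Poly k) x → eval (p ⊕ r) x ≡ eval p x + eval r x
  eval-⊕ p r x = weigh-⊕ (monomial x) p r

  eval-⊗ : ∀ (p r : Poly k) x → eval (p ⊗ r) x ≡ eval p x * eval r x
  eval-⊗ p r x = weigh-⊗ {P = λ _ → ⊤} {Q = λ _ → ⊤} {w = monomial x} (λ α β _ _ → monomial-+ x α β) (All.universal (λ _ → tt) p) (All.universal (λ _ → tt) r)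

  eval-const : ∀ c (x : Vec Carrier k) → eval (constant c) x ≡ c
  eval-const c x = weigh-const (monomial x) c (monomial-0 x)

  eval-var : ∀ i (x : Vec Carrier k) → eval (var i) x ≡ lookup x i
  eval-var i x = trans (+-identityʳ _) (trans (*-identityˡ _) (monomial-var x i))

  eval-↑ : ∀ (p : Poly k) m x → eval (p ↑ m) x ≡ eval p x ^ m
  eval-↑ p zero    x = eval-const 1# x
  eval-↑ p (suc m) x = trans (eval-⊗ p (p ↑ m) x) (cong (eval p x *_) (eval-↑ p m x))

  -- A condition on all listed terms, including those that cancel. Unlike `degree`, it passes
  -- through sums and products term by term.
  DegreeAtMost : ℕ → Poly k → Set
  DegreeAtMost d = Exponents (λ α → Vec.sum α ≤ d)

  sum-zipWith-+ : ∀ (α β : Vec ℕ k) → Vec.sum (zipWith ℕ._+_ α β) ≡ Vec.sum α ℕ.+ Vec.sum β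
  sum-zipWith-+ []      []      = refl
  sum-zipWith-+ (a ∷ α) (b ∷ β) = trans (cong (a ℕ.+ b ℕ.+_) (sum-zipWith-+ α β)) (interchange a b (Vec.sum α) (Vec.sum β))
    where open Algebra.Properties.CommutativeSemigroup ℕ.+-commutativeSemigroup using (interchange)

  sum-replicate-0 : ∀ k → Vec.sum (replicate k 0) ≡ 0
  sum-replicate-0 zero    = refl
  sum-replicate-0 (suc k) = sum-replicate-0 k

  sum-unit : ∀ (i : Fin k) → Vec.sum (replicate k 0 [ i ]≔ 1) ≡ 1
  sum-unit {suc k} zero    = cong suc (sum-replicate-0 k)
  sum-unit {suc k} (suc i) = sum-unit i

  degree-weaken : d ≤ d′ → DegreeAtMost d p → DegreeAtMost d′ p
  degree-weaken d≤d′ = All.map (λ ≤d → ℕ.≤-trans ≤d d≤d′)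

  degree-⊕ : DegreeAtMost d p → DegreeAtMost d r → DegreeAtMost d (p ⊕ r)
  degree-⊕ = All.++⁺

  degree-⊗ : DegreeAtMost d p → DegreeAtMost d′ r → DegreeAtMost (d ℕ.+ d′) (p ⊗ r)
  degree-⊗ [] _ = []
  degree-⊗ {p = (c , α) ∷ p} (α≤d ∷ p≤d) r≤d′ = All.++⁺
    (All.map⁺ (All.map (λ {(_ , β)} β≤d′ → subst (_≤ _) (sym (sum-zipWith-+ α β)) (ℕ.+-mono-≤ α≤d β≤d′)) r≤d′))
    (degree-⊗ p≤d r≤d′)

  degree-const : ∀ {c} → DegreeAtMost {k} 0 (constant c)
  degree-const {k} = ℕ.≤-reflexive (sum-replicate-0 k) ∷ []

  degree-var : ∀ (i : Fin k) → DegreeAtMost 1 (var i)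
  degree-var i = ℕ.≤-reflexive (sum-unit i) ∷ []

  degree-↑ : ∀ m → DegreeAtMost d p → DegreeAtMost (m ℕ.* d) (p ↑ m)
  degree-↑ zero    p≤d = degree-const
  degree-↑ (suc m) p≤d = degree-⊗ p≤d (degree-↑ m p≤d)

  degree-negate : DegreeAtMost d p → DegreeAtMost d (negate p)
  degree-negate p≤d = All.map⁺ p≤d

  -- The value at (x₀ ∷ x) of the homogenization in degree d.
  hweight : ℕ → Carrier → Vec Carrier k → Weight k
  hweight d x₀ x α = x₀ ^ (d ∸ Vec.sum α) * monomial x α

  homEval : ℕ → Poly k → Carrier → Vec Carrier k → Carrier
  homEval d p x₀ x = weigh (hweight d x₀ x) p

  eval-homogenize : ∀ (p : Poly k) x₀ x → eval (homogenize p) (x₀ ∷ x) ≡ homEval (degree p) p x₀ x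
  eval-homogenize p x₀ x = go p
    where
    go : ∀ r → eval (map (λ (c , α) → c , (degree p ∸ Vec.sum α) Vec.∷ α) r) (x₀ ∷ x) ≡ homEval (degree p) r x₀ x
    go []            = refl
    go ((c , α) ∷ r) = cong (c * hweight (degree p) x₀ x α +_) (go r)

  homEval-1 : ∀ d (p : Poly k) x → homEval d p 1# x ≡ eval p x
  homEval-1 d p x = weigh-cong {P = λ _ → ⊤} (λ α _ → trans (cong (_* monomial x α) (1^k≡1 (d ∸ Vec.sum α))) (*-identityˡ _)) (All.universal (λ _ → tt) p)

  homEval-· : DegreeAtMost d p → ∀ c x₀ x → homEval d p (c * x₀) (c · x) ≡ c ^ d * homEval d p x₀ x
  homEval-· {d = d} {p = p} p≤d c x₀ x = trans
    (weigh-cong {u = hweight d (c * x₀) (c · x)} {v = λ α → c ^ d * hweight d x₀ x α} scale p≤d)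
    (weigh-* (hweight d x₀ x) (c ^ d) p)
    where
    scale : ∀ α → Vec.sum α ≤ d → hweight d (c * x₀) (c · x) α ≡ c ^ d * hweight d x₀ x α
    scale α α≤d = trans (monomial-· c (x₀ ∷ x) ((d ∸ Vec.sum α) ∷ α))
      (cong (λ m → c ^ m * hweight d x₀ x α) (ℕ.m∸n+n≡m α≤d))

  homEval-⊕ : ∀ d (p r : Poly k) x₀ x → homEval d (p ⊕ r) x₀ x ≡ homEval d p x₀ x + homEval d r x₀ x
  homEval-⊕ d p r x₀ x = weigh-⊕ (hweight d x₀ x) p r

  -- Under the degree bounds no subtraction truncates, so the exponents of X₀ in the two factors add
  -- up.
  homEval-⊗ : DegreeAtMost d p → DegreeAtMost d′ r → ∀ x₀ x →
              homEval (d ℕ.+ d′) (p ⊗ r) x₀ x ≡ homEval d p x₀ x * homEval d′ r x₀ x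
  homEval-⊗ {d = d} {d′ = d′} p≤d r≤d′ x₀ x = weigh-⊗ {w = hweight (d ℕ.+ d′) x₀ x} {u = hweight d x₀ x} {v = hweight d′ x₀ x}
    (λ α β α≤d β≤d′ → trans
      (cong (λ m → x₀ ^ m * monomial x (zipWith ℕ._+_ α β)) (split α β α≤d β≤d′))
      (monomial-+ (x₀ ∷ x) ((d ∸ Vec.sum α) ∷ α) ((d′ ∸ Vec.sum β) ∷ β)))
    p≤d r≤d′
    where
    split : ∀ α β → Vec.sum α ≤ d → Vec.sum β ≤ d′ → d ℕ.+ d′ ∸ Vec.sum (zipWith ℕ._+_ α β) ≡ (d ∸ Vec.sum α) ℕ.+ (d′ ∸ Vec.sum β)
    split α β α≤d β≤d′ = begin
      d ℕ.+ d′ ∸ Vec.sum (zipWith ℕ._+_ α β)             ≡⟨ cong (d ℕ.+ d′ ∸_) (sum-zipWith-+ α β) ⟩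
      d ℕ.+ d′ ∸ (Vec.sum α ℕ.+ Vec.sum β)               ≡⟨ ℕ.∸-+-assoc (d ℕ.+ d′) (Vec.sum α) (Vec.sum β) ⟨
      d ℕ.+ d′ ∸ Vec.sum α ∸ Vec.sum β                   ≡⟨ cong (_∸ Vec.sum β) (ℕ.+-∸-comm d′ α≤d) ⟩
      (d ∸ Vec.sum α) ℕ.+ d′ ∸ Vec.sum β                 ≡⟨ ℕ.+-∸-assoc (d ∸ Vec.sum α) β≤d′ ⟩
      (d ∸ Vec.sum α) ℕ.+ (d′ ∸ Vec.sum β)               ∎

  homEval-const : ∀ c x₀ (x : Vec Carrier k) → homEval 0 (constant c) x₀ x ≡ c
  homEval-const {k} c x₀ x = weigh-const (hweight 0 x₀ x) c (trans (cong (_* monomial x (replicate k 0)) (cong (x₀ ^_) (ℕ.0∸n≡0 (Vec.sum (replicate k 0))))) (trans (*-identityˡ _) (monomial-0 x)))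

  homEval-var : ∀ (i : Fin k) x₀ x → homEval 1 (var i) x₀ x ≡ lookup x i
  homEval-var {k} i x₀ x = trans (+-identityʳ _) (trans (*-identityˡ _)
    (trans (cong (λ m → x₀ ^ (1 ∸ m) * monomial x (replicate k 0 [ i ]≔ 1)) (sum-unit i)) (trans (*-identityˡ _) (monomial-var x i))))

  homEval-↑ : DegreeAtMost d p → ∀ m x₀ x → homEval (m ℕ.* d) (p ↑ m) x₀ x ≡ homEval d p x₀ x ^ m
  homEval-↑ p≤d zero    x₀ x = homEval-const 1# x₀ x
  homEval-↑ {d = d} {p = p} p≤d (suc m) x₀ x =
    trans (homEval-⊗ p≤d (degree-↑ m p≤d) x₀ x) (cong (homEval d p x₀ x *_) (homEval-↑ p≤d m x₀ x))

  -- Every term keeps a positive power of X₀. This discards all lower summands on the hyperplane at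
  -- infinity.
  homEval-0 : d′ < d → DegreeAtMost d′ p → ∀ x → homEval d p 0# x ≡ 0#
  homEval-0 {d′ = d′} {d = d} {p = p} d′<d p≤d′ x = trans
    -- The zero weight is written as a product so that `weigh-*` can pull out a factor 0.
    (weigh-cong {u = hweight d 0# x} {v = λ α → 0# * 0#} vanish p≤d′)
    (trans (weigh-* (λ _ → 0#) 0# p) (zeroˡ _))
    where
    vanish : ∀ α → Vec.sum α ≤ d′ → hweight d 0# x α ≡ 0# * 0#
    vanish α α≤d′ with d ∸ Vec.sum α | ℕ.m<n⇒0<n∸m (ℕ.≤-<-trans α≤d′ d′<d)
    ... | suc m | _ = trans (cong (_* monomial x α) (zeroˡ _)) (trans (zeroˡ _) (sym (zeroˡ 0#)))

  homEval-negate : (∀ x → - x ≡ x) → ∀ d (p : Poly k) x₀ x → homEval d (negate p) x₀ x ≡ homEval d p x₀ x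
  homEval-negate -x≡x d []            x₀ x = refl
  homEval-negate -x≡x d ((c , α) ∷ p) x₀ x = cong₂ (λ a s → a * hweight d x₀ x α + s) (-x≡x c) (homEval-negate -x≡x d p x₀ x)

  coeff≢0⇒∈ : ∀ (p : Poly k) α → coeff p α ≢ 0# → ∃[ c ] (c , α) ∈ˡ p
  coeff≢0⇒∈ []            α ≢0 = contradiction refl ≢0
  coeff≢0⇒∈ ((c , β) ∷ p) α ≢0 with Vec.≡-dec ℕ._≟_ β α
  ... | yes refl = c , here refl
  ... | no _     = let (d , d∈) = coeff≢0⇒∈ p α ≢0 in d , there d∈

  -- The bound on the listed terms gives one inequality; for the other, a nonzero coefficient at α
  -- ensures that some listed term with exponent α survives the filter.
  degree≡ : ∀ {α} → DegreeAtMost d p → coeff p α ≢ 0# → Vec.sum α ≡ d → degree p ≡ d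
  degree≡ {d = d} {p = p} {α = α} p≤d ≢0 ∣α∣≡d = ℕ.≤-antisym
    (max≤v⁺ z≤n (All.map⁺ (All.filter⁺ survives p≤d)))
    (subst (_≤ degree p) ∣α∣≡d (All.lookup (xs≤max 0 _)
      (∈-map⁺ (Vec.sum ∘ proj₂) (∈-filter⁺ survives (proj₂ (coeff≢0⇒∈ p α ≢0)) ≢0))))
    where
    survives = λ ((_ , α) : Carrier × Vec ℕ _) → ¬? (coeff p α ≟ 0#)

  -- At (0,1,0,0) every monomial of degree d except X₁^d vanishes. So a top coefficient can be found
  -- by evaluation, without expanding the large powers in the list.
  homEval-at-unit : {p : Poly 3} → DegreeAtMost d p → homEval d p 0# (1# ∷ 0# ∷ 0# ∷ []) ≡ coeff p (d ∷ 0 ∷ 0 ∷ [])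
  homEval-at-unit [] = refl
  homEval-at-unit {d = d} {p = (c , α) ∷ p} (α≤d ∷ p≤d) with Vec.≡-dec ℕ._≟_ α (d ∷ 0 ∷ 0 ∷ [])
  ... | yes refl = cong₂ _+_ (trans (cong (c *_) weight≡1) (*-identityʳ c)) (homEval-at-unit p≤d)
    where
    weight≡1 : hweight d 0# (1# ∷ 0# ∷ 0# ∷ []) (d ∷ 0 ∷ 0 ∷ []) ≡ 1#
    weight≡1 = begin
      0# ^ (d ∸ (d ℕ.+ 0)) * (1# ^ d * (1# * (1# * 1#)))   ≡⟨ cong₂ (λ m y → 0# ^ m * (y * (1# * (1# * 1#)))) (trans (cong (d ∸_) (ℕ.+-identityʳ d)) (ℕ.n∸n≡0 d)) (1^k≡1 d) ⟩
      1# * (1# * (1# * (1# * 1#)))                         ≡⟨ trans (*-identityˡ _) (trans (*-identityˡ _) (trans (*-identityˡ _) (*-identityˡ _))) ⟩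
      1#                                                   ∎
  ... | no α≢ = trans (cong₂ _+_ (trans (cong (c *_) (weight≡0 α α≤d α≢)) (zeroʳ c)) (homEval-at-unit p≤d)) (+-identityˡ _)
    where
    weight≡0 : ∀ α → Vec.sum α ≤ d → α ≢ d ∷ 0 ∷ 0 ∷ [] → hweight d 0# (1# ∷ 0# ∷ 0# ∷ []) α ≡ 0#
    weight≡0 (a ∷ suc b ∷ c ∷ [])    _ _ = ≡0ʳ (≡0ʳ (≡0ˡ (zeroˡ _)))
    weight≡0 (a ∷ zero ∷ suc c ∷ []) _ _ = ≡0ʳ (≡0ʳ (≡0ʳ (≡0ˡ (zeroˡ _))))
    weight≡0 (a ∷ zero ∷ zero ∷ []) a+0≤d a≢d with d ∸ (a ℕ.+ 0) in eq
    ... | suc m = ≡0ˡ (zeroˡ _)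
    ... | zero  = contradiction (cong (_∷ 0 ∷ 0 ∷ []) (ℕ.≤-antisym (subst (_≤ d) (ℕ.+-identityʳ a) a+0≤d) (subst (d ≤_) (ℕ.+-identityʳ a) (ℕ.m∸n≡0⇒m≤n eq)))) a≢d

-- Affine points and points at infinity of the surface

module SurfaceEquation {e : ℕ} {K : FiniteField ((2 ℕ.^ e) ℕ.^ 2)} (generator : QuadraticGenerator e K) (1≤e : 1 ≤ e) (odd : ¬ (2 ∣ e)) where
  open Surface generator odd public
  open Over K using (Poly; constant; var; negate; eval; homogenize; degree; coeff; Γ; affineEquation; 𝒱; _·_)
  open PolynomialEvaluation K
  open ≡-Reasoning

  private
    variable k : ℕ

    2≤q : 2 ≤ q
    2≤q = ℕ.^-monoʳ-≤ 2 1≤e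

    1≤σ : 1 ≤ σ
    1≤σ = ℕ.^-monoʳ-≤ 2 {0} {s} z≤n

    D≡ : D ≡ σ ℕ.* q ℕ.+ 2 ℕ.* q
    D≡ = ℕ.*-distribʳ-+ q σ 2

    q≤σq : q ≤ σ ℕ.* q
    q≤σq = subst (_≤ σ ℕ.* q) (ℕ.*-identityˡ q) (ℕ.*-monoˡ-≤ q 1≤σ)

    0<q : 0 < q
    0<q = ℕ.≤-trans (s≤s z≤n) 2≤q

    2q<D : 2 ℕ.* q < D
    2q<D = subst (2 ℕ.* q <_) (sym D≡) (ℕ.m<n+m (2 ℕ.* q) (ℕ.<-≤-trans 0<q q≤σq))

    σq<D : σ ℕ.* q < D
    σq<D = subst (σ ℕ.* q <_) (sym D≡) (ℕ.m<m+n (σ ℕ.* q) (ℕ.<-≤-trans 0<q (ℕ.m≤n*m q 2)))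

    eval-Γ : ∀ (p : Poly k) x → eval (Γ e ε p) x ≡ γ (eval p x)
    eval-Γ {k} p x =
      trans (eval-⊕ (A ⊕ B ⊕ C ⊕ E) (p ↑ 2) x) (cong₂ _+_
        (trans (eval-⊕ (A ⊕ B ⊕ C) E x) (cong₂ _+_
          (trans (eval-⊕ (A ⊕ B) C x) (cong₂ _+_
            (trans (eval-⊕ A B x) (cong₂ _+_ eval-A eval-B))
            eval-C))
          (eval-↑ p (q ℕ.+ 1) x)))
        (eval-↑ p 2 x))
      where
      im′ A B C E : Poly k
      im′ = p ↑ q ⊕ p
      A = (p ⊕ im′ ⊗ constant ε) ↑ (σ ℕ.+ 2)
      B = im′ ↑ σ
      C = (p ↑ (2 ℕ.* q) ⊕ p ↑ 2) ⊗ constant ε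
      E = p ↑ (q ℕ.+ 1)
      eval-im : eval im′ x ≡ im (eval p x)
      eval-im = trans (eval-⊕ (p ↑ q) p x) (cong (_+ eval p x) (eval-↑ p q x))
      eval-A : eval A x ≡ re (eval p x) ^ (σ ℕ.+ 2)
      eval-A = trans (eval-↑ (p ⊕ im′ ⊗ constant ε) (σ ℕ.+ 2) x) (cong (_^ (σ ℕ.+ 2))
        (trans (eval-⊕ p (im′ ⊗ constant ε) x) (cong (eval p x +_)
          (trans (eval-⊗ im′ (constant ε) x) (cong₂ _*_ eval-im (eval-const ε x))))))
      eval-B : eval B x ≡ im (eval p x) ^ σ
      eval-B = trans (eval-↑ im′ σ x) (cong (_^ σ) eval-im)
      eval-C : eval C x ≡ (eval p x ^ (2 ℕ.* q) + eval p x ^ 2) * ε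
      eval-C = trans (eval-⊗ (p ↑ (2 ℕ.* q) ⊕ p ↑ 2) (constant ε) x) (cong₂ _*_
        (trans (eval-⊕ (p ↑ (2 ℕ.* q)) (p ↑ 2) x) (cong₂ _+_ (eval-↑ p (2 ℕ.* q) x) (eval-↑ p 2 x))) (eval-const ε x))

    module Leading {k} (i : Fin k) where
      p im′ ρ A B C E G : Poly k
      p = var i
      im′ = p ↑ q ⊕ p
      ρ = p ⊕ im′ ⊗ constant ε
      A = ρ ↑ (σ ℕ.+ 2)
      B = im′ ↑ σ
      C = (p ↑ (2 ℕ.* q) ⊕ p ↑ 2) ⊗ constant ε
      E = p ↑ (q ℕ.+ 1)
      G = p ↑ 2

      power : ∀ m → DegreeAtMost m (p ↑ m)
      power m = subst (λ d → DegreeAtMost d (p ↑ m)) (ℕ.*-identityʳ m) (degree-↑ m (degree-var i))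

      im′≤q : DegreeAtMost q im′
      im′≤q = degree-⊕ {p = p ↑ q} (power q) (degree-weaken {p = p} 0<q (degree-var i))

      imε≤q : DegreeAtMost q (im′ ⊗ constant ε)
      imε≤q = subst (λ d → DegreeAtMost d (im′ ⊗ constant ε)) (ℕ.+-identityʳ q) (degree-⊗ {p = im′} im′≤q degree-const)

      ρ≤q : DegreeAtMost q ρ
      ρ≤q = degree-⊕ {p = p} (degree-weaken {p = p} 0<q (degree-var i)) imε≤q

      A≤D : DegreeAtMost D A
      A≤D = degree-↑ (σ ℕ.+ 2) ρ≤q

      B≤σq : DegreeAtMost (σ ℕ.* q) B
      B≤σq = degree-↑ σ im′≤q

      C≤2q : DegreeAtMost (2 ℕ.* q) C
      C≤2q = subst (λ d → DegreeAtMost d C) (ℕ.+-identityʳ (2 ℕ.* q))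
        (degree-⊗ {p = p ↑ (2 ℕ.* q) ⊕ p ↑ 2}
          (degree-⊕ {p = p ↑ (2 ℕ.* q)} (power (2 ℕ.* q)) (degree-weaken {p = p ↑ 2} (ℕ.*-monoʳ-≤ 2 0<q) (power 2)))
          degree-const)

      E≤2q : DegreeAtMost (2 ℕ.* q) E
      E≤2q = degree-weaken {p = E} (ℕ.+-monoʳ-≤ q (subst (1 ≤_) (sym (ℕ.+-identityʳ q)) 0<q)) (power (q ℕ.+ 1))

      G≤2q : DegreeAtMost (2 ℕ.* q) G
      G≤2q = degree-weaken {p = G} (ℕ.*-monoʳ-≤ 2 0<q) (power 2)

      Γ≤D : DegreeAtMost D (Γ e ε p)
      Γ≤D = degree-⊕ {p = A ⊕ B ⊕ C ⊕ E} (degree-⊕ {p = A ⊕ B ⊕ C} (degree-⊕ {p = A ⊕ B} (degree-⊕ {p = A} A≤D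
        (degree-weaken {p = B} (ℕ.<⇒≤ σq<D) B≤σq)) (degree-weaken {p = C} (ℕ.<⇒≤ 2q<D) C≤2q))
        (degree-weaken {p = E} (ℕ.<⇒≤ 2q<D) E≤2q)) (degree-weaken {p = G} (ℕ.<⇒≤ 2q<D) G≤2q)

      leading-ρ : ∀ x → homEval q ρ 0# x ≡ bar (lookup x i) * ε
      leading-ρ x = begin
        homEval q ρ 0# x
          ≡⟨ homEval-⊕ q p (im′ ⊗ constant ε) 0# x ⟩
        homEval q p 0# x + homEval q (im′ ⊗ constant ε) 0# x
          ≡⟨ cong₂ _+_ p≡0 (cong (λ d → homEval d (im′ ⊗ constant ε) 0# x) (sym (ℕ.+-identityʳ q))) ⟩
        0# + homEval (q ℕ.+ 0) (im′ ⊗ constant ε) 0# x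
          ≡⟨ trans (+-identityˡ _) (homEval-⊗ {p = im′} im′≤q degree-const 0# x) ⟩
        homEval q im′ 0# x * homEval 0 (constant ε) 0# x
          ≡⟨ cong₂ _*_ (homEval-⊕ q (p ↑ q) p 0# x) (homEval-const ε 0# x) ⟩
        (homEval q (p ↑ q) 0# x + homEval q p 0# x) * ε
          ≡⟨ cong (_* ε) (trans (cong₂ _+_ p^q p≡0) (+-identityʳ _)) ⟩
        bar (lookup x i) * ε ∎
        where
        p≡0 : homEval q p 0# x ≡ 0#
        p≡0 = homEval-0 {p = p} 2≤q (degree-var i) x
        p^q : homEval q (p ↑ q) 0# x ≡ bar (lookup x i)
        p^q = begin
          homEval q (p ↑ q) 0# x              ≡⟨ cong (λ d → homEval d (p ↑ q) 0# x) (ℕ.*-identityʳ q) ⟨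
          homEval (q ℕ.* 1) (p ↑ q) 0# x      ≡⟨ homEval-↑ {p = p} (degree-var i) q 0# x ⟩
          homEval 1 p 0# x ^ q                ≡⟨ cong bar (homEval-var i 0# x) ⟩
          bar (lookup x i)                    ∎

      -- Only `A` reaches degree D; the other summands have degree at most σq or 2q. Inside `A`,
      -- only the term x^q · ε of `ρ` has degree q, because 1 < q.
      leading-Γ : ∀ x → homEval D (Γ e ε p) 0# x ≡ lookup x i ^ D * ε ^ (σ ℕ.+ 2)
      leading-Γ x = begin
        homEval D (A ⊕ B ⊕ C ⊕ E ⊕ G) 0# x
          ≡⟨ drop (A ⊕ B ⊕ C ⊕ E) G (homEval-0 {p = G} 2q<D G≤2q x) ⟩
        homEval D (A ⊕ B ⊕ C ⊕ E) 0# x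
          ≡⟨ drop (A ⊕ B ⊕ C) E (homEval-0 {p = E} 2q<D E≤2q x) ⟩
        homEval D (A ⊕ B ⊕ C) 0# x
          ≡⟨ drop (A ⊕ B) C (homEval-0 {p = C} 2q<D C≤2q x) ⟩
        homEval D (A ⊕ B) 0# x
          ≡⟨ drop A B (homEval-0 {p = B} σq<D B≤σq x) ⟩
        homEval D A 0# x
          ≡⟨ homEval-↑ {p = ρ} ρ≤q (σ ℕ.+ 2) 0# x ⟩
        homEval q ρ 0# x ^ (σ ℕ.+ 2)
          ≡⟨ cong (_^ (σ ℕ.+ 2)) (leading-ρ x) ⟩
        (bar (lookup x i) * ε) ^ (σ ℕ.+ 2)
          ≡⟨ ^-distrib-* (bar (lookup x i)) ε (σ ℕ.+ 2) ⟩
        bar (lookup x i) ^ (σ ℕ.+ 2) * ε ^ (σ ℕ.+ 2)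
          ≡⟨ cong (_* ε ^ (σ ℕ.+ 2)) (trans (^-assocʳ (lookup x i) q (σ ℕ.+ 2)) (cong (lookup x i ^_) (ℕ.*-comm q (σ ℕ.+ 2)))) ⟩
        lookup x i ^ D * ε ^ (σ ℕ.+ 2) ∎
        where
        drop : ∀ p r → homEval D r 0# x ≡ 0# → homEval D (p ⊕ r) 0# x ≡ homEval D p 0# x
        drop p r r≡0 = trans (homEval-⊕ D p r 0# x) (trans (cong (homEval D p 0# x +_) r≡0) (+-identityʳ _))

    i₁ i₂ i₃ : Fin 3
    i₁ = inject₁ zero
    i₂ = inject₁ (suc zero)
    i₃ = fromℕ 2
    module L₁ = Leading i₁
    module L₂ = Leading i₂
    module L₃ = Leading i₃

    -- Spelled out as the sum over two variables unfolds, with the trailing empty polynomial, so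
    -- that `equation` is `lhs ⊕ negate Γs` by definition.
    Γs lhs equation : Poly 3
    Γs = Γ e ε (var i₁) ⊕ (Γ e ε (var i₂) ⊕ [])
    lhs = L₃.im′
    equation = affineEquation e ε 3

    lhs≤q : DegreeAtMost q lhs
    lhs≤q = L₃.im′≤q

    Γs≤D : DegreeAtMost D Γs
    Γs≤D = degree-⊕ {p = Γ e ε (var i₁)} L₁.Γ≤D (degree-⊕ {p = Γ e ε (var i₂)} L₂.Γ≤D [])

    equation≤D : DegreeAtMost D equation
    equation≤D = degree-⊕ {p = lhs} (degree-weaken {p = lhs} (ℕ.<⇒≤ q<D) lhs≤q) (degree-negate {p = Γs} Γs≤D)
      where
      q<D : q < D
      q<D = ℕ.≤-<-trans (ℕ.m≤n*m q 2) 2q<D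

    c₀ : Carrier
    c₀ = ε ^ (σ ℕ.+ 2)

    ε≢0 : ε ≢ 0#
    ε≢0 ε≡0 = ε∉F (trans (cong bar ε≡0) (trans bar-0 (sym ε≡0)))

    c₀≢0 : c₀ ≢ 0#
    c₀≢0 = ^-≢0 (σ ℕ.+ 2) ε≢0

    -- Serves twice: at (1,0,0) it shows that the degree is D, and in general it then describes the
    -- points at infinity.
    leading-equation : ∀ x y z → homEval D equation 0# (x ∷ y ∷ z ∷ []) ≡ (x ^ D + y ^ D) * c₀
    leading-equation x y z = begin
      homEval D (lhs ⊕ negate Γs) 0# v
        ≡⟨ homEval-⊕ D lhs (negate Γs) 0# v ⟩
      homEval D lhs 0# v + homEval D (negate Γs) 0# v
        ≡⟨ cong₂ _+_ (homEval-0 {p = lhs} (ℕ.≤-<-trans (ℕ.m≤n*m q 2) 2q<D) lhs≤q v) (homEval-negate -x≡x D Γs 0# v) ⟩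
      0# + homEval D Γs 0# v
        ≡⟨ trans (+-identityˡ _) (homEval-⊕ D (Γ e ε (var i₁)) (Γ e ε (var i₂) ⊕ []) 0# v) ⟩
      homEval D (Γ e ε (var i₁)) 0# v + homEval D (Γ e ε (var i₂) ⊕ []) 0# v
        ≡⟨ cong (homEval D (Γ e ε (var i₁)) 0# v +_) (trans (homEval-⊕ D (Γ e ε (var i₂)) [] 0# v) (+-identityʳ _)) ⟩
      homEval D (Γ e ε (var i₁)) 0# v + homEval D (Γ e ε (var i₂)) 0# v
        ≡⟨ cong₂ _+_ (L₁.leading-Γ v) (L₂.leading-Γ v) ⟩
      x ^ D * c₀ + y ^ D * c₀
        ≡⟨ distribʳ c₀ (x ^ D) (y ^ D) ⟨
      (x ^ D + y ^ D) * c₀ ∎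
      where
      v : Vec Carrier 3
      v = x ∷ y ∷ z ∷ []

    coeff≢0 : coeff equation (D ∷ 0 ∷ 0 ∷ []) ≢ 0#
    coeff≢0 ≡0 = c₀≢0 (begin
      c₀                                                ≡⟨ *-identityˡ c₀ ⟨
      1# * c₀                                           ≡⟨ cong (_* c₀) (trans (sym (+-identityʳ 1#)) (cong₂ _+_ (sym (1^k≡1 D)) (sym 0^D≡0))) ⟩
      (1# ^ D + 0# ^ D) * c₀                            ≡⟨ leading-equation 1# 0# 0# ⟨
      homEval D equation 0# (1# ∷ 0# ∷ 0# ∷ [])         ≡⟨ homEval-at-unit equation≤D ⟩
      coeff equation (D ∷ 0 ∷ 0 ∷ [])                   ≡⟨ ≡0 ⟩
      0#                                                ∎)

    degree-equation : degree equation ≡ D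
    degree-equation = degree≡ {p = equation} equation≤D coeff≢0 (ℕ.+-identityʳ D)

    homogeneous : ∀ x₀ v → eval (homogenize equation) (x₀ ∷ v) ≡ homEval D equation x₀ v
    homogeneous x₀ v = trans (eval-homogenize equation x₀ v) (cong (λ d → homEval d equation x₀ v) degree-equation)

    equation-value : ∀ x y z → eval equation (x ∷ y ∷ z ∷ []) ≡ im z + (γ x + γ y)
    equation-value x y z = begin
      eval (lhs ⊕ negate Γs) v
        ≡⟨ eval-⊕ lhs (negate Γs) v ⟩
      eval lhs v + eval (negate Γs) v
        ≡⟨ cong₂ _+_ (eval-⊕ (var i₃ ↑ q) (var i₃) v) negated ⟩
      eval (var i₃ ↑ q) v + eval (var i₃) v + eval Γs v
        ≡⟨ cong₂ _+_ (cong₂ _+_ (trans (eval-↑ (var i₃) q v) (cong bar (eval-var i₃ v))) (eval-var i₃ v)) Γs-value ⟩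
      im z + (γ x + γ y) ∎
      where
      v : Vec Carrier 3
      v = x ∷ y ∷ z ∷ []
      negated : eval (negate Γs) v ≡ eval Γs v
      -- At x₀ = 1 the degree of homogenization is immaterial, so degree 0 transfers
      -- `homEval-negate` to `eval`.
      negated = trans (sym (homEval-1 0 (negate Γs) v)) (trans (homEval-negate -x≡x 0 Γs 1# v) (homEval-1 0 Γs v))
      Γs-value : eval Γs v ≡ γ x + γ y
      Γs-value = trans (eval-⊕ (Γ e ε (var i₁)) (Γ e ε (var i₂) ⊕ []) v) (cong₂ _+_
        (trans (eval-Γ (var i₁) v) (cong γ (eval-var i₁ v)))
        (trans (eval-⊕ (Γ e ε (var i₂)) [] v) (trans (+-identityʳ _) (trans (eval-Γ (var i₂) v) (cong γ (eval-var i₂ v))))))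

  𝒱-affine : ∀ x y z → 𝒱 e ε 3 (1# ∷ x ∷ y ∷ z ∷ []) ⇔ im z ≡ γ x + γ y
  𝒱-affine x y z = mk⇔ (λ ∈𝒱 → x+y≡0⇒x≡y (trans (sym value) ∈𝒱)) λ eq → trans value (trans (cong (_+ (γ x + γ y)) eq) (x+x≡0 _))
    where
    value : eval (homogenize equation) (1# ∷ x ∷ y ∷ z ∷ []) ≡ im z + (γ x + γ y)
    value = trans (homogeneous 1# (x ∷ y ∷ z ∷ [])) (trans (homEval-1 D equation (x ∷ y ∷ z ∷ [])) (equation-value x y z))

  𝒱-infinity : ∀ x y z → 𝒱 e ε 3 (0# ∷ x ∷ y ∷ z ∷ []) ⇔ x ^ D ≡ y ^ D
  𝒱-infinity x y z = mk⇔
    (λ ∈𝒱 → x+y≡0⇒x≡y (no-zero-divisors c₀≢0 (trans (*-comm c₀ _) (trans (sym value) ∈𝒱))))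
    λ eq → trans value (trans (cong (λ t → (t + y ^ D) * c₀) eq) (trans (cong (_* c₀) (x+x≡0 _)) (zeroˡ c₀)))
    where
    value : eval (homogenize equation) (0# ∷ x ∷ y ∷ z ∷ []) ≡ (x ^ D + y ^ D) * c₀
    value = trans (homogeneous 0# (x ∷ y ∷ z ∷ [])) (leading-equation x y z)

  𝒱-· : ∀ c v → 𝒱 e ε 3 v → 𝒱 e ε 3 (c · v)
  𝒱-· c (x₀ ∷ v) ∈𝒱 = trans (homogeneous (c * x₀) (c · v)) (trans (homEval-· {p = equation} equation≤D c x₀ v)
    (trans (cong (c ^ D *_) (trans (sym (homogeneous x₀ v)) ∈𝒱)) (zeroʳ _)))

-- Evaluation codes: weights from linear sections

vec-ext : ∀ {A : Set} {n} {u v : Vec A n} → (∀ i → lookup u i ≡ lookup v i) → u ≡ v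
vec-ext {u = u} {v = v} eq = trans (sym (Vec.tabulate∘lookup u)) (trans (Vec.tabulate-cong eq) (Vec.tabulate∘lookup v))

lookup-transpose : ∀ {A : Set} {m n} (M : Vec (Vec A n) m) j i → lookup (lookup (transpose M) j) i ≡ lookup (lookup M i) j
lookup-transpose {n = n} (v ∷ M) j i = trans
  (cong (λ w → lookup w i) (trans (Vec.lookup-⊛ j (replicate n Vec._∷_ Vec.⊛ v) (transpose M))
    (cong (λ f → f (lookup (transpose M) j)) (trans (Vec.lookup-⊛ j (replicate n Vec._∷_) v)
      (cong (λ f → f (lookup v j)) (Vec.lookup-replicate j Vec._∷_))))))
  (entry i)
  where
  entry : ∀ i → lookup (lookup v j ∷ lookup (transpose M) j) i ≡ lookup (lookup (v ∷ M) i) j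
  entry zero    = refl
  entry (suc i) = lookup-transpose M j i

module LinearAlgebra {n : ℕ} (K : FiniteField n) where
  open FiniteField K
  open FieldTheory K
  open Over K
  open ≡-Reasoning

  private variable k m N : ℕ

  dot : Vec Carrier k → Vec Carrier k → Carrier
  dot a x = Vec.foldr′ _+_ 0# (zipWith _*_ a x)

  dot-+ : ∀ (a b x : Vec Carrier k) → dot (a +ᵛ b) x ≡ dot a x + dot b x
  dot-+ []      []      []      = sym (+-identityˡ 0#)
  dot-+ (a ∷ as) (b ∷ bs) (x ∷ xs) = trans (cong₂ _+_ (distribʳ x a b) (dot-+ as bs xs)) (interchange (a * x) (b * x) (dot as xs) (dot bs xs))
    where
    open Algebra.Properties.CommutativeSemigroup (CommutativeMonoid.commutativeSemigroup +-commutativeMonoid) using (interchange)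

  dot-· : ∀ c (a x : Vec Carrier k) → dot (c · a) x ≡ c * dot a x
  dot-· c []       []       = sym (zeroʳ c)
  dot-· c (a ∷ as) (x ∷ xs) = trans (cong₂ _+_ (*-assoc c a x) (dot-· c as xs)) (sym (distribˡ c _ _))

  dot-·ʳ : ∀ c (a x : Vec Carrier k) → dot a (c · x) ≡ c * dot a x
  dot-·ʳ c []       []       = sym (zeroʳ c)
  dot-·ʳ c (a ∷ as) (x ∷ xs) = trans
    (cong₂ _+_ (trans (sym (*-assoc a c x)) (trans (cong (_* x) (*-comm a c)) (*-assoc c a x))) (dot-·ʳ c as xs))
    (sym (distribˡ c _ _))

  dot-0 : ∀ (x : Vec Carrier k) → dot 0ᵛ x ≡ 0#
  dot-0 []       = refl
  dot-0 (x ∷ xs) = trans (cong₂ _+_ (zeroˡ x) (dot-0 xs)) (+-identityˡ 0#)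

  dot-0ʳ : ∀ (a : Vec Carrier k) {x} → (∀ i → lookup x i ≡ 0#) → dot a x ≡ 0#
  dot-0ʳ []       {[]}     x≡0 = refl
  dot-0ʳ (a ∷ as) {x ∷ xs} x≡0 = trans (cong₂ _+_ (trans (cong (a *_) (x≡0 zero)) (zeroʳ a)) (dot-0ʳ as (x≡0 ∘ suc))) (+-identityˡ 0#)

  dot-unit : ∀ (x : Vec Carrier k) j → dot (0ᵛ [ j ]≔ 1#) x ≡ lookup x j
  dot-unit (x ∷ xs) zero    = trans (cong₂ _+_ (*-identityˡ x) (dot-0 xs)) (+-identityʳ x)
  dot-unit (x ∷ xs) (suc j) = trans (cong₂ _+_ (zeroˡ x) (dot-unit xs j)) (+-identityˡ _)

  lookup-linearCombination : ∀ (as : Vec Carrier k) (vs : Vec (Vec Carrier N) k) i →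
                             lookup (linearCombination as vs) i ≡ dot as (Vec.map (λ v → lookup v i) vs)
  lookup-linearCombination []       []       i = Vec.lookup-replicate i 0#
  lookup-linearCombination (a ∷ as) (v ∷ vs) i = trans (Vec.lookup-zipWith _+_ i (a · v) _)
    (cong₂ _+_ (Vec.lookup-map i (a *_) v) (lookup-linearCombination as vs i))

  dot-linearCombination : ∀ (as : Vec Carrier m) (Ls : Vec (Vec Carrier k) m) x →
                          dot (linearCombination as Ls) x ≡ dot as (Vec.map (λ L → dot L x) Ls)
  dot-linearCombination []       []       x = dot-0 x
  dot-linearCombination (a ∷ as) (L ∷ Ls) x = trans (dot-+ (a · L) _ x) (cong₂ _+_ (dot-· a L x) (dot-linearCombination as Ls x))

  span-isLinear : ∀ (vs : Vec (Vec Carrier N) k) → IsLinear (span vs)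
  span-isLinear vs = record
    { zero-closed = 0ᵛ , vec-ext λ i → trans (lookup-linearCombination 0ᵛ vs i) (trans (dot-0 (Vec.map (λ v → lookup v i) vs)) (sym (Vec.lookup-replicate i 0#)))
    ; +-closed = λ { (as , refl) (bs , refl) → as +ᵛ bs , vec-ext λ i →
        trans (lookup-linearCombination (as +ᵛ bs) vs i) (trans (dot-+ as bs _)
          (sym (trans (Vec.lookup-zipWith _+_ i (linearCombination as vs) (linearCombination bs vs))
            (cong₂ _+_ (lookup-linearCombination as vs i) (lookup-linearCombination bs vs i))))) }
    ; ·-closed = λ { c (as , refl) → c · as , vec-ext λ i →
        trans (lookup-linearCombination (c · as) vs i) (trans (dot-· c as _)
          (sym (trans (Vec.lookup-map i (c *_) (linearCombination as vs)) (cong (c *_) (lookup-linearCombination as vs i))))) }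
    }

  span-member : ∀ (vs : Vec (Vec Carrier N) k) j → span vs (lookup vs j)
  span-member vs j = 0ᵛ [ j ]≔ 1# , vec-ext λ i →
    trans (lookup-linearCombination (0ᵛ [ j ]≔ 1#) vs i) (trans (dot-unit (Vec.map (λ v → lookup v i) vs) j) (Vec.lookup-map j (λ v → lookup v i) vs))

  independent-single : ∀ {L : Vec Carrier k} → L ≢ 0ᵛ → LinearlyIndependent (L ∷ [])
  independent-single {L = L} L≢0 (c ∷ []) eq with c ≟ 0#
  ... | yes refl = refl
  ... | no c≢0   = contradiction (vec-ext λ i → trans (no-zero-divisors c≢0 (entry i)) (sym (Vec.lookup-replicate i 0#))) L≢0
    where
    entry : ∀ i → c * lookup L i ≡ 0#
    entry i = begin
      c * lookup L i                                 ≡⟨ +-identityʳ _ ⟨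
      c * lookup L i + 0#                            ≡⟨ lookup-linearCombination (c ∷ []) (L ∷ []) i ⟨
      lookup (linearCombination (c ∷ []) (L ∷ [])) i ≡⟨ cong (λ v → lookup v i) eq ⟩
      lookup 0ᵛ i                                    ≡⟨ Vec.lookup-replicate i 0# ⟩
      0#                                             ∎

  independent⇒≢0 : ∀ {L : Vec Carrier k} → LinearlyIndependent (L ∷ []) → L ≢ 0ᵛ
  independent⇒≢0 independent refl = 1≢0 (cong Vec.head (independent (1# ∷ []) (vec-ext λ i → begin
    lookup (linearCombination (1# ∷ []) (0ᵛ ∷ [])) i   ≡⟨ lookup-linearCombination (1# ∷ []) (0ᵛ ∷ []) i ⟩
    1# * lookup 0ᵛ i + 0#                              ≡⟨ trans (+-identityʳ _) (*-identityˡ _) ⟩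
    lookup 0ᵛ i                                        ∎)))

  module EvaluationCode {N k : ℕ} (P : Fin N → Vec (FiniteField.Carrier K) k) where

    rows : Vec (Vec Carrier N) k
    rows = transpose (tabulate P)

    C : Code N
    C = span rows

    codeword : Vec Carrier k → Vec Carrier N
    codeword L = linearCombination L rows

    lookup-codeword : ∀ L i → lookup (codeword L) i ≡ dot L (P i)
    lookup-codeword L i = trans (lookup-linearCombination L rows i) (cong (dot L) (vec-ext λ j →
      trans (Vec.lookup-map j (λ v → lookup v i) rows)
        (trans (lookup-transpose (tabulate P) j i) (cong (λ v → lookup v j) (Vec.lookup∘tabulate P i)))))

    Vanish : Vec (Vec Carrier k) m → Pred (Fin N) _
    Vanish Ls i = ∀ j → dot (lookup Ls j) (P i) ≡ 0#

    -- The geometric side of the m-th weight: no subspace of codimension m contains more than B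
    -- listed points. `Section` is the converse, a subspace with B distinct ones.
    SectionsAtMost : ℕ → ℕ → Set
    SectionsAtMost m B = ∀ (Ls : Vec (Vec Carrier k) m) → LinearlyIndependent Ls → AtMost B (Vanish Ls)

    record Section (m B : ℕ) : Set where
      field
        forms       : Vec (Vec Carrier k) m
        independent : LinearlyIndependent forms
        index       : Fin B → Fin N
        injective   : Injective _≡_ _≡_ index
        vanish      : ∀ b → Vanish forms (index b)

    module Weights (nondegenerate : ∀ L → (∀ i → dot L (P i) ≡ FiniteField.0# K) → L ≡ Over.0ᵛ K) where

      -- The points span the whole space, so a form is determined by its word. Independence can
      -- therefore be moved between forms and words.
      codeword≡0⇒ : ∀ {L} → codeword L ≡ 0ᵛ → L ≡ 0ᵛ
      codeword≡0⇒ {L} eq = nondegenerate L λ i → trans (sym (lookup-codeword L i)) (trans (cong (λ v → lookup v i) eq) (Vec.lookup-replicate i 0#))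

      dimension : HasDimension C k
      dimension = rows , (λ as → codeword≡0⇒) , λ v → mk⇔ id id

      codeword-linear : ∀ (as : Vec Carrier m) Ls → linearCombination as (Vec.map codeword Ls) ≡ codeword (linearCombination as Ls)
      codeword-linear as Ls = vec-ext λ i → begin
        lookup (linearCombination as (Vec.map codeword Ls)) i
          ≡⟨ lookup-linearCombination as (Vec.map codeword Ls) i ⟩
        dot as (Vec.map (λ v → lookup v i) (Vec.map codeword Ls))
          ≡⟨ cong (dot as) (Vec.map-∘ (λ v → lookup v i) codeword Ls) ⟨
        dot as (Vec.map (λ L → lookup (codeword L) i) Ls)
          ≡⟨ cong (dot as) (Vec.map-cong (λ L → lookup-codeword L i) Ls) ⟩
        dot as (Vec.map (λ L → dot L (P i)) Ls)
          ≡⟨ dot-linearCombination as Ls (P i) ⟨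
        dot (linearCombination as Ls) (P i)
          ≡⟨ lookup-codeword (linearCombination as Ls) i ⟨
        lookup (codeword (linearCombination as Ls)) i ∎

      -- All forms vanish at the positions outside `S`, so there are at most B of these.
      support-bound : ∀ {B} {Ls : Vec (Vec Carrier k) m} → SectionsAtMost m B → LinearlyIndependent Ls →
                      ∀ (S : Subset N) → (∀ i → i ∉ S → Vanish Ls i) → N ∸ B ≤ ∣ S ∣
      support-bound {Ls = Ls} bound independent S S-vanish =
        atMost⇒∣p∣≥ S (atMost-along (λ i _ → i) S-vanish (λ _ _ eq → eq) (bound Ls independent))

      support-size : ∀ {B} → SectionsAtMost m B → (section : Section m B) → let open Section section in
                     ∀ (S : Subset N) → (∀ i → i ∉ S ⇔ Vanish forms i) → ∣ S ∣ ≡ N ∸ B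
      support-size bound section S S⇔ = ℕ.≤-antisym
        (outside⇒∣p∣≤ S index injective λ b → Equivalence.from (S⇔ (index b)) (vanish b))
        (support-bound bound independent S λ i → Equivalence.to (S⇔ i))
        where open Section section

      -- Position i lies outside the support of the code spanned by the words of some forms exactly
      -- when all the forms vanish at `P i`. Minimizing the support is maximizing the section.
      generalizedWeight : ∀ {B} → SectionsAtMost m B → Section m B → IsGeneralizedWeight C m (N ∸ B)
      generalizedWeight {m} {B} bound section = attained , minimal
        where
        open Section section
        words : Vec (Vec Carrier N) m
        words = Vec.map codeword forms
        D = span words

        words-independent : LinearlyIndependent words
        words-independent as eq = independent as (codeword≡0⇒ (trans (sym (codeword-linear as forms)) eq))

        vanish? : ∀ i → Dec (Vanish forms i)
        vanish? i = Fin.all? λ j → dot (lookup forms j) (P i) ≟ 0#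

        S : Subset N
        S = subsetOf (¬? ∘ vanish?)

        D-vanish : ∀ {i c} → Vanish forms i → D c → lookup c i ≡ 0#
        D-vanish {i} vanish (as , refl) = begin
          lookup (linearCombination as words) i            ≡⟨ cong (λ v → lookup v i) (codeword-linear as forms) ⟩
          lookup (codeword (linearCombination as forms)) i ≡⟨ lookup-codeword (linearCombination as forms) i ⟩
          dot (linearCombination as forms) (P i)           ≡⟨ dot-linearCombination as forms (P i) ⟩
          dot as (Vec.map (λ L → dot L (P i)) forms)       ≡⟨ dot-0ʳ as (λ j → trans (Vec.lookup-map j (λ L → dot L (P i)) forms) (vanish j)) ⟩
          0#                                               ∎

        S-support : IsSupport D S
        S-support i = mk⇔
          (λ i∈S → let (j , ≢0) = Fin.¬∀⟶∃¬ m _ (λ j → dot (lookup forms j) (P i) ≟ 0#) (∈-subsetOf⁻ (¬? ∘ vanish?) i∈S) in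
            lookup words j , span-member words j ,
            λ eq → ≢0 (trans (sym (lookup-codeword (lookup forms j) i)) (trans (cong (λ v → lookup v i) (sym (Vec.lookup-map j codeword forms))) eq)))
          (λ (c , c∈D , ≢0) → ∈-subsetOf⁺ (¬? ∘ vanish?) λ vanish → ≢0 (D-vanish vanish c∈D))

        attained : Σ[ D ∈ Code N ] IsLinear D × D ⊆ C × HasDimension D m × (∃[ S ] IsSupport D S × ∣ S ∣ ≡ N ∸ B)
        attained = D , span-isLinear words
          , (λ { (as , refl) → linearCombination as forms , sym (codeword-linear as forms) })
          , (words , words-independent , λ v → mk⇔ id id)
          , S , S-support , support-size bound section S λ i → mk⇔
              (λ i∉S → decidable-stable (vanish? i) (i∉S ∘ ∈-subsetOf⁺ (¬? ∘ vanish?)))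
              (λ vanish i∈S → ∈-subsetOf⁻ (¬? ∘ vanish?) i∈S vanish)

        minimal : ∀ w → (Σ[ D ∈ Code N ] IsLinear D × D ⊆ C × HasDimension D m × (∃[ S ] IsSupport D S × ∣ S ∣ ≡ w)) → N ∸ B ≤ w
        minimal w (D , _ , D⊆C , (basis , basis-independent , D⇔span) , S , S-support , refl) =
          support-bound {Ls = Ls} bound Ls-independent S S-vanish
          where
          -- An arbitrary subcode also comes from forms: each basis word is the word of some form,
          -- and a relation between these forms would be a relation between the basis words.
          preimage : ∀ j → C (lookup basis j)
          preimage j = D⊆C (Equivalence.from (D⇔span _) (span-member basis j))
          Ls : Vec (Vec Carrier k) m
          Ls = tabulate (proj₁ ∘ preimage)
          codeword-Ls : ∀ j → codeword (lookup Ls j) ≡ lookup basis j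
          codeword-Ls j = trans (cong codeword (Vec.lookup∘tabulate (proj₁ ∘ preimage) j)) (proj₂ (preimage j))
          basis≡ : Vec.map codeword Ls ≡ basis
          basis≡ = vec-ext λ j → trans (Vec.lookup-map j codeword Ls) (codeword-Ls j)
          Ls-independent : LinearlyIndependent Ls
          Ls-independent as eq = basis-independent as (trans (cong (linearCombination as) (sym basis≡))
            (trans (codeword-linear as Ls) (trans (cong codeword eq) codeword-0)))
            where
            codeword-0 : codeword 0ᵛ ≡ 0ᵛ
            codeword-0 = vec-ext λ i → trans (lookup-codeword 0ᵛ i) (trans (dot-0 (P i)) (sym (Vec.lookup-replicate i 0#)))
          S-vanish : ∀ i → i ∉ S → Vanish Ls i
          S-vanish i i∉S j = trans (sym (lookup-codeword (lookup Ls j) i)) (trans (cong (λ v → lookup v i) (codeword-Ls j))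
            (decidable-stable (_ ≟ 0#) λ ≢0 → i∉S (Equivalence.from (S-support i)
              (lookup basis j , Equivalence.from (D⇔span _) (span-member basis j) , ≢0))))

      ∉-differing : ∀ (u v : Vec Carrier N) i → i ∉ differingPositions u v ⇔ lookup u i ≡ lookup v i
      ∉-differing u v i = mk⇔
        (λ i∉ → decidable-stable (lookup u i ≟ lookup v i) λ ≢ → i∉ (Vec.lookup⇒[]= i _ (trans (Vec.lookup-zipWith _ i u v) (dec-true (¬? (lookup u i ≟ lookup v i)) ≢))))
        (λ eq i∈ → does-true⇒ (¬? (lookup u i ≟ lookup v i)) (trans (sym (Vec.lookup-zipWith _ i u v)) (Vec.[]=⇒lookup i∈)) eq)

      -- The words of a and b agree at i exactly when the form a - b vanishes at `P i`, so distances
      -- are governed by sections with one form. The minimum is attained against the zero word.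
      minimumDistance : ∀ {B} → SectionsAtMost 1 B → Section 1 B → IsMinimumDistance C (N ∸ B)
      minimumDistance {B} bound section = attained , minimal
        where
        open Section section
        form : Vec Carrier k
        form = Vec.head forms
        forms≡ : forms ≡ form ∷ []
        forms≡ = single forms
          where
          single : ∀ {A : Set} (v : Vec A 1) → v ≡ Vec.head v ∷ []
          single (x ∷ []) = refl
        form≢0 : form ≢ 0ᵛ
        form≢0 = independent⇒≢0 (subst LinearlyIndependent forms≡ independent)

        attained : ∃[ u ] ∃[ v ] C u × C v × u ≢ v × hammingDistance u v ≡ N ∸ B
        attained = codeword form , 0ᵛ , (form , refl) , IsLinear.zero-closed (span-isLinear rows)
          , (λ eq → form≢0 (codeword≡0⇒ eq))
          , support-size bound section _ λ i → mk⇔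
              (λ i∉ → subst (λ Ls → Vanish Ls i) (sym forms≡) λ { zero → trans (sym (lookup-codeword form i)) (trans (Equivalence.to (∉-differing (codeword form) 0ᵛ i) i∉) (Vec.lookup-replicate i 0#)) })
              (λ vanish → Equivalence.from (∉-differing (codeword form) 0ᵛ i)
                (trans (lookup-codeword form i) (trans (subst (λ Ls → Vanish Ls i) forms≡ vanish zero) (sym (Vec.lookup-replicate i 0#)))))

        minimal : ∀ d → (∃[ u ] ∃[ v ] C u × C v × u ≢ v × hammingDistance u v ≡ d) → N ∸ B ≤ d
        minimal d (u , v , (a , refl) , (b , refl) , u≢v , refl) =
          support-bound {Ls = L ∷ []} bound (independent-single L≢0) (differingPositions u v)
            λ { i i∉ zero → L-vanish i (Equivalence.to (∉-differing u v i) i∉) }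
          where
          L : Vec Carrier k
          L = a +ᵛ (- 1#) · b
          dot-L : ∀ x → dot L x ≡ dot a x + - dot b x
          dot-L x = trans (dot-+ a _ x) (cong (dot a x +_) (trans (dot-· (- 1#) b x) (-1*x≈-x (dot b x))))
            where open Algebra.Properties.Ring ring using (-1*x≈-x)
          L-vanish : ∀ i → lookup u i ≡ lookup v i → dot L (P i) ≡ 0#
          L-vanish i eq = trans (dot-L (P i)) (trans (cong (_+ - dot b (P i)) (trans (sym (lookup-codeword a i)) (trans eq (lookup-codeword b i)))) (-‿inverseʳ _))
          L≢0 : L ≢ 0ᵛ
          L≢0 L≡0 = u≢v (vec-ext λ i → trans (lookup-codeword a i) (trans (difference (trans (sym (dot-L (P i))) (trans (cong (λ L → dot L (P i)) L≡0) (dot-0 (P i))))) (sym (lookup-codeword b i))))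
            where
            difference : ∀ {x y} → x + - y ≡ 0# → x ≡ y
            difference {x} {y} eq = begin
              x                ≡⟨ +-identityʳ x ⟨
              x + 0#           ≡⟨ cong (x +_) (-‿inverseˡ y) ⟨
              x + (- y + y)    ≡⟨ +-assoc x (- y) y ⟨
              x + - y + y      ≡⟨ cong (_+ y) eq ⟩
              0# + y           ≡⟨ +-identityˡ y ⟩
              y                ∎

-- Gaussian elimination; points of a linear section

module Elimination {n : ℕ} (K : FiniteField n) where
  open FiniteField K
  open FieldTheory K
  open Over K
  open LinearAlgebra K
  open Algebra.Properties.Semiring.Sum semiring using (sum; sum-cong-≗; sum-remove; ∑-distrib-+; *-distribʳ-sum; *-distribˡ-sum; sum-replicate-zero)
  open Algebra.Properties.Ring ring using (-‿distribˡ-*)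
  open ≡-Reasoning

  private variable k m N : ℕ

  sum-zero : ∀ {k} (f : Fin k → Carrier) → (∀ i → f i ≡ 0#) → sum f ≡ 0#
  sum-zero {k} f f≡0 = trans (sum-cong-≗ f≡0) (sum-replicate-zero k)

  sum-lone : ∀ {k} (f : Fin (suc k) → Carrier) i → (∀ j → f (punchIn i j) ≡ 0#) → sum f ≡ f i
  sum-lone f i rest≡0 = trans (sum-remove {i = i} f) (trans (cong (f i +_) (sum-zero (f ∘ punchIn i) rest≡0)) (+-identityʳ _))

  -- Functions on `Fin` replace vectors because deleting the pivot column is then composition with
  -- `punchIn`.
  Independent : (Fin m → Fin k → Carrier) → Set
  Independent {m} L = ∀ (a : Fin m → Carrier) → (∀ l → sum (λ i → a i * L i l) ≡ 0#) → ∀ i → a i ≡ 0#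

  -- The r coordinates are injective on the solution space. Only this half of the dimension formula
  -- is recorded, since sections are to be bounded from above.
  FreeCoordinates : ∀ {r} → (Fin m → Fin k → Carrier) → (Fin r → Fin k) → Set
  FreeCoordinates {k = k} L free = ∀ (x : Fin k → Carrier) → (∀ i → sum (λ l → L i l * x l) ≡ 0#) → (∀ t → x (free t) ≡ 0#) → ∀ l → x l ≡ 0#

  nonzero-entry : ∀ {m k} (L : Fin (suc m) → Fin k → Carrier) → Independent L → ∃[ j ] L zero j ≢ 0#
  nonzero-entry {m} L independent with Fin.any? (λ j → ¬? (L zero j ≟ 0#))
  ... | yes found = found
  ... | no none   = contradiction (independent unit vanishes zero) 1≢0
    where
    unit : Fin (suc m) → Carrier
    unit zero    = 1#
    unit (suc _) = 0#
    vanishes : ∀ l → sum (λ i → unit i * L i l) ≡ 0#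
    vanishes l = trans (cong₂ _+_ (trans (*-identityˡ _) (decidable-stable (L zero l ≟ 0#) λ ≢0 → none (l , ≢0)))
      (sum-zero _ λ i → zeroˡ (L (suc i) l))) (+-identityˡ 0#)

  -- The pivot column j of the first form is cleared from the other forms.
  freeCoordinates : ∀ m {r} (L : Fin m → Fin (m ℕ.+ r) → Carrier) → Independent L →
                    Σ[ free ∈ (Fin r → Fin (m ℕ.+ r)) ] FreeCoordinates L free
  freeCoordinates zero    L independent = id , λ x _ x≡0 → x≡0
  freeCoordinates (suc m) {r} L independent = let (free , free-L′) = freeCoordinates m L′ independent′ in
    punchIn j ∘ free , λ x solves x-free → let
      others : ∀ l → x (punchIn j l) ≡ 0#
      others = free-L′ (x ∘ punchIn j) (λ i → reduced x i solves) x-free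
      in all-zero x others (solves zero)
    where
    j = proj₁ (nonzero-entry L independent)
    p = L zero j
    p≢0 : p ≢ 0#
    p≢0 = proj₂ (nonzero-entry L independent)
    d : Fin m → Carrier
    d i = - (L (suc i) j * p ⁻¹)
    cleared : Fin m → Fin (suc m ℕ.+ r) → Carrier
    cleared i l = L (suc i) l + d i * L zero l
    cleared-j : ∀ i → cleared i j ≡ 0#
    cleared-j i = begin
      L (suc i) j + - (L (suc i) j * p ⁻¹) * p     ≡⟨ cong (L (suc i) j +_) (-‿distribˡ-* _ p) ⟨
      L (suc i) j + - (L (suc i) j * p ⁻¹ * p)     ≡⟨ cong (λ t → L (suc i) j + - t) (trans (*-assoc _ _ p) (trans (cong (L (suc i) j *_) (x⁻¹*x≡1 p≢0)) (*-identityʳ _))) ⟩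
      L (suc i) j + - L (suc i) j                  ≡⟨ -‿inverseʳ _ ⟩
      0#                                           ∎
    L′ : Fin m → Fin (m ℕ.+ r) → Carrier
    L′ i = cleared i ∘ punchIn j

    -- A relation between the cleared forms is one between the original forms, with the multiples of
    -- the pivot form collected in `b zero`. In the deleted column it holds because the cleared
    -- entries are 0 there.
    independent′ : Independent L′
    independent′ a a-L′ i = independent b b-L (suc i)
      where
      b : Fin (suc m) → Carrier
      b zero    = sum (λ i → a i * d i)
      b (suc i) = a i
      b-L-cleared : ∀ l → sum (λ i → b i * L i l) ≡ sum (λ i → a i * cleared i l)
      b-L-cleared l = begin
        sum (λ i → a i * d i) * L zero l + sum (λ i → a i * L (suc i) l)
          ≡⟨ cong (_+ sum (λ i → a i * L (suc i) l)) (*-distribʳ-sum (L zero l) (λ i → a i * d i)) ⟩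
        sum (λ i → a i * d i * L zero l) + sum (λ i → a i * L (suc i) l)
          ≡⟨ ∑-distrib-+ (λ i → a i * d i * L zero l) (λ i → a i * L (suc i) l) ⟨
        sum (λ i → a i * d i * L zero l + a i * L (suc i) l)
          ≡⟨ sum-cong-≗ (λ i → trans (cong (_+ a i * L (suc i) l) (*-assoc (a i) (d i) _)) (trans (sym (distribˡ (a i) _ _)) (cong (a i *_) (+-comm _ _)))) ⟩
        sum (λ i → a i * cleared i l) ∎
      b-L : ∀ l → sum (λ i → b i * L i l) ≡ 0#
      b-L l with j Fin.≟ l
      ... | yes refl = trans (b-L-cleared j) (sum-zero (λ i → a i * cleared i j) λ i → trans (cong (a i *_) (cleared-j i)) (zeroʳ (a i)))
      ... | no j≢l   = trans (b-L-cleared l) (subst (λ l → sum (λ i → a i * cleared i l) ≡ 0#) (Fin.punchIn-punchOut j≢l) (a-L′ (punchOut j≢l)))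

    reduced : ∀ x i → (∀ i → sum (λ l → L i l * x l) ≡ 0#) → sum (λ l → L′ i l * x (punchIn j l)) ≡ 0#
    reduced x i solves = begin
      sum (F ∘ punchIn j)                                                 ≡⟨ +-identityˡ _ ⟨
      0# + sum (F ∘ punchIn j)                                            ≡⟨ cong (_+ sum (F ∘ punchIn j)) (trans (cong (_* x j) (cleared-j i)) (zeroˡ (x j))) ⟨
      F j + sum (F ∘ punchIn j)                                           ≡⟨ sum-remove {i = j} F ⟨
      sum F                                                               ≡⟨ sum-cong-≗ (λ l → trans (distribʳ (x l) _ _) (cong (L (suc i) l * x l +_) (*-assoc (d i) (L zero l) (x l)))) ⟩
      sum (λ l → L (suc i) l * x l + d i * (L zero l * x l))              ≡⟨ ∑-distrib-+ (λ l → L (suc i) l * x l) (λ l → d i * (L zero l * x l)) ⟩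
      sum (λ l → L (suc i) l * x l) + sum (λ l → d i * (L zero l * x l))  ≡⟨ cong₂ _+_ (solves (suc i)) (trans (sym (*-distribˡ-sum (d i) (λ l → L zero l * x l))) (trans (cong (d i *_) (solves zero)) (zeroʳ (d i)))) ⟩
      0# + 0#                                                             ≡⟨ +-identityˡ 0# ⟩
      0#                                                                  ∎
      where
      F : Fin (suc m ℕ.+ r) → Carrier
      F l = cleared i l * x l

    all-zero : ∀ x → (∀ l → x (punchIn j l) ≡ 0#) → sum (λ l → L zero l * x l) ≡ 0# → ∀ l → x l ≡ 0#
    all-zero x others solves l with j Fin.≟ l
    ... | no j≢l   = subst (λ l → x l ≡ 0#) (Fin.punchIn-punchOut j≢l) (others (punchOut j≢l))
    ... | yes refl = no-zero-divisors p≢0 (trans (sym (sum-lone (λ l → L zero l * x l) j λ l → trans (cong (L zero (punchIn j l) *_) (others l)) (zeroʳ _))) solves)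

  dot≡sum : ∀ (a x : Vec Carrier k) → dot a x ≡ sum (λ l → lookup a l * lookup x l)
  dot≡sum []       []       = refl
  dot≡sum (a ∷ as) (x ∷ xs) = cong (a * x +_) (dot≡sum as xs)

  free-coordinates : ∀ {r} → k ≡ m ℕ.+ r → (Ls : Vec (Vec Carrier k) m) → LinearlyIndependent Ls →
    Σ[ free ∈ (Fin r → Fin k) ] ∀ x → (∀ j → dot (lookup Ls j) x ≡ 0#) → (∀ t → lookup x (free t) ≡ 0#) → x ≡ 0ᵛ
  free-coordinates {m = m} refl Ls independent = let (free , is-free) = freeCoordinates m (λ i l → lookup (lookup Ls i) l) independent′ in
    free , λ x solves x-free → vec-ext λ l →
      trans (is-free (lookup x) (λ i → trans (sym (dot≡sum (lookup Ls i) x)) (solves i)) x-free l) (sym (Vec.lookup-replicate l 0#))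
    where
    independent′ : Independent (λ i l → lookup (lookup Ls i) l)
    independent′ a a-L i = trans (sym (Vec.lookup∘tabulate a i)) (trans (cong (λ v → lookup v i) as≡0) (Vec.lookup-replicate i 0#))
      where
      as≡0 : tabulate a ≡ 0ᵛ
      as≡0 = independent (tabulate a) (vec-ext λ l → begin
        lookup (linearCombination (tabulate a) Ls) l                    ≡⟨ lookup-linearCombination (tabulate a) Ls l ⟩
        dot (tabulate a) (Vec.map (λ v → lookup v l) Ls)                ≡⟨ dot≡sum (tabulate a) _ ⟩
        sum (λ i → lookup (tabulate a) i * lookup (Vec.map (λ v → lookup v l) Ls) i)
          ≡⟨ sum-cong-≗ (λ i → cong₂ _*_ (Vec.lookup∘tabulate a i) (Vec.lookup-map i (λ v → lookup v l) Ls)) ⟩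
        sum (λ i → a i * lookup (lookup Ls i) l)                        ≡⟨ a-L l ⟩
        0#                                                              ≡⟨ Vec.lookup-replicate l 0# ⟨
        lookup 0ᵛ l                                                     ∎)

  module ProjectivePoints {N k : ℕ} (P : Fin N → Vec (FiniteField.Carrier K) k)
    (P≢0 : ∀ i → P i ≢ Over.0ᵛ K) (P-injective : ∀ {i j} → Over._∼_ K (P i) (P j) → i ≡ j) where
    open EvaluationCode P using (Vanish; SectionsAtMost)

    private
      module Sections {r} (k≡ : k ≡ m ℕ.+ r) (Ls : Vec (Vec Carrier k) m) (independent : LinearlyIndependent Ls) where
        free : Σ[ free ∈ (Fin r → Fin k) ] ∀ x → (∀ j → dot (lookup Ls j) x ≡ 0#) → (∀ t → lookup x (free t) ≡ 0#) → x ≡ 0ᵛ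
        free = free-coordinates k≡ Ls independent

        coordinate : Fin N → Fin r → Carrier
        coordinate i t = lookup (P i) (proj₁ free t)

        coordinates-nonzero : ∀ {i} → Vanish Ls i → ¬ (∀ t → coordinate i t ≡ 0#)
        coordinates-nonzero {i} vanish ≡0 = P≢0 i (proj₂ free (P i) vanish ≡0)

        -- The difference of `P j` and c · `P i` satisfies all the forms and has zero free
        -- coordinates, hence is 0.
        proportional : ∀ {i j c} → c ≢ 0# → Vanish Ls i → Vanish Ls j → (∀ t → c * coordinate i t ≡ coordinate j t) → i ≡ j
        proportional {i} {j} {c} c≢0 vᵢ vⱼ eq = P-injective (c , c≢0 , vec-ext λ l → difference l)
          where
          z : Vec Carrier k
          z = P j +ᵛ (- c) · P i
          lookup-z : ∀ l → lookup z l ≡ lookup (P j) l + - (c * lookup (P i) l)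
          lookup-z l = trans (Vec.lookup-zipWith _+_ l (P j) _) (cong (lookup (P j) l +_) (trans (Vec.lookup-map l (- c *_) (P i)) (sym (-‿distribˡ-* c _))))
          dot-+ʳ : ∀ {k} (a x y : Vec Carrier k) → dot a (x +ᵛ y) ≡ dot a x + dot a y
          dot-+ʳ a x y = trans (dot-comm a (x +ᵛ y)) (trans (dot-+ x y a) (cong₂ _+_ (dot-comm x a) (dot-comm y a)))
            where
            dot-comm : ∀ {k} (a b : Vec Carrier k) → dot a b ≡ dot b a
            dot-comm []       []       = refl
            dot-comm (a ∷ as) (b ∷ bs) = cong₂ _+_ (*-comm a b) (dot-comm as bs)
          z≡0 : z ≡ 0ᵛ
          z≡0 = proj₂ free z
            (λ l → trans (dot-+ʳ (lookup Ls l) (P j) _) (trans (cong₂ _+_ (vⱼ l) (trans (dot-·ʳ (- c) (lookup Ls l) (P i)) (trans (cong (- c *_) (vᵢ l)) (zeroʳ _)))) (+-identityˡ 0#)))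
            λ t → trans (lookup-z _) (trans (cong (λ s → s + - (c * coordinate i t)) (sym (eq t))) (-‿inverseʳ _))
          difference : ∀ l → lookup (c · P i) l ≡ lookup (P j) l
          difference l = trans (Vec.lookup-map l (c *_) (P i)) (sym (begin
            y                 ≡⟨ +-identityʳ y ⟨
            y + 0#            ≡⟨ cong (y +_) (-‿inverseˡ x) ⟨
            y + (- x + x)     ≡⟨ +-assoc y (- x) x ⟨
            y + - x + x       ≡⟨ cong (_+ x) (trans (sym (lookup-z l)) (trans (cong (λ v → lookup v l) z≡0) (Vec.lookup-replicate l 0#))) ⟩
            0# + x            ≡⟨ +-identityˡ x ⟩
            x                 ∎))
            where
            x = c * lookup (P i) l
            y = lookup (P j) l

        ratio : ∀ {x y} → x ≢ 0# → y * x ⁻¹ * x ≡ y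
        ratio {x} {y} x≢0 = trans (*-assoc y _ x) (trans (cong (y *_) (x⁻¹*x≡1 x≢0)) (*-identityʳ y))

    points-atMost : ∀ m → k ≡ m ℕ.+ 1 → SectionsAtMost m 1
    points-atMost m k≡ Ls independent = atMost-1 λ {i} {j} vᵢ vⱼ →
      let x≢0 = λ x≡0 → coordinates-nonzero vᵢ λ { zero → x≡0 }
          y≢0 = λ y≡0 → coordinates-nonzero vⱼ λ { zero → y≡0 }
      in proportional {i} {j} {coordinate j zero * coordinate i zero ⁻¹} (*-≢0 y≢0 (⁻¹-≢0 x≢0)) vᵢ vⱼ λ { zero → ratio x≢0 }
      where open Sections {m} {1} k≡ Ls independent

    -- The number of all points of a projective line: a slope for each point with first free
    -- coordinate nonzero, and one more point.
    lines-atMost : ∀ m → k ≡ m ℕ.+ 2 → SectionsAtMost m (n ℕ.+ 1)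
    lines-atMost m k≡ Ls independent = atMost-⊎ {P = Vanish Ls}
      {Q = λ i → Vanish Ls i × u i ≢ 0#} {R = λ i → Vanish Ls i × u i ≡ 0#} split
      (atMost-along {Q = λ _ → ⊤} (λ i _ → w i * u i ⁻¹) _ slope-injective (atMost-↔ enumeration))
      (atMost-1 lone)
      where
      open Sections {m} {2} k≡ Ls independent
      u w : Fin N → Carrier
      u i = coordinate i zero
      w i = coordinate i (suc zero)
      split : ∀ i → Vanish Ls i → (Vanish Ls i × u i ≢ 0#) ⊎ (Vanish Ls i × u i ≡ 0#)
      split i v with u i ≟ 0#
      ... | yes ≡0 = inj₂ (v , ≡0)
      ... | no ≢0  = inj₁ (v , ≢0)
      slope-injective : ∀ {i j} → Vanish Ls i × u i ≢ 0# → Vanish Ls j × u j ≢ 0# → w i * u i ⁻¹ ≡ w j * u j ⁻¹ → i ≡ j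
      slope-injective {i} {j} (vᵢ , uᵢ≢0) (vⱼ , uⱼ≢0) eq = proportional {c = c} (*-≢0 uⱼ≢0 (⁻¹-≢0 uᵢ≢0)) vᵢ vⱼ λ
        { zero → ratio uᵢ≢0
        ; (suc zero) → begin
            u j * u i ⁻¹ * w i       ≡⟨ trans (*-assoc _ _ _) (cong (u j *_) (*-comm _ _)) ⟩
            u j * (w i * u i ⁻¹)     ≡⟨ cong (u j *_) eq ⟩
            u j * (w j * u j ⁻¹)     ≡⟨ *-comm _ _ ⟩
            w j * u j ⁻¹ * u j       ≡⟨ ratio uⱼ≢0 ⟩
            w j                      ∎ }
        where c = u j * u i ⁻¹
      lone : ∀ {i j} → Vanish Ls i × u i ≡ 0# → Vanish Ls j × u j ≡ 0# → i ≡ j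
      lone {i} {j} (vᵢ , uᵢ≡0) (vⱼ , uⱼ≡0) = proportional {c = w j * w i ⁻¹} (*-≢0 wⱼ≢0 (⁻¹-≢0 wᵢ≢0)) vᵢ vⱼ λ
        { zero → trans (cong (w j * w i ⁻¹ *_) uᵢ≡0) (trans (zeroʳ _) (sym uⱼ≡0))
        ; (suc zero) → ratio wᵢ≢0 }
        where
        wᵢ≢0 : w i ≢ 0#
        wᵢ≢0 wᵢ≡0 = coordinates-nonzero vᵢ λ { zero → uᵢ≡0 ; (suc zero) → wᵢ≡0 }
        wⱼ≢0 : w j ≢ 0#
        wⱼ≢0 wⱼ≡0 = coordinates-nonzero vⱼ λ { zero → uⱼ≡0 ; (suc zero) → wⱼ≡0 }

-- Normalized points and the bound for plane sections

module NormalForms {e : ℕ} {K : FiniteField ((2 ℕ.^ e) ℕ.^ 2)} (generator : QuadraticGenerator e K) (1≤e : 1 ≤ e) (odd : ¬ (2 ∣ e)) where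
  open SurfaceEquation generator 1≤e odd public
  open Over K hiding (Γ) public
  open LinearAlgebra K public
  open ≡-Reasoning

  n : ℕ
  n = (2 ℕ.^ e) ℕ.^ 2

  -- The first nonzero coordinate is scaled to 1. There is no case with X₂ as the first nonzero
  -- coordinate, because X₁^D = X₂^D at infinity forces X₂ = 0 when X₁ = 0.
  data Normal : Set where
    affine     : (x y z : Carrier) → Normal
    atInfinity : (ω z : Carrier) → Normal
    apex       : Normal

  toVec : Normal → Vec Carrier 4
  toVec (affine x y z)   = 1# ∷ x ∷ y ∷ z ∷ []
  toVec (atInfinity ω z) = 0# ∷ 1# ∷ ω ∷ z ∷ []
  toVec apex             = 0# ∷ 0# ∷ 0# ∷ 1# ∷ []

  OnSurface : Pred Normal 0ℓ
  OnSurface (affine x y z)   = im z ≡ γ x + γ y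
  OnSurface (atInfinity ω z) = ω ^ D ≡ 1#
  OnSurface apex             = ⊤

  onSurface⇔ : ∀ w → 𝒱 e ε 3 (toVec w) ⇔ OnSurface w
  onSurface⇔ (affine x y z)   = 𝒱-affine x y z
  onSurface⇔ (atInfinity ω z) = mk⇔
    (λ ∈𝒱 → trans (sym (Equivalence.to (𝒱-infinity 1# ω z) ∈𝒱)) (1^k≡1 D))
    (λ eq → Equivalence.from (𝒱-infinity 1# ω z) (trans (1^k≡1 D) (sym eq)))
  onSurface⇔ apex = mk⇔ _ (λ _ → Equivalence.from (𝒱-infinity 0# 0# 1#) refl)

  toVec≢0 : ∀ w → toVec w ≢ 0ᵛ
  toVec≢0 (affine x y z)   eq = 1≢0 (cong (λ v → lookup v zero) eq)
  toVec≢0 (atInfinity ω z) eq = 1≢0 (cong (λ v → lookup v (suc zero)) eq)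
  toVec≢0 apex             eq = 1≢0 (cong (λ v → lookup v (suc (suc (suc zero)))) eq)

  Normalized : Vec Carrier 4 → Set
  Normalized v = ∃[ w ] v ∼ toVec w × OnSurface w

  normalized : ∀ v w c → 𝒱 e ε 3 v → c ≢ 0# → c · v ≡ toVec w → Normalized v
  normalized v w c ∈𝒱 c≢0 eq = w , (c , c≢0 , eq) , Equivalence.to (onSurface⇔ w) (subst (𝒱 e ε 3) eq (𝒱-· c v ∈𝒱))

  normalize : ∀ v → v ≢ 0ᵛ → 𝒱 e ε 3 v → Normalized v
  normalize (x₀ ∷ x₁ ∷ x₂ ∷ x₃ ∷ []) v≢0 ∈𝒱 = by-x₀ (x₀ ≟ 0#)
    where
    v : Vec Carrier 4
    v = x₀ ∷ x₁ ∷ x₂ ∷ x₃ ∷ []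
    scaled-0 : ∀ c {x} → x ≡ 0# → c * x ≡ 0#
    scaled-0 c refl = zeroʳ c
    by-x₁ : x₀ ≡ 0# → Dec (x₁ ≡ 0#) → Normalized v
    by-x₁ x₀≡0 (no x₁≢0) = normalized v (atInfinity (c * x₂) (c * x₃)) c ∈𝒱 (⁻¹-≢0 x₁≢0)
      (cong₂ (λ s t → s ∷ t ∷ c * x₂ ∷ c * x₃ ∷ []) (scaled-0 c x₀≡0) (x⁻¹*x≡1 x₁≢0))
      where c = x₁ ⁻¹
    by-x₁ x₀≡0 (yes x₁≡0) = normalized v apex c ∈𝒱 (⁻¹-≢0 x₃≢0)
      (trans (cong₂ (λ s t → s ∷ t ∷ c * x₂ ∷ c * x₃ ∷ []) (scaled-0 c x₀≡0) (scaled-0 c x₁≡0))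
             (cong₂ (λ s t → 0# ∷ 0# ∷ s ∷ t ∷ []) (scaled-0 c x₂≡0) (x⁻¹*x≡1 x₃≢0)))
      where
      c = x₃ ⁻¹
      x₂≡0 : x₂ ≡ 0#
      x₂≡0 = x^k≡0⇒x≡0 D (trans (sym (Equivalence.to (𝒱-infinity 0# x₂ x₃)
        (subst (𝒱 e ε 3) (cong₂ (λ s t → s ∷ t ∷ x₂ ∷ x₃ ∷ []) x₀≡0 x₁≡0) ∈𝒱))) 0^D≡0)
      x₃≢0 : x₃ ≢ 0#
      x₃≢0 x₃≡0 = v≢0 (trans (cong₂ (λ s t → s ∷ t ∷ x₂ ∷ x₃ ∷ []) x₀≡0 x₁≡0) (cong₂ (λ s t → 0# ∷ 0# ∷ s ∷ t ∷ []) x₂≡0 x₃≡0))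
    by-x₀ : Dec (x₀ ≡ 0#) → Normalized v
    by-x₀ (no x₀≢0)   = normalized v (affine (c * x₁) (c * x₂) (c * x₃)) c ∈𝒱 (⁻¹-≢0 x₀≢0)
      (cong (_∷ c * x₁ ∷ c * x₂ ∷ c * x₃ ∷ []) (x⁻¹*x≡1 x₀≢0))
      where c = x₀ ⁻¹
    by-x₀ (yes x₀≡0)  = by-x₁ x₀≡0 (x₁ ≟ 0#)

  ∼⇒≡ : ∀ w w′ → toVec w ∼ toVec w′ → w ≡ w′
  ∼⇒≡ w w′ (c , c≢0 , eq) = go w w′ (λ i → trans (sym (Vec.lookup-map i (c *_) (toVec w))) (cong (λ v → lookup v i) eq))
    where
    i₀ i₁ i₂ i₃ : Fin 4
    i₀ = zero
    i₁ = suc zero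
    i₂ = suc (suc zero)
    i₃ = suc (suc (suc zero))
    Entries : Normal → Normal → Set
    Entries w w′ = ∀ i → c * lookup (toVec w) i ≡ lookup (toVec w′) i
    c1≢0 : c * 1# ≢ 0#
    c1≢0 eq = c≢0 (trans (sym (*-identityʳ c)) eq)
    c0≢1 : c * 0# ≢ 1#
    c0≢1 eq = 0≢1 (trans (sym (zeroʳ c)) eq)
    same : c * 1# ≡ 1# → ∀ {x y} → c * x ≡ y → x ≡ y
    same c1≡1 {x} cx≡y = trans (sym (*-identityˡ x)) (trans (cong (_* x) (trans (sym c1≡1) (*-identityʳ c))) cx≡y)
    go : ∀ w w′ → Entries w w′ → w ≡ w′
    go (affine x y z) (affine x′ y′ z′) eq = trans
      (cong₂ (λ x y → affine x y z) (same (eq i₀) (eq i₁)) (same (eq i₀) (eq i₂)))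
      (cong (affine x′ y′) (same (eq i₀) (eq i₃)))
    go (atInfinity ω z) (atInfinity ω′ z′) eq = cong₂ atInfinity (same (eq i₁) (eq i₂)) (same (eq i₁) (eq i₃))
    go apex             apex             eq = refl
    go (affine x y z)   (atInfinity ω z′) eq = contradiction (eq i₀) c1≢0
    go (affine x y z)   apex             eq = contradiction (eq i₀) c1≢0
    go (atInfinity ω z) apex             eq = contradiction (eq i₁) c1≢0
    go (atInfinity ω z) (affine x y z′)  eq = contradiction (eq i₀) c0≢1
    go apex             (affine x y z)   eq = contradiction (eq i₀) c0≢1
    go apex             (atInfinity ω z) eq = contradiction (eq i₁) c0≢1

  atMost-Normal : ∀ {a b c} {P : Pred Normal 0ℓ} → AtMost a (λ ((x , y , z) : Carrier × Carrier × Carrier) → P (affine x y z)) →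
                  AtMost b (λ ((ω , z) : Carrier × Carrier) → P (atInfinity ω z)) → AtMost {⊤} c (λ _ → P apex) →
                  AtMost (a ℕ.+ (b ℕ.+ c)) P
  atMost-Normal {P = P} bound-a bound-b bound-c =
    atMost-⊎ {Q = Affine} {R = Infinite} split
      (atMost-along {P = Affine} coordinates (λ { (affine x y z) p → p }) (λ { {affine _ _ _} {affine _ _ _} _ _ refl → refl }) bound-a)
      (atMost-⊎ {Q = Generic} {R = Apex} split′
        (atMost-along {P = Generic} slope (λ { (atInfinity ω z) p → p }) (λ { {atInfinity _ _} {atInfinity _ _} _ _ refl → refl }) bound-b)
        (atMost-along {P = Apex} (λ _ _ → tt) (λ { apex p → p }) (λ { {apex} {apex} _ _ _ → refl }) bound-c))
    where
    Affine Infinite Generic Apex : Pred Normal 0ℓ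
    Affine (affine x y z) = P (affine x y z)
    Affine _              = ⊥
    Infinite (affine x y z) = ⊥
    Infinite w              = P w
    Generic (atInfinity ω z) = P (atInfinity ω z)
    Generic _                = ⊥
    Apex apex = P apex
    Apex _    = ⊥
    coordinates : ∀ w → Affine w → Carrier × Carrier × Carrier
    coordinates (affine x y z) _ = x , y , z
    slope : ∀ w → Generic w → Carrier × Carrier
    slope (atInfinity ω z) _ = ω , z
    split : ∀ w → P w → Affine w ⊎ Infinite w
    split (affine x y z)   p = inj₁ p
    split (atInfinity ω z) p = inj₂ p
    split apex             p = inj₂ p
    split′ : ∀ w → Infinite w → Generic w ⊎ Apex w
    split′ (atInfinity ω z) p = inj₁ p
    split′ apex             p = inj₂ p

  OnSection : Vec Carrier 4 → Pred Normal 0ℓ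
  OnSection L w = OnSurface w × dot L (toVec w) ≡ 0#

  -- The first is q³ + q² + 1, grouped as `atMost-Normal` counts a plane through the apex: q² · q
  -- affine points, q² at infinity, and the apex.
  planeSize lineSize : ℕ
  planeSize = n ℕ.* q ℕ.+ (n ℕ.+ 1)
  lineSize = n ℕ.+ 1

  private
    im,re-injective : ∀ {x y} → im x ≡ im y → re-InF x ∈F ≡ re-InF y ∈F → x ≡ y
    im,re-injective {x} {y} i r = trans (sym (re+imε x)) (trans (cong₂ (λ a b → a + b * ε) (cong val r) i) (re+imε y))

    Carrier×F : AtMost {Carrier × F} (n ℕ.* q) (λ _ → ⊤ × ⊤)
    Carrier×F = atMost-× (atMost-↔ enumeration) (atMost-↔ F-enumeration)

    apex≤1 : ∀ {P : Set} → AtMost {⊤} 1 (λ _ → P)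
    apex≤1 = atMost-1 λ _ _ → refl

    cancel-common : ∀ {a s t u} → a ≢ 0# → s + a * t ≡ 0# → s + a * u ≡ 0# → t ≡ u
    cancel-common {a} {s} {t} {u} a≢0 eq eq′ = *-cancelˡ a≢0 (x+y≡0⇒x≡y (begin
      a * t + a * u                    ≡⟨ solve 3 (λ s t u → t :+ u := s :+ t :+ (s :+ u)) refl s (a * t) (a * u) ⟩
      s + a * t + (s + a * u)          ≡⟨ cong₂ _+_ eq eq′ ⟩
      0# + 0#                          ≡⟨ +-identityˡ 0# ⟩
      0#                               ∎))

    affine-≡ : ∀ {x y z x′ y′ z′} → im z ≡ γ x + γ y → im z′ ≡ γ x′ + γ y′ → x ≡ x′ → y ≡ y′ →
               re-InF z ∈F ≡ re-InF z′ ∈F → (x , y , z) ≡ (x′ , y′ , z′)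
    affine-≡ {x} {y} on on′ refl refl same = cong (λ z → x , y , z) (im,re-injective (trans on (sym on′)) same)

  module OffApex (a₀ a₁ a₂ a₃ : Carrier) (a₃≢0 : a₃ ≢ 0#) where
    private
      L : Vec Carrier 4
      L = a₀ ∷ a₁ ∷ a₂ ∷ a₃ ∷ []
      i α β κ : Carrier
      i = a₃ ⁻¹
      α = i * a₀
      β = i * a₁
      κ = i * a₂
      count = affine-plane-count α β κ
      m : ℕ
      m = proj₁ count

      height : ∀ x y z → dot L (1# ∷ x ∷ y ∷ z ∷ []) ≡ 0# → z ≡ α + β * x + κ * y
      height x y z eq = *-cancelˡ a₃≢0 (x+y≡0⇒x≡y (begin
        a₃ * z + a₃ * (α + β * x + κ * y)
          ≡⟨ cong₂ (λ s t → a₃ * z + a₃ * (α + s + t)) (*-assoc i a₁ x) (*-assoc i a₂ y) ⟩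
        a₃ * z + a₃ * (i * a₀ + i * (a₁ * x) + i * (a₂ * y))
          ≡⟨ cong (λ t → a₃ * z + a₃ * t) (trans (cong (_+ i * (a₂ * y)) (sym (distribˡ i a₀ (a₁ * x)))) (sym (distribˡ i (a₀ + a₁ * x) (a₂ * y)))) ⟩
        a₃ * z + a₃ * (i * (a₀ + a₁ * x + a₂ * y))
          ≡⟨ cong (a₃ * z +_) (trans (sym (*-assoc a₃ i _)) (trans (cong (_* (a₀ + a₁ * x + a₂ * y)) (x*x⁻¹≡1 a₃≢0)) (*-identityˡ _))) ⟩
        a₃ * z + (a₀ + a₁ * x + a₂ * y)
          ≡⟨ solve 4 (λ a₀ s t u → u :+ (a₀ :+ s :+ t) := a₀ :* con true :+ (s :+ (t :+ (u :+ con false)))) refl a₀ (a₁ * x) (a₂ * y) (a₃ * z) ⟩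
        dot L (1# ∷ x ∷ y ∷ z ∷ [])
          ≡⟨ eq ⟩
        0# ∎))

      slope : ∀ ω z → dot L (0# ∷ 1# ∷ ω ∷ z ∷ []) ≡ 0# → (a₁ + a₂ * ω) + a₃ * z ≡ 0#
      slope ω z eq = trans (solve 4 (λ a₀ a₁ s t → (a₁ :+ s) :+ t := a₀ :* con false :+ (a₁ :* con true :+ (s :+ (t :+ con false)))) refl a₀ a₁ (a₂ * ω) (a₃ * z)) eq

      at-apex : dot L (toVec apex) ≡ a₃
      at-apex = solve 4 (λ a₀ a₁ a₂ a₃ → a₀ :* con false :+ (a₁ :* con false :+ (a₂ :* con false :+ (a₃ :* con true :+ con false))) := a₃) refl a₀ a₁ a₂ a₃

      -- Cancelling q in the bound of `affine-plane-count` gives m + q ≤ q³ + q². The remaining 1 is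
      -- what the q + 1 ratios at infinity need.
      size : m ℕ.+ (1 ℕ.+ q ℕ.+ 0) ≤ planeSize
      size = subst₂ _≤_ (sym left) (sym right) (s≤s (ℕ.*-cancelˡ-≤ q ⦃ ℕ.m^n≢0 2 e ⦄ (subst₂ _≤_
          (sym (ℕ.*-distribˡ-+ q m q))
          (trans (cong (ℕ._+ q ℕ.* (q ℕ.* q)) (ℕ.*-assoc q q (q ℕ.* q))) (sym (ℕ.*-distribˡ-+ q (q ℕ.* (q ℕ.* q)) (q ℕ.* q))))
          (proj₁ (proj₂ count)))))
        where
        left : m ℕ.+ (1 ℕ.+ q ℕ.+ 0) ≡ suc (m ℕ.+ q)
        left = trans (cong (m ℕ.+_) (ℕ.+-identityʳ (suc q))) (ℕ.+-suc m q)
        right : planeSize ≡ suc (q ℕ.* (q ℕ.* q) ℕ.+ q ℕ.* q)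
        right = trans (cong (n ℕ.* q ℕ.+_) (ℕ.+-comm n 1)) (trans (ℕ.+-suc (n ℕ.* q) n)
          (cong suc (cong₂ ℕ._+_ (trans (ℕ.*-comm n q) (cong (q ℕ.*_) q²)) q²)))

      affine-part : AtMost m (λ ((x , y , z) : Carrier × Carrier × Carrier) → OnSection L (affine x y z))
      affine-part = atMost-along (λ (x , y , z) _ → x , y)
        (λ (x , y , z) (on , eq) → trans (cong im (sym (height x y z eq))) on)
        (λ { {x , y , z} {_ , _ , z′} (_ , eq) (_ , eq′) refl → cong (λ z → x , y , z) (trans (height x y z eq) (sym (height x y z′ eq′))) })
        (proj₂ (proj₂ count))

      infinite-part : AtMost (1 ℕ.+ q) (λ ((ω , z) : Carrier × Carrier) → OnSection L (atInfinity ω z))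
      infinite-part = atMost-along (λ (ω , z) _ → ω) (λ _ → proj₁)
        (λ { {ω , z} {_ , z′} (_ , eq) (_ , eq′) refl → cong (ω ,_) (cancel-common a₃≢0 (slope ω z eq) (slope ω z′ eq′)) })
        roots-of-unity-count

    bound : AtMost planeSize (OnSection L)
    bound = atMost-≤ size (atMost-Normal {P = OnSection L} affine-part infinite-part
      (atMost-0 λ _ (_ , eq) → a₃≢0 (trans (sym at-apex) eq)))

  module ThroughApex₂ (a₀ a₁ a₂ : Carrier) (a₂≢0 : a₂ ≢ 0#) where
    private
      L : Vec Carrier 4
      L = a₀ ∷ a₁ ∷ a₂ ∷ 0# ∷ []

      at-affine : ∀ x y z → dot L (1# ∷ x ∷ y ∷ z ∷ []) ≡ 0# → (a₀ + a₁ * x) + a₂ * y ≡ 0#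
      at-affine x y z eq = trans (solve 4 (λ a₀ s t z → (a₀ :+ s) :+ t := a₀ :* con true :+ (s :+ (t :+ (con false :* z :+ con false)))) refl a₀ (a₁ * x) (a₂ * y) z) eq

      at-infinite : ∀ ω z → dot L (0# ∷ 1# ∷ ω ∷ z ∷ []) ≡ 0# → a₁ + a₂ * ω ≡ 0#
      at-infinite ω z eq = trans (solve 4 (λ a₀ a₁ s z → a₁ :+ s := a₀ :* con false :+ (a₁ :* con true :+ (s :+ (con false :* z :+ con false)))) refl a₀ a₁ (a₂ * ω) z) eq

      -- The plane determines y from x, and the surface then determines im z, which leaves x in K
      -- and re z in F.
      affine-part : AtMost (n ℕ.* q) (λ ((x , y , z) : Carrier × Carrier × Carrier) → OnSection L (affine x y z))
      affine-part = atMost-along {Q = λ _ → ⊤ × ⊤} (λ (x , y , z) _ → x , re-InF z ∈F) _ injective Carrier×F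
        where
        injective : ∀ {p p′ : Carrier × Carrier × Carrier} → OnSection L (affine (proj₁ p) (proj₁ (proj₂ p)) (proj₂ (proj₂ p))) →
                    OnSection L (affine (proj₁ p′) (proj₁ (proj₂ p′)) (proj₂ (proj₂ p′))) →
                    (proj₁ p , re-InF (proj₂ (proj₂ p)) ∈F) ≡ (proj₁ p′ , re-InF (proj₂ (proj₂ p′)) ∈F) → p ≡ p′
        injective {x , y , z} {x′ , y′ , z′} (on , eq) (on′ , eq′) same = affine-≡ on on′ (cong proj₁ same)
          (cancel-common a₂≢0 (at-affine x y z eq)
            (subst (λ x → (a₀ + a₁ * x) + a₂ * y′ ≡ 0#) (sym (cong proj₁ same)) (at-affine x′ y′ z′ eq′)))
          (cong proj₂ same)

      -- The plane fixes ω, and z is the only freedom left.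
      infinite-part : AtMost n (λ ((ω , z) : Carrier × Carrier) → OnSection L (atInfinity ω z))
      infinite-part = atMost-along {Q = λ _ → ⊤} (λ (ω , z) _ → z) _
        (λ { {ω , z} {ω′ , _} (_ , eq) (_ , eq′) refl → cong (_, z) (cancel-common a₂≢0 (at-infinite ω z eq) (at-infinite ω′ z eq′)) })
        (atMost-↔ enumeration)

    bound : AtMost planeSize (OnSection L)
    bound = atMost-Normal {P = OnSection L} affine-part infinite-part apex≤1

  module ThroughApex₁ (a₀ a₁ : Carrier) (a₁≢0 : a₁ ≢ 0#) where
    private
      L : Vec Carrier 4
      L = a₀ ∷ a₁ ∷ 0# ∷ 0# ∷ []

      at-affine : ∀ x y z → dot L (1# ∷ x ∷ y ∷ z ∷ []) ≡ 0# → a₀ + a₁ * x ≡ 0#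
      at-affine x y z eq = trans (solve 4 (λ a₀ s y z → a₀ :+ s := a₀ :* con true :+ (s :+ (con false :* y :+ (con false :* z :+ con false)))) refl a₀ (a₁ * x) y z) eq

      at-infinite : ∀ ω z → dot L (0# ∷ 1# ∷ ω ∷ z ∷ []) ≡ a₁
      at-infinite ω z = solve 4 (λ a₀ a₁ ω z → a₀ :* con false :+ (a₁ :* con true :+ (con false :* ω :+ (con false :* z :+ con false))) := a₁) refl a₀ a₁ ω z

      affine-part : AtMost (n ℕ.* q) (λ ((x , y , z) : Carrier × Carrier × Carrier) → OnSection L (affine x y z))
      affine-part = atMost-along {Q = λ _ → ⊤ × ⊤} (λ (x , y , z) _ → y , re-InF z ∈F) _
        (λ { {x , y , z} {x′ , y′ , z′} (on , eq) (on′ , eq′) same →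
             affine-≡ on on′ (cancel-common a₁≢0 (at-affine x y z eq) (at-affine x′ y′ z′ eq′)) (cong proj₁ same) (cong proj₂ same) })
        Carrier×F

    bound : AtMost planeSize (OnSection L)
    -- On X₀ = 0 the form becomes a₁X₁, so the apex is the only point at infinity.
    bound = atMost-≤ (ℕ.+-monoʳ-≤ (n ℕ.* q) (ℕ.m≤n+m 1 n)) (atMost-Normal {P = OnSection L} affine-part
      (atMost-0 λ (ω , z) (_ , eq) → a₁≢0 (trans (sym (at-infinite ω z)) eq))
      apex≤1)

  module AtInfinity (a₀ : Carrier) (a₀≢0 : a₀ ≢ 0#) where
    private
      L : Vec Carrier 4
      L = a₀ ∷ 0# ∷ 0# ∷ 0# ∷ []

      at-affine : ∀ x y z → dot L (1# ∷ x ∷ y ∷ z ∷ []) ≡ a₀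
      at-affine x y z = solve 4 (λ a₀ x y z → a₀ :* con true :+ (con false :* x :+ (con false :* y :+ (con false :* z :+ con false))) := a₀) refl a₀ x y z

      -- At infinity the surface is a cone with the apex as vertex: each of at most q + 1 ratios
      -- gives a line with q² points besides the apex.
      size : 0 ℕ.+ ((1 ℕ.+ q) ℕ.* n ℕ.+ 1) ≡ planeSize
      size = trans (cong (ℕ._+ 1) (trans (ℕ.+-comm n (q ℕ.* n)) (cong (ℕ._+ n) (ℕ.*-comm q n)))) (ℕ.+-assoc (n ℕ.* q) n 1)

    bound : AtMost planeSize (OnSection L)
    bound = atMost-≤ (ℕ.≤-reflexive size) (atMost-Normal {P = OnSection L}
      (atMost-0 λ (x , y , z) (_ , eq) → a₀≢0 (trans (sym (at-affine x y z)) eq))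
      (atMost-along {Q = λ (ω , _) → ω ^ D ≡ 1# × ⊤} (λ (ω , z) _ → ω , z) (λ _ (on , _) → on , tt) (λ _ _ eq → eq)
        (atMost-× roots-of-unity-count (atMost-↔ enumeration)))
      apex≤1)

  -- The cases are distinguished by the last nonzero coefficient, which is the one that can be
  -- solved for.
  section-bound : ∀ L → L ≢ 0ᵛ → AtMost planeSize (OnSection L)
  section-bound (a₀ ∷ a₁ ∷ a₂ ∷ a₃ ∷ []) L≢0 = by-a₃ a₃ (a₃ ≟ 0#) L≢0
    where
    by-a₁ : ∀ a₁ → Dec (a₁ ≡ 0#) → a₀ ∷ a₁ ∷ 0# ∷ 0# ∷ [] ≢ 0ᵛ → AtMost planeSize (OnSection (a₀ ∷ a₁ ∷ 0# ∷ 0# ∷ []))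
    by-a₁ a₁ (no a₁≢0)  L≢0 = ThroughApex₁.bound a₀ a₁ a₁≢0
    by-a₁ _  (yes refl) L≢0 = AtInfinity.bound a₀ λ a₀≡0 → L≢0 (cong (_∷ 0# ∷ 0# ∷ 0# ∷ []) a₀≡0)
    by-a₂ : ∀ a₂ → Dec (a₂ ≡ 0#) → a₀ ∷ a₁ ∷ a₂ ∷ 0# ∷ [] ≢ 0ᵛ → AtMost planeSize (OnSection (a₀ ∷ a₁ ∷ a₂ ∷ 0# ∷ []))
    by-a₂ a₂ (no a₂≢0)  L≢0 = ThroughApex₂.bound a₀ a₁ a₂ a₂≢0
    by-a₂ _  (yes refl) L≢0 = by-a₁ a₁ (a₁ ≟ 0#) L≢0
    by-a₃ : ∀ a₃ → Dec (a₃ ≡ 0#) → a₀ ∷ a₁ ∷ a₂ ∷ a₃ ∷ [] ≢ 0ᵛ → AtMost planeSize (OnSection (a₀ ∷ a₁ ∷ a₂ ∷ a₃ ∷ []))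
    by-a₃ a₃ (no a₃≢0)  L≢0 = OffApex.bound a₀ a₁ a₂ a₃ a₃≢0
    by-a₃ _  (yes refl) L≢0 = by-a₂ a₂ (a₂ ≟ 0#) L≢0

-- Transfer to the listed points, extremal sections, and the weights

module SurfaceCode {e : ℕ} {K : FiniteField ((2 ℕ.^ e) ℕ.^ 2)} (generator : QuadraticGenerator e K) (1≤e : 1 ≤ e) (odd : ¬ (2 ∣ e))
  (N : ℕ) (enum : Over.Enumeration K {3} N (Over.𝒱 K e (QuadraticGenerator.ε generator) 3)) where
  open NormalForms generator 1≤e odd
  open ≡-Reasoning

  private
    module Points = Setoid (points (𝒱 e ε 3))

    point : Fin N → Points.Carrier
    point = Bijection.to enum

  P : Fin N → Vec Carrier 4
  P = proj₁ ∘ point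

  P-injective : ∀ {i j} → P i ∼ P j → i ≡ j
  P-injective = Bijection.injective enum

  private
    normalPoint : ∀ w → OnSurface w → Points.Carrier
    normalPoint w on = toVec w , toVec≢0 w , Equivalence.from (onSurface⇔ w) on

    normalForm : ∀ i → Normalized (P i)
    normalForm i = normalize (P i) (proj₁ (proj₂ (point i))) (proj₂ (proj₂ (point i)))

    normal : Fin N → Normal
    normal i = proj₁ (normalForm i)

    P∼normal : ∀ i → P i ∼ toVec (normal i)
    P∼normal i = proj₁ (proj₂ (normalForm i))

    normal-on : ∀ i → OnSurface (normal i)
    normal-on i = proj₂ (proj₂ (normalForm i))

    normal-injective : ∀ {i j} → normal i ≡ normal j → i ≡ j
    normal-injective {i} {j} eq = P-injective (Points.trans {point i} {normalPoint (normal j) (normal-on j)} {point j}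
      (subst (λ w → P i ∼ toVec w) eq (P∼normal i))
      (Points.sym {point j} {normalPoint (normal j) (normal-on j)} (P∼normal j)))

    index : ∀ w → OnSurface w → Fin N
    index w on = proj₁ (Bijection.surjective enum (normalPoint w on))

    P∼index : ∀ w on → P (index w on) ∼ toVec w
    P∼index w on = proj₂ (Bijection.surjective enum (normalPoint w on)) refl

    index-injective : ∀ {w w′ on on′} → index w on ≡ index w′ on′ → w ≡ w′
    index-injective {w} {w′} {on} {on′} eq = ∼⇒≡ w w′ (Points.trans {normalPoint w on} {point (index w on)} {normalPoint w′ on′}
      (Points.sym {point (index w on)} {normalPoint w on} (P∼index w on))
      (subst (λ i → P i ∼ toVec w′) (sym eq) (P∼index w′ on′)))

    dot-∼ : ∀ L {x y : Vec Carrier 4} → x ∼ y → dot L x ≡ 0# ⇔ dot L y ≡ 0#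
    dot-∼ L {x} (c , c≢0 , refl) = mk⇔
      (λ eq → trans (dot-·ʳ c L x) (trans (cong (c *_) eq) (zeroʳ c)))
      (λ eq → no-zero-divisors c≢0 (trans (sym (dot-·ʳ c L x)) eq))

  open EvaluationCode P public
  open Elimination.ProjectivePoints K P (λ i → proj₁ (proj₂ (point i))) P-injective using (points-atMost; lines-atMost)

  plane-sections : SectionsAtMost 1 planeSize
  plane-sections (L ∷ []) independent = atMost-along (λ i _ → normal i)
    (λ i vanish → normal-on i , Equivalence.to (dot-∼ L (P∼normal i)) (vanish zero))
    (λ _ _ → normal-injective) (section-bound L (independent⇒≢0 independent))

  line-sections : SectionsAtMost 2 lineSize
  line-sections = lines-atMost 2 refl

  point-sections : SectionsAtMost 3 1
  point-sections = points-atMost 3 refl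

  private
    section : ∀ {m B} {A : Set} (forms : Vec (Vec Carrier 4) m) → LinearlyIndependent forms → Fin B ↔ A →
              (g : A → Normal) → Injective _≡_ _≡_ g → (∀ a → OnSurface (g a)) →
              (∀ a j → dot (lookup forms j) (toVec (g a)) ≡ 0#) → Section m B
    section forms independent A↔ g g-injective on vanish = record
      { forms       = forms
      ; independent = independent
      ; index       = λ b → index (g (Inverse.to A↔ b)) (on (Inverse.to A↔ b))
      ; injective   = λ {b} {b′} eq → Injection.injective (Inverse.↔⇒↣ A↔) (g-injective
          (index-injective {on = on (Inverse.to A↔ b)} {on′ = on (Inverse.to A↔ b′)} eq))
      ; vanish      = λ b j → Equivalence.from (dot-∼ (lookup forms j) (P∼index _ (on (Inverse.to A↔ b)))) (vanish (Inverse.to A↔ b) j)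
      }

    e₀ e₁ e₂ e₁+e₂ : Vec Carrier 4
    e₀ = 1# ∷ 0# ∷ 0# ∷ 0# ∷ []
    e₁ = 0# ∷ 1# ∷ 0# ∷ 0# ∷ []
    e₂ = 0# ∷ 0# ∷ 1# ∷ 0# ∷ []
    e₁+e₂ = 0# ∷ 1# ∷ 1# ∷ 0# ∷ []

    dot-e₀ : ∀ x₀ x₁ x₂ x₃ → dot e₀ (x₀ ∷ x₁ ∷ x₂ ∷ x₃ ∷ []) ≡ x₀
    dot-e₀ = solve 4 (λ x₀ x₁ x₂ x₃ → con true :* x₀ :+ (con false :* x₁ :+ (con false :* x₂ :+ (con false :* x₃ :+ con false))) := x₀) refl

    dot-e₁ : ∀ x₀ x₁ x₂ x₃ → dot e₁ (x₀ ∷ x₁ ∷ x₂ ∷ x₃ ∷ []) ≡ x₁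
    dot-e₁ = solve 4 (λ x₀ x₁ x₂ x₃ → con false :* x₀ :+ (con true :* x₁ :+ (con false :* x₂ :+ (con false :* x₃ :+ con false))) := x₁) refl

    dot-e₂ : ∀ x₀ x₁ x₂ x₃ → dot e₂ (x₀ ∷ x₁ ∷ x₂ ∷ x₃ ∷ []) ≡ x₂
    dot-e₂ = solve 4 (λ x₀ x₁ x₂ x₃ → con false :* x₀ :+ (con false :* x₁ :+ (con true :* x₂ :+ (con false :* x₃ :+ con false))) := x₂) refl

    dot-e₁+e₂ : ∀ x₀ x₁ x₂ x₃ → dot e₁+e₂ (x₀ ∷ x₁ ∷ x₂ ∷ x₃ ∷ []) ≡ x₁ + x₂
    dot-e₁+e₂ = solve 4 (λ x₀ x₁ x₂ x₃ → con false :* x₀ :+ (con true :* x₁ :+ (con true :* x₂ :+ (con false :* x₃ :+ con false))) := x₁ :+ x₂) refl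

    entry : ∀ {m} {as : Vec Carrier m} {Ls : Vec (Vec Carrier 4) m} → linearCombination as Ls ≡ 0ᵛ → ∀ i → dot as (Vec.map (λ L → lookup L i) Ls) ≡ 0#
    entry {as = as} {Ls} eq i = trans (sym (lookup-linearCombination as Ls i)) (trans (cong (λ v → lookup v i) eq) (Vec.lookup-replicate i 0#))

  -- On X₁ = X₂ the two values of γ cancel, and the equation becomes im z = 0: x is arbitrary and z
  -- lies in F. At infinity ω = 1 is a root of unity for every z, and the apex completes the count.
  plane-section : Section 1 planeSize
  plane-section = section (e₁+e₂ ∷ []) (independent-single λ eq → 1≢0 (cong (λ v → lookup v (suc zero)) eq)) shape g g-injective on vanish
    where
    Shape : Set
    Shape = (Carrier × F) ⊎ (Carrier ⊎ ⊤)
    shape : Fin planeSize ↔ Shape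
    shape = Inverse.↔-trans Fin.+↔⊎ (Inverse.↔-trans Fin.*↔× (enumeration ×-↔ F-enumeration) ⊎-↔
      Inverse.↔-trans Fin.+↔⊎ (enumeration ⊎-↔ Fin.1↔⊤))
    g : Shape → Normal
    g (inj₁ (x , a))  = affine x x (val a)
    g (inj₂ (inj₁ z)) = atInfinity 1# z
    g (inj₂ (inj₂ _)) = apex
    g-injective : Injective _≡_ _≡_ g
    g-injective {inj₁ (x , a)}  {inj₁ (y , b)}  eq = let (x≡y , val≡) = affine-injective eq in
      cong inj₁ (cong₂ _,_ x≡y (F-≡ val≡))
      where
      affine-injective : ∀ {x y z x′ y′ z′} → affine x y z ≡ affine x′ y′ z′ → x ≡ x′ × z ≡ z′
      affine-injective refl = refl , refl
    g-injective {inj₂ (inj₁ _)} {inj₂ (inj₁ _)} refl = refl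
    g-injective {inj₂ (inj₂ _)} {inj₂ (inj₂ _)} eq = refl
    g-injective {inj₁ _}        {inj₂ (inj₁ _)} ()
    g-injective {inj₁ _}        {inj₂ (inj₂ _)} ()
    g-injective {inj₂ (inj₁ _)} {inj₁ _}        ()
    g-injective {inj₂ (inj₁ _)} {inj₂ (inj₂ _)} ()
    g-injective {inj₂ (inj₂ _)} {inj₁ _}        ()
    g-injective {inj₂ (inj₂ _)} {inj₂ (inj₁ _)} ()
    on : ∀ a → OnSurface (g a)
    on (inj₁ (x , a))  = trans (im≡0 (val-InF a)) (sym (x+x≡0 (γ x)))
    on (inj₂ (inj₁ z)) = 1^k≡1 D
    on (inj₂ (inj₂ _)) = tt
    vanish : ∀ a j → dot (lookup (e₁+e₂ ∷ []) j) (toVec (g a)) ≡ 0#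
    vanish (inj₁ (x , a))  zero = trans (dot-e₁+e₂ 1# x x (val a)) (x+x≡0 x)
    vanish (inj₂ (inj₁ z)) zero = trans (dot-e₁+e₂ 0# 1# 1# z) (x+x≡0 1#)
    vanish (inj₂ (inj₂ _)) zero = trans (dot-e₁+e₂ 0# 0# 0# 1#) (x+x≡0 0#)

  -- The line X₀ = 0, X₁ = X₂ lies entirely on the surface, so it attains the number of points of a
  -- line.
  line-section : Section 2 lineSize
  line-section = section (e₀ ∷ e₁+e₂ ∷ []) independent shape g g-injective on vanish
    where
    independent : LinearlyIndependent (e₀ ∷ e₁+e₂ ∷ [])
    independent (a ∷ b ∷ []) eq = cong₂ (λ a b → a ∷ b ∷ [])
      (trans (solve 2 (λ a b → a := a :* con true :+ (b :* con false :+ con false)) refl a b) (entry {as = a ∷ b ∷ []} {e₀ ∷ e₁+e₂ ∷ []} eq zero))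
      (trans (solve 2 (λ a b → b := a :* con false :+ (b :* con true :+ con false)) refl a b) (entry {as = a ∷ b ∷ []} {e₀ ∷ e₁+e₂ ∷ []} eq (suc zero)))
    shape : Fin lineSize ↔ (Carrier ⊎ ⊤)
    shape = Inverse.↔-trans Fin.+↔⊎ (enumeration ⊎-↔ Fin.1↔⊤)
    g : Carrier ⊎ ⊤ → Normal
    g (inj₁ z) = atInfinity 1# z
    g (inj₂ _) = apex
    g-injective : Injective _≡_ _≡_ g
    g-injective {inj₁ _} {inj₁ _} refl = refl
    g-injective {inj₂ _} {inj₂ _} refl = refl
    on : ∀ a → OnSurface (g a)
    on (inj₁ z) = 1^k≡1 D
    on (inj₂ _) = tt
    vanish : ∀ a j → dot (lookup (e₀ ∷ e₁+e₂ ∷ []) j) (toVec (g a)) ≡ 0#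
    vanish (inj₁ z) zero       = dot-e₀ 0# 1# 1# z
    vanish (inj₁ z) (suc zero) = trans (dot-e₁+e₂ 0# 1# 1# z) (x+x≡0 1#)
    vanish (inj₂ _) zero       = dot-e₀ 0# 0# 0# 1#
    vanish (inj₂ _) (suc zero) = trans (dot-e₁+e₂ 0# 0# 0# 1#) (x+x≡0 0#)

  point-section : Section 3 1
  point-section = section (e₀ ∷ e₁ ∷ e₂ ∷ []) independent Fin.1↔⊤ (λ _ → apex) (λ _ → refl) _
    λ { _ zero → dot-e₀ 0# 0# 0# 1# ; _ (suc zero) → dot-e₁ 0# 0# 0# 1# ; _ (suc (suc zero)) → dot-e₂ 0# 0# 0# 1# }
    where
    independent : LinearlyIndependent (e₀ ∷ e₁ ∷ e₂ ∷ [])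
    independent (a ∷ b ∷ c ∷ []) eq = trans (cong₂ (λ a b → a ∷ b ∷ c ∷ [])
      (trans (solve 3 (λ a b c → a := a :* con true :+ (b :* con false :+ (c :* con false :+ con false))) refl a b c) (entries zero))
      (trans (solve 3 (λ a b c → b := a :* con false :+ (b :* con true :+ (c :* con false :+ con false))) refl a b c) (entries (suc zero))))
      (cong (λ c → 0# ∷ 0# ∷ c ∷ [])
      (trans (solve 3 (λ a b c → c := a :* con false :+ (b :* con false :+ (c :* con true :+ con false))) refl a b c) (entries (suc (suc zero)))))
      where
      entries = entry {as = a ∷ b ∷ c ∷ []} {e₀ ∷ e₁ ∷ e₂ ∷ []} eq

  -- The apex and points over (x₁ , x₂) = (0 , 0), (1 , 0), (0 , 1) span the space.
  nondegenerate : ∀ L → (∀ i → dot L (P i) ≡ 0#) → L ≡ 0ᵛ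
  nondegenerate (a₀ ∷ a₁ ∷ a₂ ∷ a₃ ∷ []) vanish = trans
    (cong₂ (λ s t → s ∷ t ∷ a₂ ∷ a₃ ∷ []) a₀≡0 a₁≡0) (cong₂ (λ s t → 0# ∷ 0# ∷ s ∷ t ∷ []) a₂≡0 a₃≡0)
    where
    L : Vec Carrier 4
    L = a₀ ∷ a₁ ∷ a₂ ∷ a₃ ∷ []
    normal-vanish : ∀ w → OnSurface w → dot L (toVec w) ≡ 0#
    normal-vanish w on = Equivalence.to (dot-∼ L (P∼index w on)) (vanish (index w on))
    a₃≡0 : a₃ ≡ 0#
    a₃≡0 = trans (solve 4 (λ a₀ a₁ a₂ a₃ → a₃ := a₀ :* con false :+ (a₁ :* con false :+ (a₂ :* con false :+ (a₃ :* con true :+ con false)))) refl a₀ a₁ a₂ a₃)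
      (normal-vanish apex tt)
    over : ∀ x y → a₀ + (a₁ * x + a₂ * y) ≡ 0#
    over x y = begin
      a₀ + (a₁ * x + a₂ * y)                                  ≡⟨ solve 4 (λ a₀ s t z → a₀ :+ (s :+ t) := a₀ :* con true :+ (s :+ (t :+ (con false :* z :+ con false)))) refl a₀ (a₁ * x) (a₂ * y) z ⟩
      a₀ * 1# + (a₁ * x + (a₂ * y + (0# * z + 0#)))           ≡⟨ cong (λ t → a₀ * 1# + (a₁ * x + (a₂ * y + (t * z + 0#)))) a₃≡0 ⟨
      dot L (toVec (affine x y z))                            ≡⟨ normal-vanish (affine x y z) on ⟩
      0#                                                      ∎
      where
      v = γ x + γ y
      -- The value `v` lies in the subfield and im ε = 1, so this height solves im z = v.
      z = v * ε
      on : im z ≡ v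
      on = trans (im-*ˡ (+-InF (γ-InF x) (γ-InF y)) ε) (trans (cong (v *_) im[ε]≡1) (*-identityʳ v))
    a₀≡0 : a₀ ≡ 0#
    a₀≡0 = trans (solve 3 (λ a₀ a₁ a₂ → a₀ := a₀ :+ (a₁ :* con false :+ a₂ :* con false)) refl a₀ a₁ a₂) (over 0# 0#)
    a₁≡0 : a₁ ≡ 0#
    a₁≡0 = trans (solve 3 (λ a₀ a₁ a₂ → a₁ := a₀ :+ (a₀ :+ (a₁ :* con true :+ a₂ :* con false))) refl a₀ a₁ a₂)
      (trans (cong₂ _+_ a₀≡0 (over 1# 0#)) (x+x≡0 0#))
    a₂≡0 : a₂ ≡ 0#
    a₂≡0 = trans (solve 3 (λ a₀ a₁ a₂ → a₂ := a₀ :+ (a₀ :+ (a₁ :* con false :+ a₂ :* con true))) refl a₀ a₁ a₂)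
      (trans (cong₂ _+_ a₀≡0 (over 0# 1#)) (x+x≡0 0#))

  open Weights nondegenerate public

  N∸planeSize : N ∸ planeSize ≡ N ∸ q ℕ.^ 3 ∸ q ℕ.^ 2 ∸ 1
  N∸planeSize = begin
    N ∸ (n ℕ.* q ℕ.+ (n ℕ.+ 1))         ≡⟨ ℕ.∸-+-assoc N (n ℕ.* q) (n ℕ.+ 1) ⟨
    N ∸ n ℕ.* q ∸ (n ℕ.+ 1)             ≡⟨ ℕ.∸-+-assoc (N ∸ n ℕ.* q) n 1 ⟨
    N ∸ n ℕ.* q ∸ n ∸ 1                 ≡⟨ cong (λ m → N ∸ m ∸ n ∸ 1) (ℕ.*-comm n q) ⟩
    N ∸ q ℕ.^ 3 ∸ q ℕ.^ 2 ∸ 1           ∎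

  N∸lineSize : N ∸ lineSize ≡ N ∸ q ℕ.^ 2 ∸ 1
  N∸lineSize = sym (ℕ.∸-+-assoc N n 1)

corollary3p6 : ∀ (e : ℕ) → 3 ≤ e → ¬ (2 ∣ e) →
    let q = 2 ℕ.^ e in
    (K : FiniteField (q ℕ.^ 2)) →
    let open FiniteField K
        open Over K
    in
    (ε δ : Carrier) →
    ¬ InSubfield q ε →
    InSubfield q δ →
    δ ≢ 1# →
    absoluteTrace e δ ≡ 1# →
    ε * ε + ε + δ ≡ 0# →
    (N : ℕ) (enum : Enumeration N (𝒱 e ε 3)) →
    let C = codeOf enum in
    IsLinear C
    × HasDimension C 4
    × IsMinimumDistance C (N ∸ q ℕ.^ 3 ∸ q ℕ.^ 2 ∸ 1)
    × IsGeneralizedWeight C 1 (N ∸ q ℕ.^ 3 ∸ q ℕ.^ 2 ∸ 1)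
    × IsGeneralizedWeight C 2 (N ∸ q ℕ.^ 2 ∸ 1)
    × IsGeneralizedWeight C 3 (N ∸ 1)
corollary3p6 e 3≤e odd K ε δ ε∉F δ∈F _ tr[δ]≡1 ε²+ε+δ≡0 N enum =
  LinearAlgebra.span-isLinear K rows
  , dimension
  , subst (IsMinimumDistance C) N∸planeSize (minimumDistance plane-sections plane-section)
  , subst (IsGeneralizedWeight C 1) N∸planeSize (generalizedWeight plane-sections plane-section)
  , subst (IsGeneralizedWeight C 2) N∸lineSize (generalizedWeight line-sections line-section)
  , generalizedWeight point-sections point-section
  where
  open Over K using (IsMinimumDistance; IsGeneralizedWeight)
  generator : QuadraticGenerator e K
  generator = record { ε = ε ; δ = δ ; ε∉F = ε∉F ; δ∈F = δ∈F ; tr[δ]≡1 = tr[δ]≡1 ; ε²+ε+δ≡0 = ε²+ε+δ≡0 }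
  open SurfaceCode generator (ℕ.≤-trans (s≤s z≤n) 3≤e) odd N enum
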